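{- Let $\mathcal{L}:\sum_{i\in[k]}c_ix_i=0$ with $k\ge3$ and $c_1,\dots,c_k\in\mathbb{Z}\setminus\{0\}$ be degenerate, i.e. there exists a non-empty $S\subseteq[k]$ with $\sum_{s\in S}c_s=0$. Then for every $\varepsilon>0$, $$d(\mathcal{L},\varepsilon)\le 100^{k+1}k^3\varepsilon.$$
   Context: For a prime $p$, a set $A\subseteq\mathbb{F}_p$ is solution-free for $\mathcal{L}$ if there is no $k$-tuple of pairwise distinct elements $a_1,\dots,a_k\in A$ with $\sum_i c_ia_i=0$ in $\mathbb{F}_p$. The Cayley graph $\mathrm{Cay}_{\mathbb{F}_p}(A)$ is the digraph on $\mathbb{F}_p$ with an arc $\vec{uv}$ iff $v-u\in A$; $\alpha$ of a digraph is the independence number of its underlying undirected graph. $D(\mathcal{L},\varepsilon,p)$ is the maximum size of a solution-free set $A$ of $\mathcal{L}$ in $\mathbb{F}_p$ with $\alpha(\mathrm{Cay}_{\mathbb{F}_p}(A))\le\varepsilon p$, and $d(\mathcal{L},\varepsilon):=\limsup_{p\to\infty,\ p\text{ prime}} D(\mathcal{L},\varepsilon,p)/p$. -}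

module Defs where

open import Data.Nat using (ℕ; zero; suc)
open import Data.Integer as ℤ using (ℤ; +_)
open import Data.Integer.Divisibility using (_∣_)
open import Data.Fin using (Fin; toℕ)
open import Data.Fin.Subset using (Subset; _∈_; ∣_∣; Nonempty)
open import Data.Product using (Σ; _×_; ∃)
open import Data.Rational as ℚ using (ℚ; _/_)
open import Relation.Binary.PropositionalEquality using (_≡_; _≢_)
open import Relation.Nullary using (¬_)
open import Function.Definitions using (Injective)

Σℤ : (k : ℕ) → (Fin k → ℤ) → ℤ
Σℤ zero    f = + 0
Σℤ (suc k) f = f Fin.zero ℤ.+ Σℤ k (λ i → f (Fin.suc i))

Σℤ-over : (k : ℕ) → Subset k → (Fin k → ℤ) → ℤ
Σℤ-over k S c = Σℤ k (λ i → c⁺ i)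
  where
    open import Data.Bool using (true; false)
    open import Data.Vec using (lookup)
    c⁺ : Fin k → ℤ
    c⁺ i with lookup S i
    ... | true  = c i
    ... | false = + 0

Degenerate : (k : ℕ) → (Fin k → ℤ) → Set
Degenerate k c = Σ (Subset k) λ S → Nonempty S × Σℤ-over k S c ≡ + 0

-- Elements of F_p are represented by Fin p (residues 0..p-1).
-- A ⊆ F_p is solution-free for L: no injective (pairwise distinct) tuple
-- a : Fin k → A with Σ c_i a_i ≡ 0 (mod p).
SolutionFree : (k : ℕ) → (Fin k → ℤ) → (p : ℕ) → Subset p → Set
SolutionFree k c p A =
  ¬ (Σ (Fin k → Fin p) λ a →
       Injective _≡_ _≡_ a × (∀ i → a i ∈ A) ×
       ((+ p) ∣ Σℤ k (λ i → c i ℤ.* (+ toℕ (a i)))))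

Arc : (p : ℕ) → Subset p → Fin p → Fin p → Set
Arc p A u v = ∃ λ a → a ∈ A × ((+ p) ∣ ((+ toℕ v) ℤ.- (+ toℕ u) ℤ.- (+ toℕ a)))

-- Independent set of the underlying undirected graph of Cay(A):
-- no two distinct vertices of I are joined by an arc (in either direction;
-- loops are ignored).
Independent : (p : ℕ) → Subset p → Subset p → Set
Independent p A I = ∀ u v → u ∈ I → v ∈ I → u ≢ v → ¬ Arc p A u v

toℚ : ℕ → ℚ
toℚ n = (+ n) / 1

αCay≤ : (p : ℕ) → Subset p → ℚ → Set
αCay≤ p A ε = ∀ I → Independent p A I → toℚ ∣ I ∣ ℚ.≤ ε ℚ.* toℚ p

{-# OPTIONS --safe #-}
module Submission where

-- Let c′ be the restriction of c to the zero-sum set S. If c′ has at least three non-zero coefficients, Roth's theorem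
-- for the invariant equation c′ (proved by Szemerédi's density increment with Hilbert cubes) shows that all but o(p)
-- elements of A split into disjoint solutions of c′ in A; if it has two, single elements of A serve as constant
-- solutions. Fix s in S. For solutions x, x′ from this family, replacing the entry x_s by x′_s changes the value of the
-- equation from 0 to c_s (x′_s − x_s). Every set of more than ε p residues spans an arc of each dilate Cay(λ A), so
-- discarding few elements per step one finds a walk x = x⁰, …, x′ in the family with
-- c_s (xʲ⁺¹_s − xʲ_s) = − c_i z_i, z_i ∈ A, one step for each i outside S; its total is a solution of the equation.
-- Distinctness costs only a bounded number of forbidden pairs per vertex, hence a factor linear in k by a greedy
-- independent set.

open import Defs
import Algebra.Properties.AbelianGroup
open import Data.Bool using (Bool; true; false; T; _∧_; _∨_; not; if_then_else_)
open import Data.Empty using (⊥; ⊥-elim)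
open import Data.Fin using (Fin; _≟_; toℕ; fromℕ<; inject≤; combine; remQuot) renaming (zero to fzero; suc to fsuc)
open import Data.Fin.Patterns using (0F; 1F; 2F; 3F; 4F)
open import Data.Fin.Properties using (toℕ-injective; toℕ<n; toℕ-fromℕ<; toℕ-inject≤; remQuot-combine; any?) renaming (suc-injective to fsuc-injective; 0≢1+n to fzero≢fsuc)
open import Data.Fin.Subset using (Subset; ∣_∣; _∈_; Nonempty; inside) renaming (⊥ to ∅)
open import Data.Fin.Subset.Properties using (∉⊥; ∣p∣≤n)
open import Data.Integer as ℤ using (ℤ; +_; -[1+_])
import Data.Integer.DivMod as ℤDivMod
open import Data.Integer.Divisibility.Signed using (_∣_; divides; ∣ᵤ⇒∣; ∣⇒∣ᵤ; ∣m∣n⇒∣m+n; ∣m∣n⇒∣m-n; ∣n⇒∣m*n; ∣m⇒∣-m; ∣-refl)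
import Data.Integer.Properties as ℤₚ
import Data.Integer.Tactic.RingSolver as ℤSolver
open import Data.Nat as ℕ using (ℕ; zero; suc; _+_; _*_; _^_; _∸_; _≤_; _<_; z≤n; s≤s; _≤?_; _<?_; NonZero; >-nonZero)
open import Data.Nat.Coprimality using (prime⇒coprime; coprime-Bézout)
import Data.Nat.Divisibility as ℕ∣
open import Data.Nat.DivMod using (_/_; _%_; m≡m%n+[m/n]*n; m%n<n)
open import Data.Nat.GCD using (module Bézout)
open import Data.Nat.Primality using (Prime; euclidsLemma; prime⇒nonZero)
open import Data.Nat.Properties hiding (_≟_)
open import Algebra.Properties.CommutativeSemigroup *-commutativeSemigroup using (x∙yz≈y∙xz)
open import Data.Nat.Tactic.RingSolver using (solve-∀)
open import Data.Product using (Σ; _×_; _,_; proj₁; proj₂)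
open import Data.Rational as ℚ using (ℚ; 0ℚ; mkℚ)
import Data.Rational.Properties as ℚₚ
open import Data.Rational.Unnormalised as ℚᵘ using (mkℚᵘ; *≡*; *≤*)
import Data.Rational.Unnormalised.Properties as ℚᵘₚ
open import Data.Sum using (_⊎_; inj₁; inj₂)
open import Data.Unit using (tt)
open import Data.Vec using ([]; _∷_; lookup; _[_]≔_; here; there)
open import Data.Vec.Properties using ([]=⇒lookup)
open import Function using (_∘_)
open import Function.Definitions using (Injective)
open import Relation.Binary.PropositionalEquality
open import Relation.Nullary using (¬_; Dec; yes; no; contradiction; does; ¬?; _×-dec_)
open import Relation.Nullary.Decidable using (dec-true; decidable-stable; ¬¬-excluded-middle)

-- The limsup is handled through a slack δ: for every δ > 0 all large p satisfy the bound with δ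
-- added, and the error of Roth's theorem disappears in δ. The main term is a product of three
-- factors: at most k steps of a walk, each discarding at most (10 k + 1) r solutions, where r
-- bounds the independent sets, and k elements of A in each solution. Roth's theorem is proved over
-- the integers only. An integer solution with entries below p is also a solution modulo p, so
-- intervals and progressions never wrap around. The induction runs on an upper bound: a density
-- bound u / M for solution-free sets is lowered to (u - 1) / M with M fixed, so that the iteration
-- is a descent on a natural number and needs no limiting density. Walks are built from their last
-- step backwards, because a step can only be prepended to a walk that is already known. Neither
-- walks nor solutions are searched for; the claims are inequalities between natural numbers, which
-- are stable under double negation.

module ℤ-group = Algebra.Properties.AbelianGroup ℤₚ.+-0-abelianGroup

-- Sums over initial segments of ℕ

-- A linear inequality follows from x ≤ y once the slack s is named; the equation is left to the ring solver.
linear : ∀ {x y X Y} s → x ≤ y → X + y + s ≡ Y + x → X ≤ Y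
linear {x} {y} {X} {Y} s x≤y e = +-cancelʳ-≤ y X Y (begin
  X + y      ≤⟨ m≤m+n (X + y) s ⟩
  X + y + s  ≡⟨ e ⟩
  Y + x      ≤⟨ +-monoʳ-≤ Y x≤y ⟩
  Y + y      ∎)
  where open ≤-Reasoning

scale : ∀ m {x y} → x ≤ y → m * x ≤ m * y
scale m = *-monoʳ-≤ m

∑ : ℕ → (ℕ → ℕ) → ℕ
∑ zero    g = 0
∑ (suc n) g = g 0 + ∑ n (λ i → g (suc i))

∑-mono : ∀ n {g h : ℕ → ℕ} → (∀ i → i < n → g i ≤ h i) → ∑ n g ≤ ∑ n h
∑-mono zero    le = z≤n
∑-mono (suc n) le = +-mono-≤ (le 0 (s≤s z≤n)) (∑-mono n (λ i i<n → le (suc i) (s≤s i<n)))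

∑-cong : ∀ n {g h : ℕ → ℕ} → (∀ i → g i ≡ h i) → ∑ n g ≡ ∑ n h
∑-cong zero    e = refl
∑-cong (suc n) e = cong₂ _+_ (e 0) (∑-cong n (λ i → e (suc i)))

∑-+ : ∀ n (g h : ℕ → ℕ) → ∑ n (λ i → g i + h i) ≡ ∑ n g + ∑ n h
∑-+ zero    g h = refl
∑-+ (suc n) g h = trans (cong (λ z → g 0 + h 0 + z) (∑-+ n (g ∘ suc) (h ∘ suc)))
  (interchange (g 0) (h 0) (∑ n (g ∘ suc)) (∑ n (h ∘ suc)))
  where
  interchange : ∀ a b c d → a + b + (c + d) ≡ a + c + (b + d)
  interchange = solve-∀

∑-* : ∀ n m (g : ℕ → ℕ) → ∑ n (λ i → m * g i) ≡ m * ∑ n g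
∑-* zero    m g = sym (*-zeroʳ m)
∑-* (suc n) m g = trans (cong (λ z → m * g 0 + z) (∑-* n m (g ∘ suc))) (sym (*-distribˡ-+ m (g 0) _))

∑-const : ∀ n c → ∑ n (λ _ → c) ≡ n * c
∑-const zero    c = refl
∑-const (suc n) c = cong (λ z → c + z) (∑-const n c)

∑-split : ∀ m n (g : ℕ → ℕ) → ∑ (m + n) g ≡ ∑ m g + ∑ n (λ i → g (m + i))
∑-split zero    n g = refl
∑-split (suc m) n g = trans (cong (λ z → g 0 + z) (∑-split m n (g ∘ suc))) (sym (+-assoc (g 0) _ _))

∑-swap : ∀ m n (g : ℕ → ℕ → ℕ) → ∑ m (λ i → ∑ n (g i)) ≡ ∑ n (λ j → ∑ m (λ i → g i j))
∑-swap zero    n g = sym (trans (∑-const n 0) (*-zeroʳ n))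
∑-swap (suc m) n g = trans (cong (λ z → ∑ n (g 0) + z) (∑-swap m n (g ∘ suc))) (sym (∑-+ n (g 0) _))

∑-blocks : ∀ n ℓ (g : ℕ → ℕ) → ∑ (n * ℓ) g ≡ ∑ n (λ i → ∑ ℓ (λ j → g (i * ℓ + j)))
∑-blocks zero    ℓ g = refl
∑-blocks (suc n) ℓ g = trans (∑-split ℓ (n * ℓ) g) (cong (λ z → ∑ ℓ g + z)
  (trans (∑-blocks n ℓ (λ i → g (ℓ + i)))
    (∑-cong n (λ i → ∑-cong ℓ (λ j → cong g (sym (+-assoc ℓ (i * ℓ) j)))))))

∑-classes : ∀ n q (g : ℕ → ℕ) → ∑ (n * q) g ≡ ∑ q (λ r → ∑ n (λ t → g (r + t * q)))
∑-classes n q g = trans (∑-blocks n q g) (trans (∑-swap n q _)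
  (∑-cong q (λ r → ∑-cong n (λ t → cong g (+-comm (t * q) r)))))

∑-≤const : ∀ n c {g : ℕ → ℕ} → (∀ i → i < n → g i ≤ c) → ∑ n g ≤ n * c
∑-≤const n c le = ≤-trans (∑-mono n le) (≤-reflexive (∑-const n c))

∑-prefix : ∀ {m n} (g : ℕ → ℕ) → m ≤ n → ∑ m g ≤ ∑ n g
∑-prefix {m} g m≤n with d , refl ← m≤n⇒∃[o]m+o≡n m≤n =
  ≤-trans (m≤m+n _ _) (≤-reflexive (sym (∑-split m d g)))

∑-term : ∀ n (g : ℕ → ℕ) {i} → i < n → g i ≤ ∑ n g
∑-term (suc n) g {zero}  _         = m≤m+n _ _
∑-term (suc n) g {suc i} (s≤s i<n) = ≤-trans (∑-term n (g ∘ suc) i<n) (m≤n+m _ _)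

∑-zero : ∀ n {g : ℕ → ℕ} → (∀ i → i < n → g i ≡ 0) → ∑ n g ≡ 0
∑-zero n z = n≤0⇒n≡0 (≤-trans (∑-≤const n 0 (λ i i<n → ≤-reflexive (z i i<n))) (≤-reflexive (*-zeroʳ n)))

pigeonhole : ∀ n (g h : ℕ → ℕ) → ∑ n g < ∑ n h → Σ ℕ λ i → i < n × g i < h i
pigeonhole (suc n) g h lt with g 0 <? h 0
... | yes p = 0 , s≤s z≤n , p
... | no ¬p with i , i<n , p ← pigeonhole n (g ∘ suc) (h ∘ suc)
      (+-cancelˡ-< (h 0) _ _ (≤-<-trans (+-monoˡ-≤ _ (≮⇒≥ ¬p)) lt)) = suc i , s≤s i<n , p

⟦_⟧ : Bool → ℕ
⟦ true  ⟧ = 1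
⟦ false ⟧ = 0

⟦⟧≤1 : ∀ b → ⟦ b ⟧ ≤ 1
⟦⟧≤1 true  = ≤-refl
⟦⟧≤1 false = z≤n

⟦⟧-mono : ∀ {a b} → (a ≡ true → b ≡ true) → ⟦ a ⟧ ≤ ⟦ b ⟧
⟦⟧-mono {false} f = z≤n
⟦⟧-mono {true} f rewrite f refl = ≤-refl

-- Densities along arithmetic progressions

module APBounds
  (M u ℓ : ℕ) (ℓ>0 : 0 < ℓ) (g : ℕ → ℕ) (g≤1 : ∀ i → g i ≤ 1)
  (ap-bound : ∀ r q → 0 < q → M * ∑ ℓ (λ t → g (r + t * q)) ≤ u * ℓ)
  where

  private instance
    ℓ-nonZero : NonZero ℓ
    ℓ-nonZero = >-nonZero ℓ>0

  -- The error `M * ℓ` pays for the initial piece of fewer than ℓ terms, where only the trivial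
  -- density bound 1 is available.
  long-ap-bound : ∀ r q → 0 < q → ∀ X → M * ∑ X (λ t → g (r + t * q)) ≤ u * X + M * ℓ
  long-ap-bound r q q>0 X = begin
    M * ∑ X h                                                 ≡⟨ cong (λ x → M * ∑ x h) X≡ ⟩
    M * ∑ (ρ + Q * ℓ) h                                       ≡⟨ cong (M *_) (∑-split ρ (Q * ℓ) h) ⟩
    M * (∑ ρ h + ∑ (Q * ℓ) (λ i → h (ρ + i)))                 ≡⟨ *-distribˡ-+ M _ _ ⟩
    M * ∑ ρ h + M * ∑ (Q * ℓ) (λ i → h (ρ + i))               ≤⟨ +-mono-≤ (*-monoʳ-≤ M short) long ⟩
    M * ℓ + u * (Q * ℓ)                                       ≤⟨ +-monoʳ-≤ (M * ℓ) (*-monoʳ-≤ u (m≤n+m (Q * ℓ) ρ)) ⟩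
    M * ℓ + u * (ρ + Q * ℓ)                                   ≡⟨ cong (λ x → M * ℓ + u * x) X≡ ⟨
    M * ℓ + u * X                                             ≡⟨ +-comm (M * ℓ) (u * X) ⟩
    u * X + M * ℓ                                             ∎
    where
    open ≤-Reasoning
    h : ℕ → ℕ
    h t = g (r + t * q)
    ρ Q : ℕ
    ρ = X % ℓ
    Q = X / ℓ
    X≡ : X ≡ ρ + Q * ℓ
    X≡ = m≡m%n+[m/n]*n X ℓ
    short : ∑ ρ h ≤ ℓ
    short = ≤-trans (∑-≤const ρ 1 (λ i _ → g≤1 _)) (≤-trans (≤-reflexive (*-identityʳ ρ)) (<⇒≤ (m%n<n X ℓ)))
    reindex : ∀ r q ρ i ℓ j → r + (ρ + (i * ℓ + j)) * q ≡ (r + (ρ + i * ℓ) * q) + j * q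
    reindex = solve-∀
    long : M * ∑ (Q * ℓ) (λ i → h (ρ + i)) ≤ u * (Q * ℓ)
    long = begin
      M * ∑ (Q * ℓ) (λ i → h (ρ + i))                          ≡⟨ cong (M *_) (∑-blocks Q ℓ (λ i → h (ρ + i))) ⟩
      M * ∑ Q (λ i → ∑ ℓ (λ j → h (ρ + (i * ℓ + j))))          ≡⟨ ∑-* Q M _ ⟨
      ∑ Q (λ i → M * ∑ ℓ (λ j → h (ρ + (i * ℓ + j))))          ≤⟨ ∑-≤const Q (u * ℓ) (λ i _ → ≤-trans
          (≤-reflexive (cong (M *_) (∑-cong ℓ (λ j → cong g (reindex r q ρ i ℓ j)))))
          (ap-bound (r + (ρ + i * ℓ) * q) q q>0)) ⟩
      Q * (u * ℓ)                                              ≡⟨ x∙yz≈y∙xz Q u ℓ ⟩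
      u * (Q * ℓ)                                              ∎

  interval-bound : ∀ a X → M * ∑ X (λ t → g (a + t)) ≤ u * X + M * ℓ
  interval-bound a X = ≤-trans
    (≤-reflexive (cong (M *_) (∑-cong X (λ t → cong (λ s → g (a + s)) (sym (*-identityʳ t))))))
    (long-ap-bound a 1 (s≤s z≤n) X)

  module _ (n : ℕ) (dense : u * n ≤ M * ∑ n g + n) where

    -- A set whose total density is within 1 / M of the upper bound u / M cannot be sparse on an
    -- interval: the pieces before and after it obey the upper bound, each up to `M * ℓ`, and the
    -- interval has to supply the rest.
    interval-dense : ∀ a X → a + X ≤ n → u * X ≤ M * ∑ X (λ t → g (a + t)) + n + 2 * (M * ℓ)
    interval-dense a X aX≤n with b , refl ← m≤n⇒∃[o]m+o≡n aX≤n =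
      conclude b (∑ a g) _ (∑ b (λ t → g (a + X + t)))
        (trans (∑-split (a + X) b g) (cong (_+ ∑ b (λ t → g (a + X + t))) (∑-split a X g)))
        dense (interval-bound 0 a) (interval-bound (a + X) b)
      where
      conclude : ∀ b A₁ A₂ A₃ {A} → A ≡ A₁ + A₂ + A₃ → u * (a + X + b) ≤ M * A + (a + X + b) →
        M * A₁ ≤ u * a + M * ℓ → M * A₃ ≤ u * b + M * ℓ → u * X ≤ M * A₂ + (a + X + b) + 2 * (M * ℓ)
      conclude b A₁ A₂ A₃ refl h₁ h₂ h₃ = linear 0 (+-mono-≤ (+-mono-≤ h₁ h₂) h₃)
        (identity u a X b M ℓ A₁ A₂ A₃)
        where
        identity : ∀ u a X b M ℓ A₁ A₂ A₃ →
          u * X + (M * (A₁ + A₂ + A₃) + (a + X + b) + (u * a + M * ℓ) + (u * b + M * ℓ)) + 0 ≡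
          M * A₂ + (a + X + b) + 2 * (M * ℓ) + (u * (a + X + b) + M * A₁ + M * A₃)
        identity = solve-∀

    -- The same subtraction among residue classes: the other q classes of an interval of length
    -- `X * suc q` obey the upper bound, which leaves almost the full density u / M to the class of
    -- a.
    ap-dense : ∀ a q X → a + X * suc q ≤ n →
      u * X ≤ M * ∑ X (λ t → g (a + t * suc q)) + n + (2 + q) * (M * ℓ)
    ap-dense a q X le = conclude (cls 0) (∑ q (λ r → cls (suc r)))
      (∑-classes X (suc q) (λ t → g (a + t))) (interval-dense a (X * suc q) le) others
      where
      open ≤-Reasoning
      cls : ℕ → ℕ
      cls r = ∑ X (λ t → g (a + (r + t * suc q)))
      others : M * ∑ q (λ r → cls (suc r)) ≤ q * (u * X + M * ℓ)
      others = begin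
        M * ∑ q (λ r → cls (suc r))       ≡⟨ ∑-* q M (λ r → cls (suc r)) ⟨
        ∑ q (λ r → M * cls (suc r))       ≤⟨ ∑-≤const q _ (λ r _ → ≤-trans
            (≤-reflexive (cong (M *_) (∑-cong X (λ t → cong g (sym (+-assoc a (suc r) _))))))
            (long-ap-bound (a + suc r) (suc q) (s≤s z≤n) X)) ⟩
        q * (u * X + M * ℓ)               ∎
      conclude : ∀ A₀ A₁ {A} → A ≡ A₀ + A₁ → u * (X * suc q) ≤ M * A + n + 2 * (M * ℓ) →
        M * A₁ ≤ q * (u * X + M * ℓ) → u * X ≤ M * A₀ + n + (2 + q) * (M * ℓ)
      conclude A₀ A₁ refl h₁ h₂ = linear 0 (+-mono-≤ h₁ h₂)
        (identity u X q M ℓ n A₀ A₁)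
        where
        identity : ∀ u X q M ℓ n A₀ A₁ →
          u * X + (M * (A₀ + A₁) + n + 2 * (M * ℓ) + q * (u * X + M * ℓ)) + 0 ≡
          M * A₀ + n + (2 + q) * (M * ℓ) + (u * (X * suc q) + M * A₁)
        identity = solve-∀

    -- Density 1 / M suffices here, so two averagings do it, over blocks of length `L * suc q` and
    -- then over the residue classes of a block. The progression found hosts all variables other
    -- than y and z.
    dense-window : ∀ q L Q → 0 < L → Q * (L * suc q) ≤ n →
      Q * (L * suc q) + n + 2 * (M * ℓ) < u * (Q * (L * suc q)) →
      Σ ℕ λ w → w < Q * (L * suc q) × L ≤ M * ∑ L (λ e → g (w + e * suc q))
    dense-window q L Q L>0 W≤n big =
      let i , i<Q , lt = pigeonhole Q (λ _ → L * suc q) (λ i → M * ∑ (L * suc q) (λ j → g (i * (L * suc q) + j)))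
             (subst₂ _<_ (sym (∑-const Q _)) (sym (trans (∑-* Q M _) (cong (M *_) (sym (∑-blocks Q (L * suc q) g)))))
               (cancel _ (<-≤-trans big (interval-dense 0 (Q * (L * suc q)) W≤n))))
          r , r<q , lt′ = pigeonhole (suc q) (λ _ → L) (λ r → M * ∑ L (λ e → g (i * (L * suc q) + (r + e * suc q))))
             (subst₂ _<_ (trans (*-comm L (suc q)) (sym (∑-const (suc q) L)))
               (trans (cong (M *_) (∑-classes L (suc q) (λ j → g (i * (L * suc q) + j)))) (sym (∑-* (suc q) M (λ r → ∑ L (λ e → g (i * (L * suc q) + (r + e * suc q))))))) lt)
      in i * (L * suc q) + r , w<W i r i<Q r<q ,
        <⇒≤ (subst (L <_) (cong (M *_) (∑-cong L (λ e → cong g (sym (+-assoc (i * (L * suc q)) r (e * suc q)))))) lt′)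
      where
      open ≤-Reasoning
      cancel : ∀ A → Q * (L * suc q) + n + 2 * (M * ℓ) < A + n + 2 * (M * ℓ) → Q * (L * suc q) < A
      cancel A h = +-cancelʳ-< n _ _ (+-cancelʳ-< (2 * (M * ℓ)) _ _ h)
      w<W : ∀ i r → i < Q → r < suc q → i * (L * suc q) + r < Q * (L * suc q)
      w<W i r i<Q r<q = begin-strict
        i * (L * suc q) + r            <⟨ +-monoʳ-< (i * (L * suc q)) (<-≤-trans r<q
                                            (m≤n*m (suc q) L {{>-nonZero L>0}})) ⟩
        i * (L * suc q) + L * suc q    ≡⟨ +-comm (i * (L * suc q)) (L * suc q) ⟩
        suc i * (L * suc q)            ≤⟨ *-monoˡ-≤ (L * suc q) i<Q ⟩
        Q * (L * suc q)                ∎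

-- The first element forms a pair with each later one, and `n ≤ suc ℓ` keeps these differences at
-- most ℓ.
pairs : ∀ {n ℓ} (b : ℕ → Bool) → n ≤ suc ℓ →
  ∑ n (λ j → ⟦ b j ⟧) ≤ 1 + ∑ ℓ (λ d → ∑ n (λ j → ⟦ b j ∧ b (j + suc d) ⟧))
pairs {zero} b _ = z≤n
pairs {suc n} {ℓ} b (s≤s n≤ℓ) with b 0 in eq
... | true  = s≤s (≤-trans (∑-prefix (λ d → ⟦ b (suc d) ⟧) n≤ℓ)
                (∑-mono ℓ (λ d _ → m≤m+n ⟦ b (suc d) ⟧ _)))
... | false = pairs {n} {ℓ} (b ∘ suc) (m≤n⇒m≤1+n n≤ℓ)

-- Cut into X blocks of length N, the set has at least two elements per block on average, hence at
-- least X pairs with differences below N. The most popular difference receives a share of 1 / N of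
-- them, so its base points have density at least 1 / N².
frequent-difference : ∀ q X (B : ℕ → Bool) → 0 < X → let N = 2 * suc q in
  X * N ≤ suc q * ∑ (X * N) (λ s → ⟦ B s ⟧) →
  Σ ℕ λ d → suc d < N × X * N ≤ N * N * ∑ (X * N) (λ s → ⟦ B s ∧ B (s + suc d) ⟧)
frequent-difference q X B X>0 dense
  = let d , d<N , lt = pigeonhole N-1 (λ _ → X) (λ d → N * P d) (begin-strict
         ∑ N-1 (λ _ → X)         ≡⟨ ∑-const N-1 X ⟩
         N-1 * X                 <⟨ m<n+m (N-1 * X) X>0 ⟩
         N * X                   ≤⟨ *-monoʳ-≤ N X≤ ⟩
         N * ∑ N-1 P             ≡⟨ ∑-* N-1 N P ⟨
         ∑ N-1 (λ d → N * P d)   ∎)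
    in d , s≤s d<N , (begin
      X * N          ≤⟨ *-monoˡ-≤ N (<⇒≤ lt) ⟩
      N * P d * N    ≡⟨ *-comm (N * P d) N ⟩
      N * (N * P d)  ≡⟨ *-assoc N N (P d) ⟨
      N * N * P d    ∎)
  where
  open ≤-Reasoning
  N N-1 : ℕ
  N-1 = q + suc (q + 0)
  N = suc N-1
  P : ℕ → ℕ
  P d = ∑ (X * N) (λ s → ⟦ B s ∧ B (s + suc d) ⟧)
  upper : ∑ (X * N) (λ s → ⟦ B s ⟧) ≤ X + ∑ N-1 P
  upper = begin
    ∑ (X * N) (λ s → ⟦ B s ⟧)                                ≡⟨ ∑-blocks X N _ ⟩
    ∑ X (λ i → ∑ N (λ j → ⟦ B (i * N + j) ⟧))                ≤⟨ ∑-mono X (λ i _ → pairs {N} {N-1} (λ j → B (i * N + j)) ≤-refl) ⟩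
    ∑ X (λ i → 1 + ∑ N-1 (λ d → ∑ N (λ j → ⟦ B (i * N + j) ∧ B (i * N + (j + suc d)) ⟧)))
                                                             ≡⟨ ∑-+ X (λ _ → 1) _ ⟩
    ∑ X (λ _ → 1) + ∑ X (λ i → ∑ N-1 (λ d → ∑ N (λ j → ⟦ B (i * N + j) ∧ B (i * N + (j + suc d)) ⟧)))
                                                             ≡⟨ cong₂ _+_ (trans (∑-const X 1) (*-identityʳ X)) (∑-swap X N-1 _) ⟩
    X + ∑ N-1 (λ d → ∑ X (λ i → ∑ N (λ j → ⟦ B (i * N + j) ∧ B (i * N + (j + suc d)) ⟧)))
      ≡⟨ cong (λ z → X + z) (∑-cong N-1 (λ d → ∑-cong X (λ i → ∑-cong N (λ j →
           cong (λ z → ⟦ B (i * N + j) ∧ B z ⟧) (sym (+-assoc (i * N) j (suc d))))))) ⟩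
    X + ∑ N-1 (λ d → ∑ X (λ i → ∑ N (λ j → ⟦ B (i * N + j) ∧ B (i * N + j + suc d) ⟧)))
      ≡⟨ cong (λ z → X + z) (∑-cong N-1 (λ d → ∑-blocks X N (λ s → ⟦ B s ∧ B (s + suc d) ⟧))) ⟨
    X + ∑ N-1 P                                              ∎
  twice : ∀ X q → X * (2 * q) ≡ q * (X + X)
  twice = solve-∀
  X≤ : X ≤ ∑ N-1 P
  X≤ = +-cancelˡ-≤ X _ _ (≤-trans (*-cancelˡ-≤ (suc q) (≤-trans (≤-reflexive (sym (twice X (suc q)))) dense)) upper)

-- Translates of sets of integers

∑-shift : ∀ d R (h : ℕ → ℕ) → ∑ d h + ∑ R (λ s → h (d + s)) ≡ ∑ R h + ∑ d (λ i → h (R + i))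
∑-shift d R h = trans (sym (∑-split d R h)) (trans (cong (λ n → ∑ n h) (+-comm d R)) (∑-split R d h))

∑-indicator≤ : ∀ n (b : ℕ → Bool) → ∑ n (λ i → ⟦ b i ⟧) ≤ n
∑-indicator≤ n b = ≤-trans (∑-≤const n 1 (λ i _ → ⟦⟧≤1 (b i))) (≤-reflexive (*-identityʳ n))

∧-true : ∀ {a b} → a ∧ b ≡ true → a ≡ true × b ≡ true
∧-true {true} {true} _ = refl , refl

SupportedBelow : ℕ → (ℤ → Bool) → Set
SupportedBelow R P = ∀ {s} → P s ≡ true → Σ ℕ λ n → n < R × s ≡ + n

private
  unshift : ∀ d s → + (suc d + s) ℤ.+ -[1+ d ] ≡ + s
  unshift d s = trans (ℤₚ.⊖-≥ (m≤m+n (suc d) s)) (cong ℤ.+_ (m+n∸m≡n (suc d) s))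

-- Nothing lies outside the window [0, R) beforehand, so a translation can only push points out of
-- it.
∑-shift-≤ : ∀ {R P} → SupportedBelow R P → ∀ D → ∑ R (λ s → ⟦ P (+ s ℤ.+ D) ⟧) ≤ ∑ R (λ s → ⟦ P (+ s) ⟧)
∑-shift-≤ {R} {P} supp (+ d) = begin
  ∑ R (λ s → ⟦ P (+ (s + d)) ⟧)                            ≡⟨ ∑-cong R (λ s → cong (λ n → ⟦ P (+ n) ⟧) (+-comm s d)) ⟩
  ∑ R (λ s → h (d + s))                                    ≤⟨ m≤n+m _ (∑ d h) ⟩
  ∑ d h + ∑ R (λ s → h (d + s))                            ≡⟨ ∑-shift d R h ⟩
  ∑ R h + ∑ d (λ i → h (R + i))                            ≡⟨ cong (λ z → ∑ R h + z) (∑-zero d (λ i _ → beyond i)) ⟩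
  ∑ R h + 0                                                ≡⟨ +-identityʳ _ ⟩
  ∑ R h                                                    ∎
  where
  open ≤-Reasoning
  h : ℕ → ℕ
  h i = ⟦ P (+ i) ⟧
  beyond : ∀ i → h (R + i) ≡ 0
  beyond i with P (+ (R + i)) in eq
  ... | false = refl
  ... | true with supp eq
  ...   | n , n<R , refl = contradiction n<R (m+n≮m R i)
∑-shift-≤ {R} {P} supp -[1+ d ] = begin
  ∑ R h                                                    ≤⟨ m≤m+n _ _ ⟩
  ∑ R h + ∑ (suc d) (λ i → h (R + i))                      ≡⟨ ∑-shift (suc d) R h ⟨
  ∑ (suc d) h + ∑ R (λ s → h (suc d + s))                  ≡⟨ cong₂ _+_ (∑-zero (suc d) below) (∑-cong R (λ s → cong (⟦_⟧ ∘ P) (unshift d s))) ⟩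
  ∑ R (λ s → ⟦ P (+ s) ⟧)                                  ∎
  where
  open ≤-Reasoning
  h : ℕ → ℕ
  h i = ⟦ P (+ i ℤ.+ -[1+ d ]) ⟧
  below : ∀ i → i < suc d → h i ≡ 0
  below i i≤d with P (+ i ℤ.+ -[1+ d ]) in eq
  ... | false = refl
  ... | true with supp eq
  ...   | n , _ , e = contradiction
    (subst (ℤ._≤ ℤ.-1ℤ) e (ℤₚ.≤-trans (ℤₚ.+-monoˡ-≤ -[1+ d ] (ℤ.+≤+ (≤-pred i≤d))) (ℤₚ.≤-reflexive (d-d-1 d)))) (λ ())
    where
    d-d-1 : ∀ d → + d ℤ.+ -[1+ d ] ≡ ℤ.-1ℤ
    d-d-1 d = trans (ℤₚ.⊖-< (n<1+n d)) (cong (λ n → ℤ.- + n) (m+n∸n≡m 1 d))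

∑-shift-≥ : ∀ R (P : ℤ → Bool) D → ∑ R (λ s → ⟦ P (+ s) ⟧) ≤ ∑ R (λ s → ⟦ P (+ s ℤ.+ D) ⟧) + ℤ.∣ D ∣
∑-shift-≥ R P (+ d) = begin
  ∑ R h                                        ≤⟨ m≤m+n _ _ ⟩
  ∑ R h + ∑ d (λ i → h (R + i))                ≡⟨ ∑-shift d R h ⟨
  ∑ d h + ∑ R (λ s → h (d + s))                ≤⟨ +-monoˡ-≤ _ (∑-indicator≤ d (λ i → P (+ i))) ⟩
  d + ∑ R (λ s → h (d + s))                    ≡⟨ +-comm d _ ⟩
  ∑ R (λ s → h (d + s)) + d                    ≡⟨ cong (_+ d) (∑-cong R (λ s → cong h (+-comm d s))) ⟩
  ∑ R (λ s → h (s + d)) + d                    ∎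
  where
  open ≤-Reasoning
  h : ℕ → ℕ
  h i = ⟦ P (+ i) ⟧
∑-shift-≥ R P -[1+ d ] = begin
  ∑ R (λ s → ⟦ P (+ s) ⟧)                      ≡⟨ ∑-cong R (λ s → cong (⟦_⟧ ∘ P) (unshift d s)) ⟨
  ∑ R (λ s → h (suc d + s))                    ≤⟨ m≤n+m _ (∑ (suc d) h) ⟩
  ∑ (suc d) h + ∑ R (λ s → h (suc d + s))      ≡⟨ ∑-shift (suc d) R h ⟩
  ∑ R h + ∑ (suc d) (λ i → h (R + i))          ≤⟨ +-monoʳ-≤ (∑ R h) (∑-indicator≤ (suc d) (λ i → P (+ (R + i) ℤ.+ -[1+ d ]))) ⟩
  ∑ R h + suc d                                ∎
  where
  open ≤-Reasoning
  h : ℕ → ℕ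
  h i = ⟦ P (+ i ℤ.+ -[1+ d ]) ⟧

-- Hilbert cubes and almost invariant unions

entering : (ℤ → Bool) → ℤ → ℤ → Bool
entering ν D s = ν (s ℤ.- D) ∧ not (ν s)

-- Passing to a popular difference turns density 1 / q into 1 / (2 q)² and needs blocks of length 2
-- q. The recursion collects these block lengths over m rounds, one for each dimension of the cube.
cubeLength : ℕ → ℕ → ℕ
cubeLength zero    q = 1
cubeLength (suc m) q = cubeLength m (2 * q * (2 * q)) * (2 * q)

cubeLength>0 : ∀ m q → 0 < q → 0 < cubeLength m q
cubeLength>0 zero    q q>0 = s≤s z≤n
cubeLength>0 (suc m) q q>0 = *-mono-< (cubeLength>0 m _ (*-mono-< 2q>0 2q>0)) 2q>0
  where
  2q>0 : 0 < 2 * q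
  2q>0 = *-mono-< {0} {2} (s≤s z≤n) q>0

-- Szemerédi's cube argument: B contains x₀ + {0, d₁} + … + {0, dₘ}, and the union of the translates V e over a growing
-- face of this cube cannot gain thr points m times inside [0, R), so one of the shifts by c dᵢ gains fewer.
module CubeChain
  (V : ℕ → ℤ → Bool) (c : ℤ) (R T thr : ℕ) (Valid : ℕ → Set)
  (V-shift : ∀ e d s → V (e + d) s ≡ V e (s ℤ.- c ℤ.* + d))
  (V-large : ∀ {e} → Valid e → T ≤ ∑ R (λ s → ⟦ V e (+ s) ⟧))
  (V-supp : ∀ {e} → Valid e → SupportedBelow R (V e))
  where

  -- Only one inclusion is recorded, that ν is covered by the sets `V e` with e in B; the size of ν
  -- is tracked separately.
  UnionOver : (ℕ → Bool) → (ℤ → Bool) → Set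
  UnionOver B ν = ∀ {s} → ν s ≡ true → Σ ℕ λ e → B e ≡ true × V e s ≡ true

  record AlmostInvariant (L : ℕ) (B : ℕ → Bool) : Set where
    field
      ν       : ℤ → Bool
      d       : ℕ
      d>0     : 0 < d
      d<L     : d < L
      union   : UnionOver B ν
      union-d : UnionOver B (λ s → ν (s ℤ.- c ℤ.* + d))
      large   : T ≤ ∑ R (λ s → ⟦ ν (+ s) ⟧)
      few     : ∑ R (λ s → ⟦ entering ν (c ℤ.* + d) (+ s) ⟧) ≤ thr

  record Growing (m : ℕ) (B : ℕ → Bool) : Set where
    field
      ν       : ℤ → Bool
      union   : UnionOver B ν
      large   : T ≤ ∑ R (λ s → ⟦ ν (+ s) ⟧)
      grown   : m * thr ≤ ∑ R (λ s → ⟦ ν (+ s) ⟧)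

  Base : ℕ → (ℕ → Bool) → ℕ → Set
  Base q B L = L ≤ q * ∑ L (λ e → ⟦ B e ⟧)

  nonempty : ∀ q B L → 0 < L → Base q B L → Σ ℕ λ e → B e ≡ true
  nonempty q B L L>0 base with pigeonhole L (λ _ → 0) (λ e → ⟦ B e ⟧) positive
    where
    positive : ∑ L (λ _ → 0) < ∑ L (λ e → ⟦ B e ⟧)
    positive with ∑ L (λ e → ⟦ B e ⟧)
    ... | zero = contradiction (≤-trans L>0 (≤-trans base (≤-reflexive (*-zeroʳ q)))) (λ ())
    ... | suc n = subst (_< suc n) (sym (trans (∑-const L 0) (*-zeroʳ L))) (s≤s z≤n)
  ... | e , _ , b with B e in eq
  ...   | true = e , eq

  -- Each level passes to B′, the points e of B with e + d in B. A set covered by translates from B′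
  -- is covered, together with its shift by c d, by translates from B. Either this shift brings at
  -- most thr new points and the search ends, or the union with it gains more than thr.
  chain : ∀ m q X B → 0 < X → (∀ {e} → B e ≡ true → Valid e) →
    Base (suc q) B (X * cubeLength m (suc q)) →
    AlmostInvariant (X * cubeLength m (suc q)) B ⊎ Growing m B
  chain zero q X B X>0 valid base
    with e , be ← nonempty (suc q) B (X * 1) (subst (0 <_) (sym (*-identityʳ X)) X>0) base = inj₂ (record
    { ν = V e ; union = λ v → e , be , v ; large = V-large (valid be) ; grown = z≤n })
  chain (suc m) q X B X>0 valid base = step
    (frequent-difference q X′ B X′>0 (subst (Base (suc q) B) len base))
    where
    N X′ : ℕ
    N = 2 * suc q
    X′ = X * cubeLength m (N * N)
    X′>0 : 0 < X′
    X′>0 = *-mono-< X>0 (cubeLength>0 m (N * N) (s≤s z≤n))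
    len : X * cubeLength (suc m) (suc q) ≡ X′ * N
    len = sym (*-assoc X (cubeLength m (N * N)) N)
    len′ : X * N * cubeLength m (N * N) ≡ X′ * N
    len′ = swap X N (cubeLength m (N * N))
      where
      swap : ∀ a b c → a * b * c ≡ a * c * b
      swap = solve-∀
    step : (Σ ℕ λ d → suc d < N × X′ * N ≤ N * N * ∑ (X′ * N) (λ s → ⟦ B s ∧ B (s + suc d) ⟧)) →
           AlmostInvariant (X * cubeLength (suc m) (suc q)) B ⊎ Growing (suc m) B
    step (d , d<N , base′) with chain m _ (X * N) B′ (*-mono-< X>0 (s≤s z≤n)) (valid ∘ proj₁ ∘ ∧-true)
                                  (subst (Base (N * N) B′) (sym len′) base′)
      where
      B′ : ℕ → Bool
      B′ e = B e ∧ B (e + suc d)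
    ... | inj₁ a = inj₁ (record
      { ν = ν ; d = d₁ ; d>0 = d>0 ; d<L = subst (d₁ <_) (trans len′ (sym len)) d<L
      ; union = λ v → let e , b , w = union v in e , proj₁ (∧-true b) , w
      ; union-d = λ v → let e , b , w = union-d v in e , proj₁ (∧-true b) , w
      ; large = large ; few = few })
      where open AlmostInvariant a renaming (d to d₁)
    ... | inj₂ a = decide (∑ R (λ s → ⟦ entering ν D (+ s) ⟧) ≤? thr)
      where
      open Growing a
      D : ℤ
      D = c ℤ.* + suc d
      ν′ : ℤ → Bool
      ν′ s = ν s ∨ ν (s ℤ.- D)
      from-ν : UnionOver B ν
      from-ν v = let e , b , w = union v in e , proj₁ (∧-true b) , w
      from-shift : UnionOver B (λ s → ν (s ℤ.- D))
      from-shift {s} v = let e , b , w = union v in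
        e + suc d , proj₂ (∧-true {B e} b) , trans (V-shift e (suc d) s) w
      from-ν′ : UnionOver B ν′
      from-ν′ {s} v with ν s in eq
      ... | true  = from-ν eq
      ... | false = from-shift v
      ν≤ν′ : ∀ s → ⟦ ν s ⟧ ≤ ⟦ ν′ s ⟧
      ν≤ν′ s with ν s
      ... | true  = ≤-refl
      ... | false = z≤n
      gain : ∀ s → ⟦ ν s ⟧ + ⟦ entering ν D s ⟧ ≤ ⟦ ν′ s ⟧
      gain s with ν s | ν (s ℤ.- D)
      ... | true  | true  = ≤-refl
      ... | true  | false = ≤-refl
      ... | false | true  = ≤-refl
      ... | false | false = ≤-refl
      decide : Dec (∑ R (λ s → ⟦ entering ν D (+ s) ⟧) ≤ thr) → _
      decide (yes few) = inj₁ (record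
        { ν = ν ; d = suc d ; d>0 = s≤s z≤n
        ; d<L = subst (suc d <_) (sym len) (<-≤-trans d<N (m≤n*m N X′ {{>-nonZero X′>0}}))
        ; union = from-ν ; union-d = from-shift ; large = large ; few = few })
      decide (no many) = inj₂ (record
        { ν = ν′ ; union = from-ν′
        ; large = ≤-trans large (∑-mono R (λ s _ → ν≤ν′ (+ s)))
        ; grown = ≤-trans (≤-reflexive (+-comm thr (m * thr))) (≤-trans (+-mono-≤ grown (<⇒≤ (≰⇒> many)))
            (≤-trans (≤-reflexive (sym (∑-+ R _ _))) (∑-mono R (λ s _ → gain (+ s))))) })

  almost-invariant : ∀ m q X B → 0 < X → (∀ {e} → B e ≡ true → Valid e) → R < m * thr →
    Base (suc q) B (X * cubeLength m (suc q)) →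
    AlmostInvariant (X * cubeLength m (suc q)) B
  almost-invariant m q X B X>0 valid R<m base with chain m q X B X>0 valid base
  ... | inj₁ a = a
  ... | inj₂ a = contradiction (≤-trans (Growing.grown a)
    (∑-indicator≤ R (λ s → Growing.ν a (+ s)))) (<⇒≱ R<m)

-- Both sides count pairs (s , j) with k true at the j-th term of the progression s, s + D, …, s + (ℓ - 1) D; a
-- progression contributes nothing once it lies inside ν, and it leaves ν only at a point entering the complement.
module DoubleCount
  (M u ℓ R thr : ℕ) (ℓ>0 : 0 < ℓ) (D : ℤ) (ν k : ℤ → Bool)
  (disjoint : ∀ {s} → ν s ≡ true → k s ≡ true → ⊥)
  (ap-bound : ∀ s → M * ∑ ℓ (λ j → ⟦ k (s ℤ.+ D ℤ.* + j) ⟧) ≤ u * ℓ)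
  (supp : SupportedBelow R (entering ν D))
  (few : ∑ R (λ s → ⟦ entering ν D (+ s) ⟧) ≤ thr)
  where

  private
    K E : ℤ → ℕ
    K s = ∑ ℓ (λ j → ⟦ k (s ℤ.+ D ℤ.* + j) ⟧)
    E s = ∑ ℓ (λ j → ⟦ entering ν D (s ℤ.+ D ℤ.* + suc j) ⟧)

    back : ∀ s D j → s ℤ.+ D ℤ.* + suc j ℤ.- D ≡ s ℤ.+ D ℤ.* + j
    back s D j = trans (cong (λ z → s ℤ.+ D ℤ.* z ℤ.- D) (ℤₚ.pos-+ 1 j)) (expand s D (+ j))
      where
      expand : ∀ s D j → s ℤ.+ D ℤ.* (+ 1 ℤ.+ j) ℤ.- D ≡ s ℤ.+ D ℤ.* j
      expand = ℤSolver.solve-∀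

    stays : ∀ {s} → ν s ≡ true → E s ≡ 0 → ∀ {j} → j < ℓ → ν (s ℤ.+ D ℤ.* + j) ≡ true
    stays {s} νs E≡0 {zero} _ = trans (cong ν (trans (cong (λ z → s ℤ.+ z) (ℤₚ.*-zeroʳ D)) (ℤₚ.+-identityʳ s))) νs
    stays {s} νs E≡0 {suc j} j<ℓ with ν (s ℤ.+ D ℤ.* + suc j) in eq
    ... | true = refl
    ... | false = contradiction (≤-trans (≤-reflexive (sym enters))
        (≤-trans (∑-term ℓ (λ j → ⟦ entering ν D (s ℤ.+ D ℤ.* + suc j) ⟧) (<⇒≤ j<ℓ)) (≤-reflexive E≡0))) (λ ())
      where
      enters : ⟦ entering ν D (s ℤ.+ D ℤ.* + suc j) ⟧ ≡ 1
      enters rewrite eq | back s D j | stays νs E≡0 {j} (<⇒≤ j<ℓ) = refl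

    pointwise : ∀ s → M * K s + u * ℓ * ⟦ ν s ⟧ ≤ u * ℓ + u * ℓ * E s
    pointwise s with ν s in νs
    ... | false = ≤-trans (≤-reflexive (trans (cong (λ z → M * K s + z) (*-zeroʳ (u * ℓ))) (+-identityʳ _)))
                    (≤-trans (ap-bound s) (m≤m+n _ _))
    ... | true with E s in eq
    ...   | suc n = +-mono-≤ (ap-bound s) (*-monoʳ-≤ (u * ℓ) (s≤s z≤n))
    ...   | zero  = ≤-reflexive (trans (cong₂ _+_ (trans (cong (M *_) (∑-zero ℓ empty)) (*-zeroʳ M)) (*-identityʳ (u * ℓ)))
                      (sym (trans (cong (λ z → u * ℓ + z) (*-zeroʳ (u * ℓ))) (+-identityʳ _))))
      where
      empty : ∀ j → j < ℓ → ⟦ k (s ℤ.+ D ℤ.* + j) ⟧ ≡ 0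
      empty j j<ℓ with k (s ℤ.+ D ℤ.* + j) in ks
      ... | false = refl
      ... | true  = ⊥-elim (disjoint (stays νs eq j<ℓ) ks)

    entries : ∑ R (λ s → E (+ s)) ≤ ℓ * thr
    entries = ≤-trans (≤-reflexive (∑-swap R ℓ _))
      (∑-≤const ℓ thr (λ j _ → ≤-trans (∑-shift-≤ {P = entering ν D} supp (D ℤ.* + suc j)) few))

    k-total : ℓ * ∑ R (λ s → ⟦ k (+ s) ⟧) ≤ ∑ R (λ s → K (+ s)) + ℓ * (ℓ * ℤ.∣ D ∣)
    k-total = begin
      ℓ * ∑ R (λ s → ⟦ k (+ s) ⟧)                                    ≡⟨ ∑-const ℓ _ ⟨
      ∑ ℓ (λ _ → ∑ R (λ s → ⟦ k (+ s) ⟧))                            ≤⟨ ∑-mono ℓ (λ j j<ℓ → ≤-trans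
          (∑-shift-≥ R k (D ℤ.* + j)) (+-monoʳ-≤ _ (≤-trans (≤-reflexive (trans (ℤₚ.abs-* D (+ j)) (*-comm ℤ.∣ D ∣ j)))
            (*-monoˡ-≤ ℤ.∣ D ∣ (<⇒≤ j<ℓ))))) ⟩
      ∑ ℓ (λ j → ∑ R (λ s → ⟦ k (+ s ℤ.+ D ℤ.* + j) ⟧) + ℓ * ℤ.∣ D ∣)  ≡⟨ ∑-+ ℓ _ _ ⟩
      ∑ ℓ (λ j → ∑ R (λ s → ⟦ k (+ s ℤ.+ D ℤ.* + j) ⟧)) + ∑ ℓ (λ _ → ℓ * ℤ.∣ D ∣)
                                                                     ≡⟨ cong₂ _+_ (∑-swap ℓ R _) (∑-const ℓ _) ⟩
      ∑ R (λ s → K (+ s)) + ℓ * (ℓ * ℤ.∣ D ∣)                          ∎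
      where open ≤-Reasoning

  -- The gain over the trivial bound u R: up to the error terms, k has only the complement of ν to
  -- live in, and its density there is still at most u / M.
  double-count : M * ∑ R (λ s → ⟦ k (+ s) ⟧) + u * ∑ R (λ s → ⟦ ν (+ s) ⟧) ≤ u * R + u * (ℓ * thr) + M * (ℓ * ℤ.∣ D ∣)
  double-count = conclude _ _ _ _ _ summed entries k-total
    where
    open ≤-Reasoning
    summed : M * ∑ R (λ s → K (+ s)) + u * ℓ * ∑ R (λ s → ⟦ ν (+ s) ⟧) ≤ R * (u * ℓ) + u * ℓ * ∑ R (λ s → E (+ s))
    summed = begin
      M * ∑ R (λ s → K (+ s)) + u * ℓ * ∑ R (λ s → ⟦ ν (+ s) ⟧)       ≡⟨ cong₂ _+_ (∑-* R M _) (∑-* R (u * ℓ) _) ⟨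
      ∑ R (λ s → M * K (+ s)) + ∑ R (λ s → u * ℓ * ⟦ ν (+ s) ⟧)       ≡⟨ ∑-+ R _ _ ⟨
      ∑ R (λ s → M * K (+ s) + u * ℓ * ⟦ ν (+ s) ⟧)                   ≤⟨ ∑-mono R (λ s _ → pointwise (+ s)) ⟩
      ∑ R (λ s → u * ℓ + u * ℓ * E (+ s))                             ≡⟨ ∑-+ R _ _ ⟩
      ∑ R (λ s → u * ℓ) + ∑ R (λ s → u * ℓ * E (+ s))                 ≡⟨ cong₂ _+_ (∑-const R _) (∑-* R (u * ℓ) _) ⟩
      R * (u * ℓ) + u * ℓ * ∑ R (λ s → E (+ s))                       ∎
    conclude : ∀ κ n e c d → M * κ + u * ℓ * n ≤ R * (u * ℓ) + u * ℓ * e → e ≤ ℓ * thr → ℓ * c ≤ κ + ℓ * (ℓ * d) →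
      M * c + u * n ≤ u * R + u * (ℓ * thr) + M * (ℓ * d)
    conclude κ n e c d h₁ h₂ h₃ = *-cancelˡ-≤ ℓ {{>-nonZero ℓ>0}}
      (linear 0 (+-mono-≤ (+-mono-≤ h₁ (scale (u * ℓ) h₂)) (scale M h₃))
        (identity M u ℓ R thr κ n e c d))
      where
      identity : ∀ M u ℓ R thr κ n e c d →
        ℓ * (M * c + u * n) + (R * (u * ℓ) + u * ℓ * e + u * ℓ * (ℓ * thr) + M * (κ + ℓ * (ℓ * d))) + 0 ≡
        ℓ * (u * R + u * (ℓ * thr) + M * (ℓ * d)) + (M * κ + u * ℓ * n + u * ℓ * e + M * (ℓ * c))
      identity = solve-∀

-- Configurations of solutions

Σℤ-cong : ∀ k {f g : Fin k → ℤ} → (∀ i → f i ≡ g i) → Σℤ k f ≡ Σℤ k g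
Σℤ-cong zero    e = refl
Σℤ-cong (suc k) e = cong₂ ℤ._+_ (e fzero) (Σℤ-cong k (e ∘ fsuc))

Σℤ-+ : ∀ k (f g : Fin k → ℤ) → Σℤ k (λ i → f i ℤ.+ g i) ≡ Σℤ k f ℤ.+ Σℤ k g
Σℤ-+ zero    f g = refl
Σℤ-+ (suc k) f g = trans (cong (λ z → f fzero ℤ.+ g fzero ℤ.+ z) (Σℤ-+ k (f ∘ fsuc) (g ∘ fsuc)))
  (interchange (f fzero) (g fzero) _ _)
  where
  interchange : ∀ a b c d → a ℤ.+ b ℤ.+ (c ℤ.+ d) ≡ a ℤ.+ c ℤ.+ (b ℤ.+ d)
  interchange = ℤSolver.solve-∀

Σℤ-* : ∀ k x (f : Fin k → ℤ) → Σℤ k (λ i → x ℤ.* f i) ≡ x ℤ.* Σℤ k f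
Σℤ-* zero    x f = sym (ℤₚ.*-zeroʳ x)
Σℤ-* (suc k) x f = trans (cong (λ z → x ℤ.* f fzero ℤ.+ z) (Σℤ-* k x (f ∘ fsuc))) (sym (ℤₚ.*-distribˡ-+ x _ _))

Σℤ-0 : ∀ k → Σℤ k (λ _ → + 0) ≡ + 0
Σℤ-0 zero    = refl
Σℤ-0 (suc k) = trans (ℤₚ.+-identityˡ _) (Σℤ-0 k)

at : ∀ {k} → Fin k → ℤ → Fin k → ℤ
at j v i = if does (i ≟ j) then v else + 0

Σℤ-at : ∀ k (j : Fin k) v → Σℤ k (at j v) ≡ v
Σℤ-at (suc k) fzero    v = trans (cong (λ z → v ℤ.+ z) (Σℤ-0 k)) (ℤₚ.+-identityʳ v)
Σℤ-at (suc k) (fsuc j) v = trans (ℤₚ.+-identityˡ _) (Σℤ-at k j v)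

∑Fin : ∀ k → (Fin k → ℕ) → ℕ
∑Fin zero    f = 0
∑Fin (suc k) f = f fzero + ∑Fin k (f ∘ fsuc)

∣Σℤ∣≤ : ∀ k (c x : Fin k → ℤ) L → (∀ i → ℤ.∣ x i ∣ ≤ L) → ℤ.∣ Σℤ k (λ i → c i ℤ.* x i) ∣ ≤ L * ∑Fin k (λ i → ℤ.∣ c i ∣)
∣Σℤ∣≤ zero    c x L x≤L = z≤n
∣Σℤ∣≤ (suc k) c x L x≤L = begin
  ℤ.∣ c fzero ℤ.* x fzero ℤ.+ Σℤ k (λ i → c (fsuc i) ℤ.* x (fsuc i)) ∣        ≤⟨ ℤₚ.∣i+j∣≤∣i∣+∣j∣ (c fzero ℤ.* x fzero) _ ⟩
  ℤ.∣ c fzero ℤ.* x fzero ∣ + ℤ.∣ Σℤ k (λ i → c (fsuc i) ℤ.* x (fsuc i)) ∣      ≤⟨ +-mono-≤ first (∣Σℤ∣≤ k (c ∘ fsuc) (x ∘ fsuc) L (x≤L ∘ fsuc)) ⟩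
  L * ℤ.∣ c fzero ∣ + L * ∑Fin k (λ i → ℤ.∣ c (fsuc i) ∣)                       ≡⟨ *-distribˡ-+ L _ _ ⟨
  L * (ℤ.∣ c fzero ∣ + ∑Fin k (λ i → ℤ.∣ c (fsuc i) ∣))                         ∎
  where
  open ≤-Reasoning
  first : ℤ.∣ c fzero ℤ.* x fzero ∣ ≤ L * ℤ.∣ c fzero ∣
  first = ≤-trans (≤-reflexive (ℤₚ.abs-* (c fzero) (x fzero)))
    (≤-trans (scale ℤ.∣ c fzero ∣ (x≤L fzero)) (≤-reflexive (*-comm ℤ.∣ c fzero ∣ L)))

∑Fin-mono : ∀ k {f g : Fin k → ℕ} → (∀ i → f i ≤ g i) → ∑Fin k f ≤ ∑Fin k g
∑Fin-mono zero    le = z≤n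
∑Fin-mono (suc k) le = +-mono-≤ (le fzero) (∑Fin-mono k (le ∘ fsuc))

Solution : ∀ k → (Fin k → ℤ) → (ℤ → Bool) → Set
Solution k c f = Σ (Fin k → ℤ) λ x → Injective _≡_ _≡_ x × (∀ i → f (x i) ≡ true) × Σℤ k (λ i → c i ℤ.* x i) ≡ + 0

-- This is where the vanishing coefficient sum enters: the translation contributes a multiple of
-- `Σℤ k c`, so solutions survive affine maps and density bounds pass to all progressions.
solution-shift : ∀ k (c x : Fin k → ℤ) → Σℤ k c ≡ + 0 → ∀ a D →
  Σℤ k (λ i → c i ℤ.* (a ℤ.+ D ℤ.* x i)) ≡ D ℤ.* Σℤ k (λ i → c i ℤ.* x i)
solution-shift k c x Σc≡0 a D = begin
  Σℤ k (λ i → c i ℤ.* (a ℤ.+ D ℤ.* x i))                              ≡⟨ Σℤ-cong k (λ i → expand (c i) a D (x i)) ⟩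
  Σℤ k (λ i → a ℤ.* c i ℤ.+ D ℤ.* (c i ℤ.* x i))                      ≡⟨ Σℤ-+ k _ _ ⟩
  Σℤ k (λ i → a ℤ.* c i) ℤ.+ Σℤ k (λ i → D ℤ.* (c i ℤ.* x i))         ≡⟨ cong₂ ℤ._+_ (Σℤ-* k a c) (Σℤ-* k D _) ⟩
  a ℤ.* Σℤ k c ℤ.+ D ℤ.* Σℤ k (λ i → c i ℤ.* x i)                     ≡⟨ cong (λ z → a ℤ.* z ℤ.+ D ℤ.* Σℤ k (λ i → c i ℤ.* x i)) Σc≡0 ⟩
  a ℤ.* + 0 ℤ.+ D ℤ.* Σℤ k (λ i → c i ℤ.* x i)                        ≡⟨ cong (λ z → z ℤ.+ D ℤ.* Σℤ k (λ i → c i ℤ.* x i)) (ℤₚ.*-zeroʳ a) ⟩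
  + 0 ℤ.+ D ℤ.* Σℤ k (λ i → c i ℤ.* x i)                              ≡⟨ ℤₚ.+-identityˡ _ ⟩
  D ℤ.* Σℤ k (λ i → c i ℤ.* x i)                                      ∎
  where
  open ≡-Reasoning
  expand : ∀ c a D x → c ℤ.* (a ℤ.+ D ℤ.* x) ≡ a ℤ.* c ℤ.+ D ℤ.* (c ℤ.* x)
  expand = ℤSolver.solve-∀

solution-affine : ∀ k c f → Σℤ k c ≡ + 0 → ∀ a D → D ≢ + 0 →
  Solution k c (λ s → f (a ℤ.+ D ℤ.* s)) → Solution k c f
solution-affine k c f Σc≡0 a D D≢0 (x , inj , fx , Σ≡0) =
  (λ i → a ℤ.+ D ℤ.* x i) ,
  (λ e → inj (ℤₚ.*-cancelˡ-≡ D _ _ {{ℤ.≢-nonZero D≢0}} (ℤ-group.∙-cancelˡ a _ _ e))) ,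
  fx ,
  trans (solution-shift k c x Σc≡0 a D) (trans (cong (D ℤ.*_) Σ≡0) (ℤₚ.*-zeroʳ D))

-- With offsets γ β φ i from w for the other variables, γ t for y and β s for z, the equation becomes s ≡ t + σ φ e.
module Configuration
  (k : ℕ) (c : Fin k → ℤ) (Σc≡0 : Σℤ k c ≡ + 0)
  (i₁ y z : Fin k) (i₁≢y : i₁ ≢ y) (i₁≢z : i₁ ≢ z) (y≢z : y ≢ z)
  (b g : ℕ) (cy : c y ≡ + suc b) (cz : c z ≡ -[1+ g ])
  where

  β γ : ℕ
  β = suc b
  γ = suc g

  rest : Fin k → ℤ
  rest i = if does (i ≟ i₁) then + 0 else (if does (i ≟ y) then + 0 else (if does (i ≟ z) then + 0 else c i))

  offset : (Fin k → ℕ) → ℤ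
  offset φ = Σℤ k (λ i → rest i ℤ.* + φ i)

  σ : (Fin k → ℕ) → ℕ → ℤ
  σ φ e = c i₁ ℤ.* + e ℤ.+ offset φ

  module _ (f : ℤ → Bool) (w L : ℕ) (φ : Fin k → ℕ) (φ-inj : Injective _≡_ _≡_ φ) (φ<L : ∀ i → φ i < L)
    (fφ : ∀ i → f (+ (w + γ * β * φ i)) ≡ true)
    (e : ℕ) (e<L : e < L) (φ≢e : ∀ i → φ i ≢ e) (fe : f (+ (w + γ * β * e)) ≡ true)
    (t s : ℕ) (s≡t+σ : + s ≡ + t ℤ.+ σ φ e) (βL≤t : β * L ≤ t) (γL≤s : γ * L ≤ s) (γt≢βs : γ * t ≢ β * s)
    (ft : f (+ (w + γ * t)) ≡ true) (fs : f (+ (w + β * s)) ≡ true)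
    where

    private
      ψ : Fin k → ℕ
      ψ i = if does (i ≟ i₁) then e else φ i

      ψ-inj : Injective _≡_ _≡_ ψ
      ψ-inj {i} {j} eq with i ≟ i₁ | j ≟ i₁
      ... | yes p | yes q = trans p (sym q)
      ... | yes p | no  _ = contradiction (sym eq) (φ≢e j)
      ... | no  _ | yes q = contradiction eq (φ≢e i)
      ... | no  _ | no  _ = φ-inj eq

      ψ<L : ∀ i → ψ i < L
      ψ<L i with i ≟ i₁
      ... | yes _ = e<L
      ... | no  _ = φ<L i

      fψ : ∀ i → f (+ (w + γ * β * ψ i)) ≡ true
      fψ i with i ≟ i₁
      ... | yes _ = fe
      ... | no  _ = fφ i

      off : Fin k → ℕ
      off i = if does (i ≟ y) then γ * t else (if does (i ≟ z) then β * s else γ * β * ψ i)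

      ψ≢t : ∀ i → γ * β * ψ i ≢ γ * t
      ψ≢t i eq = <⇒≱ (<-≤-trans (*-monoʳ-< β (ψ<L i)) βL≤t)
        (≤-reflexive (sym (*-cancelˡ-≡ (β * ψ i) t γ (trans (sym (*-assoc γ β (ψ i))) eq))))

      ψ≢s : ∀ i → γ * β * ψ i ≢ β * s
      ψ≢s i eq = <⇒≱ (<-≤-trans (*-monoʳ-< γ (ψ<L i)) γL≤s)
        (≤-reflexive (sym (*-cancelˡ-≡ (γ * ψ i) s β
          (trans (sym (*-assoc β γ (ψ i))) (trans (cong (_* ψ i) (*-comm β γ)) eq)))))

      off-inj : Injective _≡_ _≡_ off
      off-inj {i} {j} eq with i ≟ y | j ≟ y | i ≟ z | j ≟ z
      ... | yes p | yes q | _     | _     = trans p (sym q)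
      ... | yes _ | no  _ | _     | yes _ = contradiction eq γt≢βs
      ... | yes _ | no  _ | _     | no  _ = contradiction (sym eq) (ψ≢t j)
      ... | no  _ | yes _ | yes _ | _     = contradiction (sym eq) γt≢βs
      ... | no  _ | yes _ | no  _ | _     = contradiction eq (ψ≢t i)
      ... | no  _ | no  _ | yes p | yes q = trans p (sym q)
      ... | no  _ | no  _ | yes _ | no  _ = contradiction (sym eq) (ψ≢s j)
      ... | no  _ | no  _ | no  _ | yes _ = contradiction eq (ψ≢s i)
      ... | no  _ | no  _ | no  _ | no  _ = ψ-inj (*-cancelˡ-≡ (ψ i) (ψ j) (γ * β) eq)

      f-off : ∀ i → f (+ (w + off i)) ≡ true
      f-off i with i ≟ y | i ≟ z
      ... | yes _ | _     = ft
      ... | no  _ | yes _ = fs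
      ... | no  _ | no  _ = fψ i

      v₁ vy vz : ℤ
      v₁ = c i₁ ℤ.* + (γ * β * e)
      vy = c y ℤ.* + (γ * t)
      vz = c z ℤ.* + (β * s)

      pointwise : ∀ i → c i ℤ.* + off i ≡
        + (γ * β) ℤ.* (rest i ℤ.* + φ i) ℤ.+ (at i₁ v₁ i ℤ.+ (at y vy i ℤ.+ at z vz i))
      pointwise i with i ≟ i₁ | i ≟ y | i ≟ z
      ... | yes refl | yes p    | _        = contradiction p i₁≢y
      ... | yes refl | no _     | yes q    = contradiction q i₁≢z
      ... | no _     | yes refl | yes q    = contradiction q y≢z
      ... | yes refl | no _     | no _     = pad₁ (+ (γ * β)) (+ φ i) v₁
        where
        pad₁ : ∀ a p v → v ≡ a ℤ.* (+ 0 ℤ.* p) ℤ.+ (v ℤ.+ (+ 0 ℤ.+ + 0))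
        pad₁ = ℤSolver.solve-∀
      ... | no _     | yes refl | no _     = pad₂ (+ (γ * β)) (+ φ i) vy
        where
        pad₂ : ∀ a p v → v ≡ a ℤ.* (+ 0 ℤ.* p) ℤ.+ (+ 0 ℤ.+ (v ℤ.+ + 0))
        pad₂ = ℤSolver.solve-∀
      ... | no _     | no _     | yes refl = pad₃ (+ (γ * β)) (+ φ i) vz
        where
        pad₃ : ∀ a p v → v ≡ a ℤ.* (+ 0 ℤ.* p) ℤ.+ (+ 0 ℤ.+ (+ 0 ℤ.+ v))
        pad₃ = ℤSolver.solve-∀
      ... | no _     | no _     | no _     =
        trans (cong (c i ℤ.*_) (ℤₚ.pos-* (γ * β) (φ i))) (pad₀ (c i) (+ (γ * β)) (+ φ i))
        where
        pad₀ : ∀ c a p → c ℤ.* (a ℤ.* p) ≡ a ℤ.* (c ℤ.* p) ℤ.+ (+ 0 ℤ.+ (+ 0 ℤ.+ + 0))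
        pad₀ = ℤSolver.solve-∀

      balance : + (γ * β) ℤ.* offset φ ℤ.+ (v₁ ℤ.+ (vy ℤ.+ vz)) ≡ + 0
      balance = begin
        + (γ * β) ℤ.* offset φ ℤ.+ (v₁ ℤ.+ (vy ℤ.+ vz))
          ≡⟨ cong₂ ℤ._+_ (cong (ℤ._* offset φ) (ℤₚ.pos-* γ β))
               (cong₂ ℤ._+_ (cong (c i₁ ℤ.*_) (trans (ℤₚ.pos-* (γ * β) e) (cong (ℤ._* + e) (ℤₚ.pos-* γ β))))
                 (cong₂ ℤ._+_ (cong₂ ℤ._*_ cy (ℤₚ.pos-* γ t)) (cong₂ ℤ._*_ cz (trans (ℤₚ.pos-* β s) (cong (+ β ℤ.*_) s≡t+σ))))) ⟩
        + γ ℤ.* + β ℤ.* offset φ ℤ.+ (c i₁ ℤ.* (+ γ ℤ.* + β ℤ.* + e) ℤ.+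
          (+ β ℤ.* (+ γ ℤ.* + t) ℤ.+ ℤ.- (+ γ) ℤ.* (+ β ℤ.* (+ t ℤ.+ (c i₁ ℤ.* + e ℤ.+ offset φ)))))
          ≡⟨ cancels (+ γ) (+ β) (offset φ) (c i₁) (+ e) (+ t) ⟩
        + 0 ∎
        where
        open ≡-Reasoning
        cancels : ∀ γ β o c e t → γ ℤ.* β ℤ.* o ℤ.+ (c ℤ.* (γ ℤ.* β ℤ.* e) ℤ.+
          (β ℤ.* (γ ℤ.* t) ℤ.+ ℤ.- γ ℤ.* (β ℤ.* (t ℤ.+ (c ℤ.* e ℤ.+ o))))) ≡ + 0
        cancels = ℤSolver.solve-∀

      Σ-off : Σℤ k (λ i → c i ℤ.* + off i) ≡ + 0
      Σ-off = begin
        Σℤ k (λ i → c i ℤ.* + off i)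
          ≡⟨ Σℤ-cong k pointwise ⟩
        Σℤ k (λ i → + (γ * β) ℤ.* (rest i ℤ.* + φ i) ℤ.+ (at i₁ v₁ i ℤ.+ (at y vy i ℤ.+ at z vz i)))
          ≡⟨ Σℤ-+ k _ _ ⟩
        Σℤ k (λ i → + (γ * β) ℤ.* (rest i ℤ.* + φ i)) ℤ.+ Σℤ k (λ i → at i₁ v₁ i ℤ.+ (at y vy i ℤ.+ at z vz i))
          ≡⟨ cong₂ ℤ._+_ (Σℤ-* k (+ (γ * β)) (λ i → rest i ℤ.* + φ i)) (trans (Σℤ-+ k _ _) (cong₂ ℤ._+_ (Σℤ-at k i₁ v₁)
               (trans (Σℤ-+ k _ _) (cong₂ ℤ._+_ (Σℤ-at k y vy) (Σℤ-at k z vz))))) ⟩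
        + (γ * β) ℤ.* offset φ ℤ.+ (v₁ ℤ.+ (vy ℤ.+ vz))
          ≡⟨ balance ⟩
        + 0 ∎
        where open ≡-Reasoning

    solution : Solution k c f
    solution = (λ i → + (w + off i)) , (λ eq → off-inj (+-cancelˡ-≡ w _ _ (ℤₚ.+-injective eq))) , f-off ,
      (begin
        Σℤ k (λ i → c i ℤ.* + (w + off i))                     ≡⟨ Σℤ-cong k (λ i → cong (λ x → c i ℤ.* (+ w ℤ.+ x)) (ℤₚ.*-identityˡ (+ off i))) ⟨
        Σℤ k (λ i → c i ℤ.* (+ w ℤ.+ + 1 ℤ.* + off i))         ≡⟨ solution-shift k c (λ i → + off i) Σc≡0 (+ w) (+ 1) ⟩
        + 1 ℤ.* Σℤ k (λ i → c i ℤ.* + off i)                   ≡⟨ trans (ℤₚ.*-identityˡ _) Σ-off ⟩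
        + 0                                                    ∎)
      where open ≡-Reasoning

-- Selecting and removing elements

select : ∀ n k (E : ℕ → Bool) → k ≤ ∑ n (λ e → ⟦ E e ⟧) →
  Σ (Fin k → ℕ) λ φ → Injective _≡_ _≡_ φ × (∀ i → φ i < n) × (∀ i → E (φ i) ≡ true)
select zero zero E _ = (λ ()) , (λ { {()} }) , (λ ()) , (λ ())
select (suc n) k E le with E 0 in eq
select (suc n) k E le | false with φ , inj , lt , Eφ ← select n k (E ∘ suc) le =
  suc ∘ φ , inj ∘ suc-injective , s≤s ∘ lt , Eφ
select (suc n) zero E le | true = (λ ()) , (λ { {()} }) , (λ ()) , (λ ())
select (suc n) (suc k) E (s≤s le) | true with φ , inj , lt , Eφ ← select n k (E ∘ suc) le =
  φ′ , inj′ , (λ { fzero → s≤s z≤n ; (fsuc i) → s≤s (lt i) }) , (λ { fzero → eq ; (fsuc i) → Eφ i })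
  where
  φ′ : Fin (suc k) → ℕ
  φ′ fzero    = 0
  φ′ (fsuc i) = suc (φ i)
  inj′ : Injective _≡_ _≡_ φ′
  inj′ {fzero}  {fzero}  _ = refl
  inj′ {fsuc i} {fsuc j} e = cong fsuc (inj (suc-injective e))

remove : (ℕ → Bool) → (ℕ → Bool) → ℕ → Bool
remove P E e = E e ∧ not (P e)

∑-unique : ∀ n (P : ℕ → Bool) → (∀ {i j} → P i ≡ true → P j ≡ true → i ≡ j) → ∑ n (λ e → ⟦ P e ⟧) ≤ 1
∑-unique zero    P uniq = z≤n
∑-unique (suc n) P uniq with P 0 in eq
... | true  = ≤-reflexive (cong suc (∑-zero n (λ i _ → none i)))
  where
  none : ∀ i → ⟦ P (suc i) ⟧ ≡ 0
  none i with P (suc i) in eq′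
  ... | false = refl
  ... | true  = contradiction (uniq eq eq′) (λ ())
... | false = ∑-unique n (P ∘ suc) (λ p q → suc-injective (uniq p q))

∑-remove : ∀ n (P E : ℕ → Bool) → (∀ {i j} → P i ≡ true → P j ≡ true → i ≡ j) →
  ∑ n (λ e → ⟦ E e ⟧) ≤ ∑ n (λ e → ⟦ remove P E e ⟧) + 1
∑-remove n P E uniq = ≤-trans (∑-mono n (λ e _ → pointwise e)) (≤-trans (≤-reflexive (∑-+ n _ _))
  (+-monoʳ-≤ _ (∑-unique n P uniq)))
  where
  pointwise : ∀ e → ⟦ E e ⟧ ≤ ⟦ remove P E e ⟧ + ⟦ P e ⟧
  pointwise e with E e | P e
  ... | true  | true  = ≤-refl
  ... | true  | false = ≤-refl
  ... | false | _     = z≤n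

≡ᵇ-true : ∀ m n → (m ℕ.≡ᵇ n) ≡ true → m ≡ n
≡ᵇ-true m n e = ≡ᵇ⇒≡ m n (subst T (sym e) tt)

removeAll : ∀ k → (Fin k → ℕ) → (ℕ → Bool) → ℕ → Bool
removeAll zero    φ E = E
removeAll (suc k) φ E = remove (φ fzero ℕ.≡ᵇ_) (removeAll k (φ ∘ fsuc) E)

removeAll-true : ∀ k φ E {e} → removeAll k φ E e ≡ true → E e ≡ true × (∀ i → φ i ≢ e)
removeAll-true zero    φ E p = p , λ ()
removeAll-true (suc k) φ E {e} p with removeAll k (φ ∘ fsuc) E e in eq | φ fzero ℕ.≡ᵇ e in eq′
... | true | false with Ee , others ← removeAll-true k (φ ∘ fsuc) E eq =
  Ee , λ { fzero φ0≡e → subst T eq′ (≡⇒≡ᵇ (φ fzero) e φ0≡e) ; (fsuc i) → others i }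

∑-removeAll : ∀ n k φ E → ∑ n (λ e → ⟦ E e ⟧) ≤ ∑ n (λ e → ⟦ removeAll k φ E e ⟧) + k
∑-removeAll n zero    φ E = m≤m+n _ 0
∑-removeAll n (suc k) φ E = ≤-trans (∑-removeAll n k (φ ∘ fsuc) E)
  (≤-trans (+-monoˡ-≤ k (∑-remove n (φ fzero ℕ.≡ᵇ_) (removeAll k (φ ∘ fsuc) E)
      (λ {i} {j} p q → trans (sym (≡ᵇ-true (φ fzero) i p)) (≡ᵇ-true (φ fzero) j q))))
    (≤-reflexive (+-assoc _ 1 k)))

nearby : ∀ {t Λ} z → ℤ.∣ z ∣ ≤ Λ → Λ ≤ t → Σ ℕ λ n → + n ≡ + t ℤ.+ z × n ≤ t + Λ × t ≤ n + Λ
nearby {t} (+ a) a≤Λ Λ≤t = t + a , refl , +-monoʳ-≤ t a≤Λ , ≤-trans (m≤m+n t a) (m≤m+n _ _)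
nearby {t} {Λ} -[1+ a ] a<Λ Λ≤t = t ∸ suc a , sym (ℤₚ.⊖-≥ (≤-trans a<Λ Λ≤t)) , ≤-trans (m∸n≤m t (suc a)) (m≤m+n _ _) ,
  ≤-trans (≤-reflexive (sym (m∸n+n≡m (≤-trans a<Λ Λ≤t)))) (+-monoʳ-≤ _ a<Λ)

<ᵇ-true : ∀ m n → (m ℕ.<ᵇ n) ≡ true → m < n
<ᵇ-true m n e = <ᵇ⇒< m n (subst T (sym e) tt)

T-true : ∀ {b} → T b → b ≡ true
T-true {true} _ = refl

-- The sizes S of the source and Z of the target are eliminated. By `h₂` the target has density
-- almost u / M in [0, R); by `h₃` it has at most that density on what is left after taking S points
-- away. So u S is an error term, whereas by `h₁` S is almost u τ / M.
collect : ∀ u M β γ S Z τ n ℓ R thr Λ →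
  u * τ ≤ M * S + n + (1 + γ) * (M * ℓ) → u * R ≤ M * Z + n + (1 + β) * (M * ℓ) →
  M * Z + u * S ≤ u * R + u * (ℓ * thr) + M * (ℓ * Λ) →
  u * (u * τ) ≤ M * (u * (ℓ * thr) + M * (ℓ * Λ) + n + (1 + β) * (M * ℓ)) + u * n + u * ((1 + γ) * (M * ℓ))
collect u M β γ S Z τ n ℓ R thr Λ h₁ h₂ h₃ = linear 0 (+-mono-≤ (scale u h₁) (scale M (+-mono-≤ h₂ h₃)))
  (identity u M β γ S Z τ n ℓ R thr Λ)
  where
  identity : ∀ u M β γ S Z τ n ℓ R thr Λ →
    u * (u * τ) + (u * (M * S + n + (1 + γ) * (M * ℓ)) + M * (M * Z + n + (1 + β) * (M * ℓ) + (u * R + u * (ℓ * thr) + M * (ℓ * Λ)))) + 0 ≡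
    M * (u * (ℓ * thr) + M * (ℓ * Λ) + n + (1 + β) * (M * ℓ)) + u * n + u * ((1 + γ) * (M * ℓ)) + (u * (u * τ) + M * (u * R + (M * Z + u * S)))
  identity = solve-∀

product≢0 : ∀ {a b} → a ≢ + 0 → b ≢ + 0 → a ℤ.* b ≢ + 0
product≢0 {a} a≢0 b≢0 ab≡0 with ℤₚ.i*j≡0⇒i≡0∨j≡0 a ab≡0
... | inj₁ a≡0 = a≢0 a≡0
... | inj₂ b≡0 = b≢0 b≡0

zero?-true : ∀ {x} → does (x ℤ.≟ + 0) ≡ true → x ≡ + 0
zero?-true {x} p with x ℤ.≟ + 0
... | yes x≡0 = x≡0

zero?-false : ∀ {x} → not (does (x ℤ.≟ + 0)) ≡ true → x ≢ + 0
zero?-false {x} p with x ℤ.≟ + 0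
... | no x≢0 = x≢0

-- The density increment

module Step
  (k : ℕ) (c : Fin k → ℤ) (Σc≡0 : Σℤ k c ≡ + 0)
  (i₁ y z : Fin k) (i₁≢y : i₁ ≢ y) (i₁≢z : i₁ ≢ z) (y≢z : y ≢ z)
  (b g : ℕ) (cy : c y ≡ + suc b) (cz : c z ≡ -[1+ g ]) (c₁≢0 : c i₁ ≢ + 0)
  (M′ h ℓ : ℕ) (ℓ>0 : 0 < ℓ)
  (ub : ∀ f → ¬ Solution k c f → suc M′ * ∑ ℓ (λ j → ⟦ f (+ j) ⟧) ≤ suc h * ℓ)
  where

  open Configuration k c Σc≡0 i₁ y z i₁≢y i₁≢z y≢z b g cy cz

  M u N : ℕ
  M = suc M′
  u = suc h
  N = ℤ.∣ c i₁ ∣ + ∑Fin k (λ i → ℤ.∣ rest i ∣)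

  -- L is the length of the base progression and Λ bounds the shifts σ. The source occupies [t₀, t₀
  -- + τ), its translates by σ stay inside [0, R), and n has room for a start w < τ followed by
  -- progressions of difference β and γ.
  module Constants
    (L m X Λ t₀ Q τ thr R n : ℕ) (X>0 : 0 < X) (L≡ : L ≡ X * cubeLength m (2 * M)) (L-large : 2 * M * suc k ≤ L)
    (Λ-large : L * N ≤ Λ) (t₀-large : β * L + γ * L + β * Λ + Λ < t₀) (τ≡ : τ ≡ Q * (L * (γ * β)))
    (R≡ : R ≡ t₀ + τ + Λ) (R<m : R < m * thr) (n≡ : n ≡ τ + (β + γ) * R)
    (window-room : τ + n + 2 * (M * ℓ) < u * τ)
    (final-room : M * (u * (ℓ * thr) + M * (ℓ * Λ) + n + (1 + β) * (M * ℓ)) + u * n + u * ((1 + γ) * (M * ℓ)) < u * (u * τ))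
    where

    L>0 : 0 < L
    L>0 = ≤-trans (s≤s z≤n) L-large

    Λ≤t₀ : Λ ≤ t₀
    Λ≤t₀ = ≤-trans (m≤n+m Λ _) (<⇒≤ t₀-large)

    ∣offset∣≤ : ∀ {φ} → (∀ i → φ i < L) → ℤ.∣ offset φ ∣ ≤ L * ∑Fin k (λ i → ℤ.∣ rest i ∣)
    ∣offset∣≤ {φ} φ<L = ∣Σℤ∣≤ k rest (λ i → + φ i) L (λ i → <⇒≤ (φ<L i))

    ∣σ∣≤ : ∀ {φ} → (∀ i → φ i < L) → ∀ {e} → e < L → ℤ.∣ σ φ e ∣ ≤ Λ
    ∣σ∣≤ {φ} φ<L {e} e<L = begin
      ℤ.∣ c i₁ ℤ.* + e ℤ.+ offset φ ∣                              ≤⟨ ℤₚ.∣i+j∣≤∣i∣+∣j∣ (c i₁ ℤ.* + e) (offset φ) ⟩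
      ℤ.∣ c i₁ ℤ.* + e ∣ + ℤ.∣ offset φ ∣                            ≤⟨ +-mono-≤ first (∣offset∣≤ φ<L) ⟩
      L * ℤ.∣ c i₁ ∣ + L * ∑Fin k (λ i → ℤ.∣ rest i ∣)               ≡⟨ *-distribˡ-+ L _ _ ⟨
      L * N                                                      ≤⟨ Λ-large ⟩
      Λ                                                          ∎
      where
      open ≤-Reasoning
      first : ℤ.∣ c i₁ ℤ.* + e ∣ ≤ L * ℤ.∣ c i₁ ∣
      first = ≤-trans (≤-reflexive (trans (ℤₚ.abs-* (c i₁) (+ e)) (*-comm ℤ.∣ c i₁ ∣ e))) (*-monoˡ-≤ ℤ.∣ c i₁ ∣ (<⇒≤ e<L))

    -- The hypothesis `dense` says that h n is at most M times the count, with h written as u - 1: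
    -- the bound to be proved fails.
    module WithSet (f : ℤ → Bool) (free : ¬ Solution k c f) (dense : u * n ≤ M * ∑ n (λ j → ⟦ f (+ j) ⟧) + n) where

      ap-bound-ℤ : ∀ a D → D ≢ + 0 → M * ∑ ℓ (λ j → ⟦ f (a ℤ.+ D ℤ.* + j) ⟧) ≤ u * ℓ
      ap-bound-ℤ a D D≢0 = ub (λ s → f (a ℤ.+ D ℤ.* s)) (free ∘ solution-affine k c f Σc≡0 a D D≢0)

      ap-bound : ∀ r q → 0 < q → M * ∑ ℓ (λ t → ⟦ f (+ (r + t * q)) ⟧) ≤ u * ℓ
      ap-bound r q q>0 = subst (λ x → M * x ≤ u * ℓ)
        (∑-cong ℓ (λ t → cong (λ x → ⟦ f (+ r ℤ.+ x) ⟧) (trans (sym (ℤₚ.pos-* q t)) (cong ℤ.+_ (*-comm q t)))))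
        (ap-bound-ℤ (+ r) (+ q) (λ { refl → contradiction q>0 (λ ()) }))

      open APBounds M u ℓ ℓ>0 (λ j → ⟦ f (+ j) ⟧) (λ j → ⟦⟧≤1 (f (+ j))) ap-bound

      module WithTuple
        (w : ℕ) (w<τ : w < τ) (φ : Fin k → ℕ) (φ-inj : Injective _≡_ _≡_ φ) (φ<L : ∀ i → φ i < L)
        (fφ : ∀ i → f (+ (w + γ * β * φ i)) ≡ true)
        (E : ℕ → Bool) (E⇒ : ∀ {e} → E e ≡ true → e < L × f (+ (w + γ * β * e)) ≡ true)
        (window : L ≤ M * ∑ L (λ e → ⟦ E e ⟧))
        where

        -- If σ = 0 then s = t, and y and z coincide when β = γ. As σ is affine in e with slope
        -- `c i₁` ≠ 0, at most one e is lost.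
        vanishing : ℕ → Bool
        vanishing e = does (σ φ e ℤ.≟ + 0)

        vanishing-unique : ∀ {e e′} → vanishing e ≡ true → vanishing e′ ≡ true → e ≡ e′
        vanishing-unique {e} {e′} p q = ℤₚ.+-injective (ℤₚ.*-cancelˡ-≡ (c i₁) (+ e) (+ e′) {{ℤ.≢-nonZero c₁≢0}}
          (ℤ-group.∙-cancelʳ (offset φ) _ _ (trans (zero?-true {σ φ e} p) (sym (zero?-true {σ φ e′} q)))))

        B : ℕ → Bool
        B = remove vanishing (removeAll k φ E)

        record Valid (e : ℕ) : Set where
          field
            e<L : e < L
            φ≢e : ∀ i → φ i ≢ e
            fe  : f (+ (w + γ * β * e)) ≡ true
            σ≢0 : σ φ e ≢ + 0

        B-valid : ∀ {e} → B e ≡ true → Valid e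
        B-valid {e} p = record
          { e<L = proj₁ (E⇒ (proj₁ kept)) ; φ≢e = proj₂ kept ; fe = proj₂ (E⇒ (proj₁ kept))
          ; σ≢0 = zero?-false {σ φ e} (proj₂ (∧-true {removeAll k φ E e} p)) }
          where
          kept : E e ≡ true × (∀ i → φ i ≢ e)
          kept = removeAll-true k φ E {e} (proj₁ (∧-true {removeAll k φ E e} p))

        -- Removing the k entries of φ and one zero of σ costs at most k + 1 points, and L ≥ 2 M (k
        -- + 1) makes this at most half of the L / M available ones.
        base-dense : L ≤ 2 * M * ∑ L (λ e → ⟦ B e ⟧)
        base-dense = conclude _ _ window (≤-trans (∑-removeAll L k φ E)
          (+-monoˡ-≤ k (∑-remove L vanishing (removeAll k φ E) vanishing-unique)))
          where
          conclude : ∀ e b → L ≤ M * e → e ≤ b + 1 + k → L ≤ 2 * M * b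
          conclude e b h₁ h₂ = linear 0 (+-mono-≤ (+-mono-≤ (scale 2 h₁) (scale (2 * M) h₂)) L-large)
            (identity L M e b k)
            where
            identity : ∀ L M e b k → L + (2 * (M * e) + 2 * M * (b + 1 + k) + L) + 0 ≡ 2 * M * b + (2 * L + 2 * M * e + 2 * M * suc k)
            identity = solve-∀

        -- The positions t open to the variable y. After the shift by σ they become positions that z
        -- must not take, so `V e` is a set of forbidden places for z.
        source : ℤ → Bool
        source (+ t)    = (t₀ ℕ.≤ᵇ t) ∧ ((t ℕ.<ᵇ t₀ + τ) ∧ f (+ (w + γ * t)))
        source -[1+ _ ] = false

        source-true : ∀ {s} → source s ≡ true → Σ ℕ λ t → s ≡ + t × t₀ ≤ t × t < t₀ + τ × f (+ (w + γ * t)) ≡ true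
        source-true {+ t} p =
          let lo , q = ∧-true {t₀ ℕ.≤ᵇ t} p
              hi , r = ∧-true {t ℕ.<ᵇ t₀ + τ} q
          in t , refl , ≤ᵇ⇒≤ t₀ t (subst T (sym lo) tt) , <ᵇ-true t (t₀ + τ) hi , r

        V : ℕ → ℤ → Bool
        V e s = source (s ℤ.- σ φ e)

        shifted : ∀ {e s t} → s ℤ.- σ φ e ≡ + t → s ≡ + t ℤ.+ σ φ e
        shifted {e} {s} p = trans (cancel s (σ φ e)) (cong (ℤ._+ σ φ e) p)
          where
          cancel : ∀ s x → s ≡ s ℤ.- x ℤ.+ x
          cancel = ℤSolver.solve-∀

        Σcount : ℕ
        Σcount = ∑ τ (λ t → ⟦ f (+ (w + γ * t₀ + t * γ)) ⟧)

        V-shift : ∀ e d s → V (e + d) s ≡ V e (s ℤ.- c i₁ ℤ.* + d)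
        V-shift e d s = cong source (trans (cong (λ x → s ℤ.- (c i₁ ℤ.* x ℤ.+ offset φ)) (ℤₚ.pos-+ e d)) (expand s (c i₁) (+ e) (+ d) (offset φ)))
          where
          expand : ∀ s c e d o → s ℤ.- (c ℤ.* (e ℤ.+ d) ℤ.+ o) ≡ s ℤ.- c ℤ.* d ℤ.- (c ℤ.* e ℤ.+ o)
          expand = ℤSolver.solve-∀

        V-large : ∀ {e} → Valid e → Σcount ≤ ∑ R (λ s → ⟦ V e (+ s) ⟧)
        V-large {e} valid = begin
          Σcount                                                ≤⟨ ∑-mono τ (λ t t<τ → ⟦⟧-mono (λ p → at-shift t t<τ p)) ⟩
          ∑ τ (λ t → ⟦ V e (+ (o + t)) ⟧)                       ≤⟨ m≤n+m _ (∑ o (λ s → ⟦ V e (+ s) ⟧)) ⟩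
          ∑ o (λ s → ⟦ V e (+ s) ⟧) + ∑ τ (λ t → ⟦ V e (+ (o + t)) ⟧)   ≡⟨ ∑-split o τ (λ s → ⟦ V e (+ s) ⟧) ⟨
          ∑ (o + τ) (λ s → ⟦ V e (+ s) ⟧)                       ≤⟨ ∑-prefix (λ s → ⟦ V e (+ s) ⟧) o+τ≤R ⟩
          ∑ R (λ s → ⟦ V e (+ s) ⟧)                             ∎
          where
          open ≤-Reasoning
          near : Σ ℕ λ o → + o ≡ + t₀ ℤ.+ σ φ e × o ≤ t₀ + Λ × t₀ ≤ o + Λ
          near = nearby {t₀} (σ φ e) (∣σ∣≤ φ<L (Valid.e<L valid)) Λ≤t₀
          o : ℕ
          o = proj₁ near
          o+τ≤R : o + τ ≤ R
          o+τ≤R = ≤-trans (+-monoˡ-≤ τ (proj₁ (proj₂ (proj₂ near)))) (≤-reflexive (trans (swap t₀ Λ τ) (sym R≡)))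
            where
            swap : ∀ a b c → a + b + c ≡ a + c + b
            swap = solve-∀
          position : ∀ t → + (o + t) ℤ.- σ φ e ≡ + (t₀ + t)
          position t = trans (cong (λ x → x ℤ.- σ φ e) (trans (ℤₚ.pos-+ o t) (cong (ℤ._+ + t) (proj₁ (proj₂ near)))))
            (trans (cancel (+ t₀) (σ φ e) (+ t)) (sym (ℤₚ.pos-+ t₀ t)))
            where
            cancel : ∀ a x t → a ℤ.+ x ℤ.+ t ℤ.- x ≡ a ℤ.+ t
            cancel = ℤSolver.solve-∀
          at-shift : ∀ t → t < τ → f (+ (w + γ * t₀ + t * γ)) ≡ true → V e (+ (o + t)) ≡ true
          at-shift t t<τ p = trans (cong source (position t)) (cong₂ _∧_ (T-true (≤⇒≤ᵇ (m≤m+n t₀ t)))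
            (cong₂ _∧_ (T-true (<⇒<ᵇ (+-monoʳ-< t₀ t<τ))) (trans (cong (λ x → f (+ x)) (regroup w γ t₀ t)) p)))
            where
            regroup : ∀ w γ t₀ t → w + γ * (t₀ + t) ≡ w + γ * t₀ + t * γ
            regroup = solve-∀

        V-supp : ∀ {e} → Valid e → SupportedBelow R (V e)
        V-supp {e} valid {s} p =
          let t , s-σ≡t , t₀≤t , t< , _ = source-true {s ℤ.- σ φ e} p
              n , n≡ , n≤ , _ = nearby {t} (σ φ e) (∣σ∣≤ φ<L (Valid.e<L valid)) (≤-trans Λ≤t₀ t₀≤t)
          in n , subst (n <_) (sym R≡) (≤-<-trans n≤ (+-monoˡ-< Λ t<)) , trans (shifted {e} s-σ≡t) (sym n≡)

        open CubeChain V (c i₁) R Σcount thr Valid V-shift V-large V-supp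

        invariant : AlmostInvariant L B
        invariant = subst (λ x → AlmostInvariant x B) (sym L≡)
          (almost-invariant m _ X B X>0 B-valid R<m (subst (λ x → x ≤ 2 * M * ∑ x (λ e → ⟦ B e ⟧)) L≡ base-dense))

        module WithInvariant (inv : AlmostInvariant L B) where

          open AlmostInvariant inv

          D : ℤ
          D = c i₁ ℤ.* + d

          D≢0 : D ≢ + 0
          D≢0 = product≢0 {c i₁} {+ d} c₁≢0 (λ d≡0 → <⇒≢ d>0 (sym (ℤₚ.+-injective d≡0)))

          target : ℤ → Bool
          target s = f (+ w ℤ.+ + β ℤ.* s)

          -- γ t = β s would give (γ - β) t = β σ. For γ = β this contradicts σ ≠ 0; otherwise the
          -- left side has absolute value at least t > β Λ, and the right side at most β Λ.
          y≢z-offsets : ∀ {e t s} → Valid e → t₀ ≤ t → + s ≡ + t ℤ.+ σ φ e → γ * t ≢ β * s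
          y≢z-offsets {e} {t} {s} valid t₀≤t s≡ γt≡βs = <⇒≱ (<-≤-trans t₀-large t₀≤t) (begin
            t                                     ≤⟨ m≤n*m t ℤ.∣ x ∣ {{ℕ.≢-nonZero x≢0}} ⟩
            ℤ.∣ x ∣ * t                             ≡⟨ ℤₚ.abs-* x (+ t) ⟨
            ℤ.∣ x ℤ.* + t ∣                         ≡⟨ cong ℤ.∣_∣ xt≡ ⟩
            ℤ.∣ + β ℤ.* σ φ e ∣                     ≡⟨ ℤₚ.abs-* (+ β) (σ φ e) ⟩
            β * ℤ.∣ σ φ e ∣                         ≤⟨ scale β (∣σ∣≤ φ<L (Valid.e<L valid)) ⟩
            β * Λ                                 ≤⟨ m≤n+m (β * Λ) (β * L + γ * L) ⟩
            β * L + γ * L + β * Λ                 ≤⟨ m≤m+n _ Λ ⟩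
            β * L + γ * L + β * Λ + Λ             ∎)
            where
            open ≤-Reasoning
            x : ℤ
            x = + γ ℤ.- + β
            xt≡ : x ℤ.* + t ≡ + β ℤ.* σ φ e
            xt≡ = trans (distrib (+ γ) (+ β) (+ t)) (trans
              (cong (λ v → v ℤ.- + β ℤ.* + t) (trans (sym (ℤₚ.pos-* γ t)) (trans (cong ℤ.+_ γt≡βs) (trans (ℤₚ.pos-* β s) (cong (+ β ℤ.*_) s≡)))))
              (cancel (+ β) (+ t) (σ φ e)))
              where
              distrib : ∀ γ β t → (γ ℤ.- β) ℤ.* t ≡ γ ℤ.* t ℤ.- β ℤ.* t
              distrib = ℤSolver.solve-∀
              cancel : ∀ β t σ → β ℤ.* (t ℤ.+ σ) ℤ.- β ℤ.* t ≡ β ℤ.* σ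
              cancel = ℤSolver.solve-∀
            x≢0 : ℤ.∣ x ∣ ≢ 0
            x≢0 ∣x∣≡0 = product≢0 {+ β} {σ φ e} (λ ()) (Valid.σ≢0 valid)
              (trans (sym xt≡) (cong (ℤ._* + t) (ℤₚ.∣i∣≡0⇒i≡0 {x} ∣x∣≡0)))

          clash : ∀ {e t n} → Valid e → t₀ ≤ t → f (+ (w + γ * t)) ≡ true →
            + n ≡ + t ℤ.+ σ φ e → t ≤ n + Λ → f (+ (w + β * n)) ≡ true → ⊥
          clash {e} {t} {n} valid t₀≤t ft n≡ t≤ fn = free
            (solution f w L φ φ-inj φ<L fφ e (Valid.e<L valid) (Valid.φ≢e valid) (Valid.fe valid) t n n≡
              βL≤t γL≤n (y≢z-offsets valid t₀≤t n≡) ft fn)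
            where
            t-large : β * L + γ * L + β * Λ + Λ ≤ t
            t-large = ≤-trans (<⇒≤ t₀-large) t₀≤t
            βL≤t : β * L ≤ t
            βL≤t = ≤-trans (≤-trans (m≤m+n (β * L) (γ * L)) (≤-trans (m≤m+n (β * L + γ * L) (β * Λ)) (m≤m+n _ Λ))) t-large
            γL≤n : γ * L ≤ n
            γL≤n = +-cancelʳ-≤ Λ (γ * L) n (≤-trans (≤-trans (+-monoˡ-≤ Λ
              (≤-trans (m≤n+m (γ * L) (β * L)) (m≤m+n (β * L + γ * L) (β * Λ)))) t-large) t≤)

          disjoint : ∀ {s} → ν s ≡ true → target s ≡ true → ⊥
          disjoint {s} νs fs =
            let e , Be , Ves = union νs
                t , s-σ≡t , t₀≤t , _ , ft = source-true {s ℤ.- σ φ e} Ves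
                n , n≡ , _ , t≤ = nearby {t} (σ φ e) (∣σ∣≤ φ<L (Valid.e<L (B-valid {e} Be))) (≤-trans Λ≤t₀ t₀≤t)
            in clash (B-valid {e} Be) t₀≤t ft n≡ t≤ (subst (λ v → f v ≡ true) (target≡ {s} {n} (trans (shifted {e} {s} s-σ≡t) (sym n≡))) fs)
            where
            target≡ : ∀ {s n} → s ≡ + n → + w ℤ.+ + β ℤ.* s ≡ + (w + β * n)
            target≡ {n = n} refl = trans (cong (λ v → + w ℤ.+ v) (sym (ℤₚ.pos-* β n))) (sym (ℤₚ.pos-+ w (β * n)))

          -- Sampling the target with difference D means sampling f with difference β D ≠ 0, so the
          -- bound assumed for solution-free sets carries over.
          target-ap : ∀ s → M * ∑ ℓ (λ j → ⟦ target (s ℤ.+ D ℤ.* + j) ⟧) ≤ u * ℓ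
          target-ap s = subst (λ x → M * x ≤ u * ℓ)
            (∑-cong ℓ (λ j → cong (λ v → ⟦ f v ⟧) (expand (+ w) (+ β) s D (+ j))))
            (ap-bound-ℤ (+ w ℤ.+ + β ℤ.* s) (+ β ℤ.* D) βD≢0)
            where
            expand : ∀ w β s D j → w ℤ.+ β ℤ.* s ℤ.+ β ℤ.* D ℤ.* j ≡ w ℤ.+ β ℤ.* (s ℤ.+ D ℤ.* j)
            expand = ℤSolver.solve-∀
            βD≢0 : + β ℤ.* D ≢ + 0
            βD≢0 = product≢0 {+ β} {D} (λ ()) D≢0

          entering-supp : SupportedBelow R (entering ν D)
          entering-supp {s} p = let e , Be , Ves = union-d {s} (proj₁ (∧-true p)) in V-supp (B-valid {e} Be) Ves

          open DoubleCount M u ℓ R thr ℓ>0 D ν target disjoint target-ap entering-supp few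

          ∣D∣≤Λ : ℤ.∣ D ∣ ≤ Λ
          ∣D∣≤Λ = begin
            ℤ.∣ c i₁ ℤ.* + d ∣     ≡⟨ trans (ℤₚ.abs-* (c i₁) (+ d)) (*-comm ℤ.∣ c i₁ ∣ d) ⟩
            d * ℤ.∣ c i₁ ∣         ≤⟨ *-mono-≤ (<⇒≤ d<L) (m≤m+n ℤ.∣ c i₁ ∣ _) ⟩
            L * N                ≤⟨ Λ-large ⟩
            Λ                    ∎
            where open ≤-Reasoning

          source-dense : u * τ ≤ M * Σcount + n + (2 + g) * (M * ℓ)
          source-dense = ap-dense n dense (w + γ * t₀) g τ (begin
            w + γ * t₀ + τ * γ            ≤⟨ +-monoˡ-≤ (τ * γ) (+-monoˡ-≤ (γ * t₀) (<⇒≤ w<τ)) ⟩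
            τ + γ * t₀ + τ * γ            ≤⟨ m≤m+n _ (β * (t₀ + τ + Λ) + γ * Λ) ⟩
            τ + γ * t₀ + τ * γ + (β * (t₀ + τ + Λ) + γ * Λ) ≡⟨ regroup τ γ t₀ β Λ ⟩
            τ + (β + γ) * (t₀ + τ + Λ)    ≡⟨ trans n≡ (cong (λ r → τ + (β + γ) * r) R≡) ⟨
            n                             ∎)
            where
            open ≤-Reasoning
            regroup : ∀ τ γ t₀ β Λ → τ + γ * t₀ + τ * γ + (β * (t₀ + τ + Λ) + γ * Λ) ≡ τ + (β + γ) * (t₀ + τ + Λ)
            regroup = solve-∀

          target-dense : u * R ≤ M * ∑ R (λ s → ⟦ target (+ s) ⟧) + n + (2 + b) * (M * ℓ)
          target-dense = subst (λ x → u * R ≤ M * x + n + (2 + b) * (M * ℓ))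
            (∑-cong R (λ s → cong (λ v → ⟦ f v ⟧) (trans (ℤₚ.pos-+ w (s * β)) (cong (λ v → + w ℤ.+ v) (trans (cong ℤ.+_ (*-comm s β)) (ℤₚ.pos-* β s))))))
            (ap-dense n dense w b R (begin
              w + R * β              ≤⟨ +-mono-≤ (<⇒≤ w<τ) (≤-trans (m≤m+n _ (γ * R)) (≤-reflexive (regroup R β γ))) ⟩
              τ + (β + γ) * R        ≡⟨ n≡ ⟨
              n                      ∎))
            where
            open ≤-Reasoning
            regroup : ∀ R β γ → R * β + γ * R ≡ (β + γ) * R
            regroup = solve-∀

          large-target : M * ∑ R (λ s → ⟦ target (+ s) ⟧) + u * Σcount ≤ u * R + u * (ℓ * thr) + M * (ℓ * Λ)
          large-target = ≤-trans (+-monoʳ-≤ (M * ∑ R (λ s → ⟦ target (+ s) ⟧)) (scale u large))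
            (≤-trans double-count (+-monoʳ-≤ (u * R + u * (ℓ * thr)) (scale M (scale ℓ ∣D∣≤Λ))))

          absurd : ⊥
          absurd = <⇒≱ final-room (collect u M β γ Σcount (∑ R (λ s → ⟦ target (+ s) ⟧)) τ n ℓ R thr Λ
            source-dense target-dense large-target)

        absurd : ⊥
        absurd = WithInvariant.absurd invariant

      from-window : ∀ w → w < τ → L ≤ M * ∑ L (λ e → ⟦ f (+ (w + e * (γ * β))) ⟧) → ⊥
      from-window w w<τ window = finish (select L k E k≤)
        where
        E : ℕ → Bool
        E e = (e ℕ.<ᵇ L) ∧ f (+ (w + γ * β * e))
        E⇒ : ∀ {e} → E e ≡ true → e < L × f (+ (w + γ * β * e)) ≡ true
        E⇒ {e} p = <ᵇ-true e L (proj₁ (∧-true {e ℕ.<ᵇ L} p)) , proj₂ (∧-true {e ℕ.<ᵇ L} p)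
        in-E : ∀ e → e < L → f (+ (w + e * (γ * β))) ≡ true → E e ≡ true
        in-E e e<L p = cong₂ _∧_ (T-true (<⇒<ᵇ e<L)) (trans (cong (λ x → f (+ (w + x))) (*-comm (γ * β) e)) p)
        window′ : L ≤ M * ∑ L (λ e → ⟦ E e ⟧)
        window′ = ≤-trans window (scale M (∑-mono L (λ e e<L → ⟦⟧-mono (in-E e e<L))))
        k≤ : k ≤ ∑ L (λ e → ⟦ E e ⟧)
        k≤ = *-cancelˡ-≤ M (begin
          M * k                         ≤⟨ scale M (≤-trans (n≤1+n k) (m≤m+n (suc k) (suc k + 0))) ⟩
          M * (2 * suc k)               ≡⟨ regroup M (suc k) ⟩
          2 * M * suc k                 ≤⟨ L-large ⟩
          L                             ≤⟨ window′ ⟩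
          M * ∑ L (λ e → ⟦ E e ⟧)       ∎)
          where
          open ≤-Reasoning
          regroup : ∀ M k → M * (2 * k) ≡ 2 * M * k
          regroup = solve-∀
        finish : (Σ (Fin k → ℕ) λ φ → Injective _≡_ _≡_ φ × (∀ i → φ i < L) × (∀ i → E (φ i) ≡ true)) → ⊥
        finish (φ , φ-inj , φ<L , Eφ) = WithTuple.absurd w w<τ φ φ-inj φ<L
          (λ i → proj₂ (E⇒ (Eφ i))) E E⇒ window′

      absurd : ⊥
      absurd =
        -- `suc (b + g * suc b)` is γ β, the difference of the base progression.
        let w , w<W , window = dense-window n dense (b + g * suc b) L Q L>0
              (subst (_≤ n) τ≡ (≤-trans (m≤m+n τ _) (≤-reflexive (sym n≡))))
              (subst (λ x → x + n + 2 * (M * ℓ) < u * x) τ≡ window-room)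
        in from-window w (subst (w <_) (sym τ≡) w<W) window

    bound : ∀ f → ¬ Solution k c f → M * ∑ n (λ j → ⟦ f (+ j) ⟧) ≤ h * n
    bound f free with M * ∑ n (λ j → ⟦ f (+ j) ⟧) ≤? h * n
    ... | yes le = le
    ... | no  gt = ⊥-elim (WithSet.absurd f free (≤-trans (+-monoʳ-≤ n (<⇒≤ (≰⇒> gt))) (≤-reflexive (+-comm n _))))

-- Roth's theorem for an invariant equation

-- With C = β + γ, the choice τ = M² ℓ thr keeps the terms containing ℓ below 2 τ in total, and n ≤
-- (1 + 2 C) τ costs 2 M (1 + 2 C) τ. All this is less than M (4 C + 5) τ, so the requirement u² ≥ M
-- (4 C + 5) decides how far the density can be lowered.
final-estimate : ∀ M u β γ ℓ thr τ n Λ → τ ≡ M * M * ℓ * thr → u ≤ M → Λ + (1 + β) + (1 + γ) ≤ thr →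
  n ≤ τ + 2 * ((β + γ) * τ) → M * (4 * (β + γ) + 5) ≤ u * u → 0 < τ → 0 < M →
  M * (u * (ℓ * thr) + M * (ℓ * Λ) + n + (1 + β) * (M * ℓ)) + u * n + u * ((1 + γ) * (M * ℓ)) < u * (u * τ)
final-estimate M u β γ ℓ thr τ n Λ τ≡ u≤M Λ≤thr n≤ u²≥ τ>0 M>0 = begin-strict
  M * (u * (ℓ * thr) + M * (ℓ * Λ) + n + (1 + β) * (M * ℓ)) + u * n + u * ((1 + γ) * (M * ℓ))
    ≤⟨ +-mono-≤ (+-mono-≤ (scale M (+-monoˡ-≤ ((1 + β) * (M * ℓ)) (+-monoˡ-≤ n (+-monoˡ-≤ (M * (ℓ * Λ)) (*-monoˡ-≤ (ℓ * thr) u≤M)))))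
         (*-monoˡ-≤ n u≤M)) (*-monoˡ-≤ ((1 + γ) * (M * ℓ)) u≤M) ⟩
  M * (M * (ℓ * thr) + M * (ℓ * Λ) + n + (1 + β) * (M * ℓ)) + M * n + M * ((1 + γ) * (M * ℓ))
    ≡⟨ collected M β γ ℓ thr n Λ ⟩
  M * M * ℓ * thr + M * M * ℓ * (Λ + (1 + β) + (1 + γ)) + 2 * M * n
    ≤⟨ +-mono-≤ (+-monoʳ-≤ (M * M * ℓ * thr) (scale (M * M * ℓ) Λ≤thr)) (scale (2 * M) n≤) ⟩
  M * M * ℓ * thr + M * M * ℓ * thr + 2 * M * (τ + 2 * ((β + γ) * τ))
    ≡⟨ cong (λ x → x + x + 2 * M * (τ + 2 * ((β + γ) * τ))) τ≡ ⟨
  τ + τ + 2 * M * (τ + 2 * ((β + γ) * τ))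
    ≡⟨ factor M (β + γ) τ ⟩
  (2 + 2 * M + 4 * (M * (β + γ))) * τ
    <⟨ *-monoˡ-< τ {{>-nonZero τ>0}} gap ⟩
  M * (4 * (β + γ) + 5) * τ
    ≤⟨ *-monoˡ-≤ τ u²≥ ⟩
  u * u * τ
    ≡⟨ *-assoc u u τ ⟩
  u * (u * τ) ∎
  where
  open ≤-Reasoning
  collected : ∀ M β γ ℓ thr n Λ →
    M * (M * (ℓ * thr) + M * (ℓ * Λ) + n + (1 + β) * (M * ℓ)) + M * n + M * ((1 + γ) * (M * ℓ)) ≡
    M * M * ℓ * thr + M * M * ℓ * (Λ + (1 + β) + (1 + γ)) + 2 * M * n
  collected = solve-∀
  factor : ∀ M C τ → τ + τ + 2 * M * (τ + 2 * (C * τ)) ≡ (2 + 2 * M + 4 * (M * C)) * τ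
  factor = solve-∀
  gap : 2 + 2 * M + 4 * (M * (β + γ)) < M * (4 * (β + γ) + 5)
  gap = linear 0 (scale 3 M>0) (identity M (β + γ))
    where
    identity : ∀ M C → suc (2 + 2 * M + 4 * (M * C)) + 3 * M + 0 ≡ M * (4 * C + 5) + 3 * 1
    identity = solve-∀

module Roth
  (k : ℕ) (c : Fin k → ℤ) (Σc≡0 : Σℤ k c ≡ + 0)
  (i₁ y z : Fin k) (i₁≢y : i₁ ≢ y) (i₁≢z : i₁ ≢ z) (y≢z : y ≢ z)
  (b g : ℕ) (cy : c y ≡ + suc b) (cz : c z ≡ -[1+ g ]) (c₁≢0 : c i₁ ≢ + 0)
  where

  private
    β γ C : ℕ
    β = suc b
    γ = suc g
    C = β + γ

  DensityBound : ℕ → ℕ → Set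
  DensityBound M u = Σ ℕ λ ℓ → 0 < ℓ × (∀ f → ¬ Solution k c f → M * ∑ ℓ (λ j → ⟦ f (+ j) ⟧) ≤ u * ℓ)

  decrement : ∀ M′ h → suc h ≤ suc M′ → 2 * C + 4 ≤ suc h → suc M′ * (4 * C + 5) ≤ suc h * suc h →
    DensityBound (suc M′) (suc h) → DensityBound (suc M′) h
  decrement M′ h u≤M u≥ u²≥ (ℓ , ℓ>0 , ub) = n , n>0 , S.Constants.bound L (suc ρ) X Λ t₀ Q τ thr R n X>0 refl
    (m≤m*n X (cubeLength (suc ρ) (2 * M)) {{>-nonZero cube>0}}) ≤-refl ≤-refl refl refl R<m refl window final
    where
    open ≤-Reasoning
    module S = Step k c Σc≡0 i₁ y z i₁≢y i₁≢z y≢z b g cy cz c₁≢0 M′ h ℓ ℓ>0 ub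
    M u ρ X L Λ t₀ θ thr Q τ R n : ℕ
    M   = suc M′
    u   = suc h
    -- The cube dimension `suc ρ` depends on M and ℓ only, so L is fixed before thr. This avoids a
    -- circle: τ is ρ times thr, and R < suc ρ * thr holds as soon as thr exceeds t₀ + Λ.
    ρ   = M * M * ℓ
    X   = 2 * M * suc k
    L   = X * cubeLength (suc ρ) (2 * M)
    Λ   = L * S.N
    t₀  = suc (β * L + γ * L + β * Λ + Λ)
    -- θ dominates both t₀ + Λ, as `R<m` demands, and the lower-order terms of the final estimate.
    -- The factor `L * (γ * β)` in thr makes τ a whole number of windows.
    θ   = t₀ + Λ + (Λ + (1 + β) + (1 + γ))
    thr = θ * (L * (γ * β))
    Q   = ρ * θ
    τ   = Q * (L * (γ * β))
    R   = t₀ + τ + Λ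
    n   = τ + C * R
    ρ>0 : 0 < ρ
    ρ>0 = *-mono-< {0} {M * M} (s≤s z≤n) ℓ>0
    X>0 : 0 < X
    X>0 = s≤s z≤n
    cube>0 : 0 < cubeLength (suc ρ) (2 * M)
    cube>0 = cubeLength>0 (suc ρ) (2 * M) (s≤s z≤n)
    Lγβ>0 : 0 < L * (γ * β)
    Lγβ>0 = *-mono-< (*-mono-< X>0 cube>0) (s≤s z≤n)
    θ≤thr : θ ≤ thr
    θ≤thr = m≤m*n θ (L * (γ * β)) {{>-nonZero Lγβ>0}}
    τ≡ρthr : τ ≡ ρ * thr
    τ≡ρthr = *-assoc ρ θ (L * (γ * β))
    thr≤τ : thr ≤ τ
    thr≤τ = ≤-trans (m≤n*m thr ρ {{>-nonZero ρ>0}}) (≤-reflexive (sym τ≡ρthr))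
    t₀Λ<thr : t₀ + Λ < thr
    t₀Λ<thr = <-≤-trans (m<m+n (t₀ + Λ) (≤-trans (s≤s z≤n) (m≤n+m (1 + γ) (Λ + (1 + β))))) θ≤thr
    τ>0 : 0 < τ
    τ>0 = <-≤-trans (≤-<-trans z≤n t₀Λ<thr) thr≤τ
    n>0 : 0 < n
    n>0 = ≤-trans τ>0 (m≤m+n τ (C * R))
    R≡ : R ≡ t₀ + Λ + τ
    R≡ = swap t₀ τ Λ
      where
      swap : ∀ a b c → a + b + c ≡ a + c + b
      swap = solve-∀
    R<m : R < suc ρ * thr
    R<m = begin-strict
      R                  ≡⟨ R≡ ⟩
      t₀ + Λ + τ         <⟨ +-monoˡ-< τ t₀Λ<thr ⟩
      thr + τ            ≡⟨ cong (λ x → thr + x) τ≡ρthr ⟩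
      thr + ρ * thr      ∎
    n≤ : n ≤ τ + 2 * (C * τ)
    n≤ = +-monoʳ-≤ τ (begin
      C * R              ≤⟨ scale C (≤-trans (≤-reflexive R≡) (+-monoˡ-≤ τ (≤-trans (<⇒≤ t₀Λ<thr) thr≤τ))) ⟩
      C * (τ + τ)        ≡⟨ double C τ ⟩
      2 * (C * τ)        ∎)
      where
      double : ∀ C τ → C * (τ + τ) ≡ 2 * (C * τ)
      double = solve-∀
    2≤thr : 2 ≤ thr
    2≤thr = ≤-trans (s≤s (s≤s z≤n)) (≤-trans (m≤n+m (1 + γ) (t₀ + Λ + (Λ + (1 + β)))) (≤-trans (≤-reflexive (+-assoc (t₀ + Λ) (Λ + (1 + β)) (1 + γ))) θ≤thr))
    2Mℓ≤τ : 2 * (M * ℓ) ≤ τ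
    2Mℓ≤τ = begin
      2 * (M * ℓ)        ≡⟨ *-comm 2 (M * ℓ) ⟩
      M * ℓ * 2          ≤⟨ *-mono-≤ (*-monoˡ-≤ ℓ (m≤m*n M M)) 2≤thr ⟩
      ρ * thr            ≡⟨ τ≡ρthr ⟨
      τ                  ∎
    window : τ + n + 2 * (M * ℓ) < u * τ
    window = begin-strict
      τ + n + 2 * (M * ℓ)                  ≤⟨ +-mono-≤ (+-monoʳ-≤ τ n≤) 2Mℓ≤τ ⟩
      τ + (τ + 2 * (C * τ)) + τ            <⟨ m<m+n _ τ>0 ⟩
      τ + (τ + 2 * (C * τ)) + τ + τ        ≡⟨ collected C τ ⟩
      (2 * C + 4) * τ                      ≤⟨ *-monoˡ-≤ τ u≥ ⟩
      u * τ                                ∎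
      where
      collected : ∀ C τ → τ + (τ + 2 * (C * τ)) + τ + τ ≡ (2 * C + 4) * τ
      collected = solve-∀
    final : M * (u * (ℓ * thr) + M * (ℓ * Λ) + n + (1 + β) * (M * ℓ)) + u * n + u * ((1 + γ) * (M * ℓ)) < u * (u * τ)
    final = final-estimate M u β γ ℓ thr τ n Λ τ≡ρthr u≤M (≤-trans (m≤n+m _ (t₀ + Λ)) θ≤thr) n≤ u²≥ τ>0 (s≤s z≤n)

  -- With H = q (4 C + 5) and M = q H, every u ≥ H satisfies u² ≥ H² = M (4 C + 5). The decrement
  -- therefore applies all the way down to H, where H / M = 1 / q.
  threshold : ℕ → ℕ
  threshold q = q * (4 * C + 5)

  descend : ∀ q M′ → suc M′ ≡ suc q * threshold (suc q) → ∀ d → threshold (suc q) + d ≤ suc M′ →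
    DensityBound (suc M′) (threshold (suc q) + d) → DensityBound (suc M′) (threshold (suc q))
  descend q M′ M≡ zero    le D = subst (DensityBound (suc M′)) (+-identityʳ (threshold (suc q))) D
  descend q M′ M≡ (suc d) le D = descend q M′ M≡ d (≤-trans (+-monoʳ-≤ H (n≤1+n d)) le)
    (decrement M′ (H + d) (subst (_≤ suc M′) (+-suc H d) le) u≥ u²≥
      (subst (DensityBound (suc M′)) (+-suc H d) D))
    where
    open ≤-Reasoning
    H : ℕ
    H = threshold (suc q)
    H≤u : H ≤ suc (H + d)
    H≤u = ≤-trans (m≤m+n H d) (n≤1+n _)
    u≥ : 2 * C + 4 ≤ suc (H + d)
    u≥ = ≤-trans (+-mono-≤ (*-monoˡ-≤ C {2} {4} (s≤s (s≤s z≤n))) (n≤1+n 4)) (≤-trans (m≤n*m (4 * C + 5) (suc q)) H≤u)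
    u²≥ : suc M′ * (4 * C + 5) ≤ suc (H + d) * suc (H + d)
    u²≥ = begin
      suc M′ * (4 * C + 5)                  ≡⟨ cong (_* (4 * C + 5)) M≡ ⟩
      suc q * H * (4 * C + 5)               ≡⟨ swap (suc q) H (4 * C + 5) ⟩
      H * H                                 ≤⟨ *-mono-≤ H≤u H≤u ⟩
      suc (H + d) * suc (H + d)             ∎
      where
      swap : ∀ q h x → q * h * x ≡ q * x * h
      swap = solve-∀

  density-bound : ∀ q → DensityBound (suc q * threshold (suc q)) (threshold (suc q))
  density-bound q = from (suc q * H) refl
    where
    H : ℕ
    H = threshold (suc q)
    from : ∀ M → M ≡ suc q * H → DensityBound M H
    from zero     M≡ = 1 , s≤s z≤n , λ _ _ → z≤n
    from (suc M′) M≡ with d , H+d≡ ← m≤n⇒∃[o]m+o≡n (≤-trans (m≤n*m H (suc q)) (≤-reflexive (sym M≡))) =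
      -- The descent starts from u = M, the trivial bound for intervals of length 1.
      descend q M′ M≡ d (≤-reflexive H+d≡) (subst (DensityBound (suc M′)) (sym H+d≡)
        (1 , s≤s z≤n , λ f _ → scale (suc M′) (∑-indicator≤ 1 (λ j → f (+ j)))))

  roth : ∀ q → Σ ℕ λ ℓ → ∀ f → ¬ Solution k c f → ∀ n → suc q * ∑ n (λ j → ⟦ f (+ j) ⟧) ≤ n + suc q * ℓ
  roth q = ℓ , λ f free n → subst (λ x → suc q * ∑ n (λ j → ⟦ f (+ j) ⟧) ≤ x + suc q * ℓ) (*-identityˡ n)
    (APBounds.interval-bound (suc q) 1 ℓ ℓ>0 (λ j → ⟦ f (+ j) ⟧) (λ j → ⟦⟧≤1 (f (+ j))) (ap-bound f free) 0 n)
    where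
    H ℓ : ℕ
    H = threshold (suc q)
    ℓ = proj₁ (density-bound q)
    ℓ>0 : 0 < ℓ
    ℓ>0 = proj₁ (proj₂ (density-bound q))
    cancel : ∀ {S} → suc q * H * S ≤ H * ℓ → suc q * S ≤ 1 * ℓ
    cancel {S} le = *-cancelˡ-≤ H (≤-trans (≤-reflexive (swap (suc q) H S))
      (≤-trans le (≤-reflexive (cong (H *_) (sym (*-identityˡ ℓ))))))
      where
      swap : ∀ q h s → h * (q * s) ≡ q * h * s
      swap = solve-∀
    ap-bound : ∀ f → ¬ Solution k c f → ∀ r d → 0 < d → suc q * ∑ ℓ (λ t → ⟦ f (+ (r + t * d)) ⟧) ≤ 1 * ℓ
    ap-bound f free r d d>0 = subst (λ x → suc q * x ≤ 1 * ℓ)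
      (∑-cong ℓ (λ t → cong (λ x → ⟦ f (+ r ℤ.+ x) ⟧) (trans (sym (ℤₚ.pos-* d t)) (cong ℤ.+_ (*-comm d t)))))
      (cancel (proj₂ (proj₂ (density-bound q)) (λ s → f (+ r ℤ.+ + d ℤ.* s))
        (free ∘ solution-affine k c f Σc≡0 (+ r) (+ d) (λ { refl → contradiction d>0 (λ ()) }))))

-- Independent vertices of sparse digraphs

∑Fin-+ : ∀ n (f g : Fin n → ℕ) → ∑Fin n (λ i → f i + g i) ≡ ∑Fin n f + ∑Fin n g
∑Fin-+ zero    f g = refl
∑Fin-+ (suc n) f g = trans (cong (λ z → f fzero + g fzero + z) (∑Fin-+ n (f ∘ fsuc) (g ∘ fsuc)))
  (interchange (f fzero) (g fzero) _ _)
  where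
  interchange : ∀ a b c d → a + b + (c + d) ≡ a + c + (b + d)
  interchange = solve-∀

∑Fin-const : ∀ n c → ∑Fin n (λ _ → c) ≡ n * c
∑Fin-const zero    c = refl
∑Fin-const (suc n) c = cong (λ z → c + z) (∑Fin-const n c)

∑Fin-* : ∀ n c (f : Fin n → ℕ) → ∑Fin n (λ i → c * f i) ≡ c * ∑Fin n f
∑Fin-* zero    c f = sym (*-zeroʳ c)
∑Fin-* (suc n) c f = trans (cong (λ z → c * f fzero + z) (∑Fin-* n c (f ∘ fsuc))) (sym (*-distribˡ-+ c (f fzero) _))

∑Fin-swap : ∀ m n (f : Fin m → Fin n → ℕ) → ∑Fin m (λ i → ∑Fin n (f i)) ≡ ∑Fin n (λ j → ∑Fin m (λ i → f i j))
∑Fin-swap zero    n f = sym (trans (∑Fin-const n 0) (*-zeroʳ n))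
∑Fin-swap (suc m) n f = trans (cong (λ z → ∑Fin n (f fzero) + z) (∑Fin-swap m n (f ∘ fsuc)))
  (sym (∑Fin-+ n (f fzero) _))

∑Fin-term : ∀ n (f : Fin n → ℕ) i → f i ≤ ∑Fin n f
∑Fin-term (suc n) f fzero    = m≤m+n _ _
∑Fin-term (suc n) f (fsuc i) = ≤-trans (∑Fin-term n (f ∘ fsuc) i) (m≤n+m _ _)

∑Fin-pigeonhole : ∀ n (f g : Fin n → ℕ) → ∑Fin n f < ∑Fin n g → Σ (Fin n) λ i → f i < g i
∑Fin-pigeonhole (suc n) f g lt with f fzero <? g fzero
... | yes p = fzero , p
... | no ¬p with i , p ← ∑Fin-pigeonhole n (f ∘ fsuc) (g ∘ fsuc)
      (+-cancelˡ-< (g fzero) _ _ (≤-<-trans (+-monoˡ-≤ _ (≮⇒≥ ¬p)) lt)) = fsuc i , p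

# : ∀ {n} → (Fin n → Bool) → ℕ
# {n} P = ∑Fin n (λ i → ⟦ P i ⟧)

#-mono : ∀ {n} {P Q : Fin n → Bool} → (∀ i → P i ≡ true → Q i ≡ true) → # P ≤ # Q
#-mono {n} P⊆Q = ∑Fin-mono n (λ i → ⟦⟧-mono (P⊆Q i))

#-all : ∀ {n} {P : Fin n → Bool} → (∀ i → P i ≡ true) → # P ≡ n
#-all {zero}  all = refl
#-all {suc n} all rewrite all fzero = cong suc (#-all (all ∘ fsuc))

#-unique : ∀ {n} {P : Fin n → Bool} → (∀ {i j} → P i ≡ true → P j ≡ true → i ≡ j) → # P ≤ 1
#-unique {zero} uniq = z≤n
#-unique {suc n} {P} uniq with P fzero in eq
... | false = #-unique (λ p q → fsuc-injective (uniq p q))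
... | true  = s≤s (≤-trans (#-mono none) (≤-reflexive (trans (∑Fin-const n 0) (*-zeroʳ n))))
  where
  none : ∀ i → P (fsuc i) ≡ true → false ≡ true
  none i p = contradiction (uniq eq p) fzero≢fsuc

-- Each element is charged to a label in `Fin D`, and a label is charged at most once.
#-bounded : ∀ {n D} {P : Fin n → Bool} (R : Fin D → Fin n → Set) →
  (∀ {i} → P i ≡ true → Σ (Fin D) λ q → R q i) → (∀ {q i j} → R q i → R q j → i ≡ j) → # P ≤ D
#-bounded {n} {D} {P} R choose functional = begin
  # P                                            ≤⟨ ∑Fin-mono n covered ⟩
  ∑Fin n (λ i → ∑Fin D (λ q → ⟦ hit q i ⟧))      ≡⟨ ∑Fin-swap n D _ ⟩
  ∑Fin D (λ q → # (hit q))                       ≤⟨ ∑Fin-mono D (λ q → #-unique (λ p p′ → functional (hit-R p) (hit-R p′))) ⟩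
  ∑Fin D (λ _ → 1)                               ≡⟨ trans (∑Fin-const D 1) (*-identityʳ D) ⟩
  D                                              ∎
  where
  open ≤-Reasoning
  -- The label depends on the equation `P i ≡ true`, so the boolean is passed along with its
  -- equation.
  hitAt : Fin D → ∀ i b → P i ≡ b → Bool
  hitAt q i true  Pi = does (q ≟ proj₁ (choose Pi))
  hitAt q i false Pi = false
  hit : Fin D → Fin n → Bool
  hit q i = hitAt q i (P i) refl
  hitAt-R : ∀ q i b Pi → hitAt q i b Pi ≡ true → R q i
  hitAt-R q i true Pi p with q ≟ proj₁ (choose Pi)
  ... | yes refl = proj₂ (choose Pi)
  hit-R : ∀ {q i} → hit q i ≡ true → R q i
  hit-R {q} {i} = hitAt-R q i (P i) refl
  coveredAt : ∀ i b (Pi : P i ≡ b) → ⟦ b ⟧ ≤ ∑Fin D (λ q → ⟦ hitAt q i b Pi ⟧)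
  coveredAt i false Pi = z≤n
  coveredAt i true  Pi = ≤-trans (≤-reflexive (cong ⟦_⟧ (sym (dec-true (proj₁ (choose Pi) ≟ proj₁ (choose Pi)) refl))))
    (∑Fin-term D (λ q → ⟦ does (q ≟ proj₁ (choose Pi)) ⟧) (proj₁ (choose Pi)))
  covered : ∀ i → ⟦ P i ⟧ ≤ ∑Fin D (λ q → ⟦ hit q i ⟧)
  covered i = coveredAt i (P i) refl

record IndependentIn {n} (D : ℕ) (bad : Fin n → Fin n → Bool) (V : Fin n → Bool) : Set where
  field
    I          : Fin n → Bool
    I⊆V        : ∀ {i} → I i ≡ true → V i ≡ true
    compatible : ∀ {u v} → I u ≡ true → I v ≡ true → u ≢ v → bad u v ≡ false × bad v u ≡ false
    large      : # V ≤ suc (2 * D) * # I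

module _ {n} (D : ℕ) (bad : Fin n → Fin n → Bool) (out-degree : ∀ v → # (bad v) ≤ D) where

  -- The in-degrees inside V average at most D, so some vertex of V conflicts with at most 2 D others.
  low-in-degree : ∀ V → 0 < # V → Σ (Fin n) λ u → V u ≡ true × # (λ v → V v ∧ bad v u) ≤ D
  low-in-degree V V>0 = finish (∑Fin-pigeonhole n (λ u → ⟦ V u ⟧ * # (λ v → V v ∧ bad v u)) (λ u → suc D * ⟦ V u ⟧)
    (begin-strict
      ∑Fin n (λ u → ⟦ V u ⟧ * # (λ v → V v ∧ bad v u))       ≤⟨ ∑Fin-mono n (λ u → drop (V u) _) ⟩
      ∑Fin n (λ u → # (λ v → V v ∧ bad v u))                 ≡⟨ ∑Fin-swap n n _ ⟩
      ∑Fin n (λ v → ∑Fin n (λ u → ⟦ V v ∧ bad v u ⟧))        ≤⟨ ∑Fin-mono n out ⟩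
      ∑Fin n (λ v → D * ⟦ V v ⟧)                             ≡⟨ ∑Fin-* n D _ ⟩
      D * # V                                                <⟨ m<n+m (D * # V) V>0 ⟩
      suc D * # V                                            ≡⟨ ∑Fin-* n (suc D) _ ⟨
      ∑Fin n (λ v → suc D * ⟦ V v ⟧)                         ∎))
    where
    open ≤-Reasoning
    drop : ∀ b x → ⟦ b ⟧ * x ≤ x
    drop true  x = ≤-reflexive (+-identityʳ x)
    drop false x = z≤n
    out : ∀ v → ∑Fin n (λ u → ⟦ V v ∧ bad v u ⟧) ≤ D * ⟦ V v ⟧
    out v with V v
    ... | true  = ≤-trans (out-degree v) (≤-reflexive (sym (*-identityʳ D)))
    ... | false = ≤-trans (≤-reflexive (trans (∑Fin-const n 0) (*-zeroʳ n))) z≤n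
    finish : (Σ (Fin n) λ u → ⟦ V u ⟧ * # (λ v → V v ∧ bad v u) < suc D * ⟦ V u ⟧) →
      Σ (Fin n) λ u → V u ≡ true × # (λ v → V v ∧ bad v u) ≤ D
    finish (u , lt) with V u in eq
    ... | false = contradiction lt (λ lt → <⇒≱ lt (≤-trans (≤-reflexive (*-zeroʳ D)) z≤n))
    ... | true  = u , eq , ≤-pred (subst₂ _<_ (+-identityʳ _) (*-identityʳ (suc D)) lt)

  -- Greedy choice: a vertex from `low-in-degree` eliminates itself, at most D out-neighbours and at
  -- most D in-neighbours inside V, whence the ratio 2 D + 1. The number m only bounds the
  -- recursion.
  independent : ∀ m V → # V ≤ m → IndependentIn D bad V
  independent m V V≤m with 0 <? # V
  independent m V V≤m | no V≯0 = record
    { I = λ _ → false ; I⊆V = λ () ; compatible = λ () ; large = ≤-trans (≮⇒≥ V≯0) z≤n }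
  independent zero    V V≤m | yes V>0 = contradiction (<-≤-trans V>0 V≤m) (λ ())
  independent (suc m) V V≤m | yes V>0 with u , Vu , in-degree ← low-in-degree V V>0 = record
    { I = I ; I⊆V = I⊆V ; compatible = compatible ; large = large }
    where
    conflict : Fin n → Bool
    conflict v = does (v ≟ u) ∨ (bad u v ∨ bad v u)
    V′ : Fin n → Bool
    V′ v = V v ∧ not (conflict v)
    V′-true : ∀ {v} → V′ v ≡ true → V v ≡ true × v ≢ u × bad u v ≡ false × bad v u ≡ false
    V′-true {v} p with V v | v ≟ u | bad u v | bad v u
    ... | true | no v≢u | false | false = refl , v≢u , refl , refl
    one : 1 ≤ # (λ v → does (v ≟ u))
    one = ≤-trans (≤-reflexive (cong ⟦_⟧ (sym (dec-true (u ≟ u) refl)))) (∑Fin-term n (λ v → ⟦ does (v ≟ u) ⟧) u)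
    V′<V : # V′ < # V
    V′<V = ≤-trans (≤-reflexive (+-comm 1 (# V′))) (≤-trans (+-monoʳ-≤ (# V′) one)
      (≤-trans (≤-reflexive (sym (∑Fin-+ n _ _))) (∑Fin-mono n pointwise)))
        where
        pointwise : ∀ v → ⟦ V′ v ⟧ + ⟦ does (v ≟ u) ⟧ ≤ ⟦ V v ⟧
        pointwise v with v ≟ u
        ... | yes refl rewrite Vu = ≤-refl
        ... | no  _ with V v | bad u v ∨ bad v u
        ...   | true  | true  = z≤n
        ...   | true  | false = ≤-refl
        ...   | false | _     = z≤n
    open IndependentIn (independent m V′ (≤-pred (≤-trans V′<V V≤m)))
      renaming (I to I′; I⊆V to I′⊆V′; compatible to compatible′; large to large′)
    I : Fin n → Bool
    I v = does (v ≟ u) ∨ I′ v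
    I⊆V : ∀ {v} → I v ≡ true → V v ≡ true
    I⊆V {v} p with v ≟ u
    ... | yes refl = Vu
    ... | no _     = proj₁ (V′-true (I′⊆V′ p))
    compatible : ∀ {v w} → I v ≡ true → I w ≡ true → v ≢ w → bad v w ≡ false × bad w v ≡ false
    compatible {v} {w} p q v≢w with v ≟ u | w ≟ u
    ... | yes refl | yes refl = contradiction refl v≢w
    ... | yes refl | no _     = proj₂ (proj₂ (V′-true (I′⊆V′ q)))
    ... | no _     | yes refl = let c = proj₂ (proj₂ (V′-true (I′⊆V′ p))) in proj₂ c , proj₁ c
    ... | no _     | no _     = compatible′ p q v≢w
    I≥ : suc (# I′) ≤ # I
    I≥ = ≤-trans (+-monoˡ-≤ (# I′) one) (≤-trans (≤-reflexive (sym (∑Fin-+ n _ _))) (∑Fin-mono n pointwise))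
      where
      pointwise : ∀ v → ⟦ does (v ≟ u) ⟧ + ⟦ I′ v ⟧ ≤ ⟦ I v ⟧
      pointwise v with v ≟ u
      ... | no _ = ≤-refl
      ... | yes refl with I′ v in eq
      ...   | false = ≤-refl
      ...   | true  = contradiction refl (proj₁ (proj₂ (V′-true (I′⊆V′ eq))))
    removed : # V ≤ # V′ + suc (2 * D)
    removed = begin
      # V                                                                      ≤⟨ ∑Fin-mono n pointwise ⟩
      ∑Fin n (λ v → ⟦ V′ v ⟧ + (⟦ does (v ≟ u) ⟧ + (⟦ bad u v ⟧ + ⟦ V v ∧ bad v u ⟧)))
        ≡⟨ trans (∑Fin-+ n _ _) (cong (λ z → # V′ + z) (trans (∑Fin-+ n _ _) (cong (λ z → # (λ v → does (v ≟ u)) + z) (∑Fin-+ n _ _)))) ⟩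
      # V′ + (# (λ v → does (v ≟ u)) + (# (bad u) + # (λ v → V v ∧ bad v u)))
        ≤⟨ +-monoʳ-≤ (# V′) (+-mono-≤ (#-unique same) (+-mono-≤ (out-degree u) in-degree)) ⟩
      # V′ + (1 + (D + D))                                                     ≡⟨ cong (λ z → # V′ + suc (D + z)) (+-identityʳ D) ⟨
      # V′ + suc (2 * D)                                                       ∎
      where
      open ≤-Reasoning
      same : ∀ {i j} → does (i ≟ u) ≡ true → does (j ≟ u) ≡ true → i ≡ j
      same {i} {j} p q with i ≟ u | j ≟ u
      ... | yes refl | yes refl = refl
      pointwise : ∀ v → ⟦ V v ⟧ ≤ ⟦ V′ v ⟧ + (⟦ does (v ≟ u) ⟧ + (⟦ bad u v ⟧ + ⟦ V v ∧ bad v u ⟧))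
      pointwise v with V v | does (v ≟ u) | bad u v | bad v u
      ... | false | _     | _     | _     = z≤n
      ... | true  | true  | _     | _     = s≤s z≤n
      ... | true  | false | true  | _     = s≤s z≤n
      ... | true  | false | false | true  = ≤-refl
      ... | true  | false | false | false = ≤-refl
    large : # V ≤ suc (2 * D) * # I
    large = begin
      # V                                        ≤⟨ removed ⟩
      # V′ + suc (2 * D)                         ≤⟨ +-monoˡ-≤ _ large′ ⟩
      suc (2 * D) * # I′ + suc (2 * D)           ≡⟨ trans (+-comm _ (suc (2 * D))) (sym (*-suc (suc (2 * D)) (# I′))) ⟩
      suc (2 * D) * suc (# I′)                   ≤⟨ scale (suc (2 * D)) I≥ ⟩
      suc (2 * D) * # I                          ∎
      where open ≤-Reasoning

  independent-subset : ∀ V → IndependentIn D bad V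
  independent-subset V = independent (# V) V ≤-refl

∣insert∣ : ∀ {p} (J : Subset p) x → ¬ x ∈ J → ∣ J [ x ]≔ inside ∣ ≡ suc ∣ J ∣
∣insert∣ (true  ∷ J) fzero    x∉J = contradiction here x∉J
∣insert∣ (false ∷ J) fzero    x∉J = refl
∣insert∣ (true  ∷ J) (fsuc x) x∉J = cong suc (∣insert∣ J x (x∉J ∘ there))
∣insert∣ (false ∷ J) (fsuc x) x∉J = ∣insert∣ J x (x∉J ∘ there)

∈-insert : ∀ {p} (J : Subset p) x {y} → y ∈ J [ x ]≔ inside → y ≡ x ⊎ y ∈ J
∈-insert (b ∷ J) fzero    here      = inj₁ refl
∈-insert (b ∷ J) fzero    (there q) = inj₂ (there q)
∈-insert (b ∷ J) (fsuc x) here      = inj₂ here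
∈-insert (b ∷ J) (fsuc x) (there q) with ∈-insert J x q
... | inj₁ e = inj₁ (cong fsuc e)
... | inj₂ r = inj₂ (there r)

image : ∀ {n p} (I : Fin n → Bool) (x : Fin n → Fin p) →
  (∀ {i j} → I i ≡ true → I j ≡ true → x i ≡ x j → i ≡ j) →
  Σ (Subset p) λ J → (∀ {y} → y ∈ J → Σ (Fin n) λ i → I i ≡ true × x i ≡ y) × # I ≤ ∣ J ∣
image {zero} I x inj = ∅ , (λ y∈∅ → contradiction y∈∅ ∉⊥) , z≤n
image {suc n} I x inj with J , J⇒ , le ← image (I ∘ fsuc) (x ∘ fsuc) (λ p q e → fsuc-injective (inj p q e)) with I fzero in eq
... | false = J , (λ y∈J → let i , Ii , e = J⇒ y∈J in fsuc i , Ii , e) , le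
... | true  = J [ x fzero ]≔ inside , from , ≤-trans (s≤s le) (≤-reflexive (sym (∣insert∣ J (x fzero) fresh)))
  where
  fresh : ¬ x fzero ∈ J
  fresh x∈J = let i , Ii , e = J⇒ x∈J in contradiction (inj eq Ii (sym e)) fzero≢fsuc
  from : ∀ {y} → y ∈ J [ x fzero ]≔ inside → Σ (Fin (suc n)) λ i → I i ≡ true × x i ≡ y
  from y∈ with ∈-insert J (x fzero) y∈
  ... | inj₁ refl = fzero , eq , refl
  ... | inj₂ y∈J  = let i , Ii , e = J⇒ y∈J in fsuc i , Ii , e

-- Allows finitely many undecided statements, such as the existence of a walk from each vertex, to
-- be treated as decided while a stable inequality is proved.
¬¬-∀ : ∀ {n} {F : Fin n → Set} → (∀ i → ¬ ¬ F i) → ¬ ¬ (∀ i → F i)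
¬¬-∀ {zero}  f ¬all = ¬all λ ()
¬¬-∀ {suc n} f ¬all = f fzero λ F₀ → ¬¬-∀ (f ∘ fsuc) λ tail → ¬all λ { fzero → F₀ ; (fsuc i) → tail i }

-- Walks in the Cayley graph

module ModPrime (p : ℕ) (p-prime : Prime p) where

  instance
    p-nonZero : NonZero p
    p-nonZero = prime⇒nonZero p-prime

  -- A convenient form of invertibility modulo p: fixed nonzero coefficients satisfy it for all
  -- large p.
  Unit : ℤ → Set
  Unit c = c ≢ + 0 × ℤ.∣ c ∣ < p

  cancel-unit : ∀ {c} x → Unit c → + p ∣ c ℤ.* x → + p ∣ x
  cancel-unit {c} x (c≢0 , c<p) p∣cx
    with euclidsLemma ℤ.∣ c ∣ ℤ.∣ x ∣ p-prime (subst (p ℕ∣.∣_) (ℤₚ.abs-* c x) (∣⇒∣ᵤ p∣cx))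
  ... | inj₂ p∣x = ∣ᵤ⇒∣ p∣x
  ... | inj₁ p∣c = contradiction p∣c (ℕ∣.>⇒∤ {{ℤ.≢-nonZero c≢0}} c<p)

  residue-unique : ∀ {x y : Fin p} → + p ∣ + toℕ x ℤ.- + toℕ y → x ≡ y
  residue-unique {x} {y} p∣x-y = toℕ-injective (ℤₚ.+-injective (ℤₚ.i-j≡0⇒i≡j (+ toℕ x) (+ toℕ y)
    (ℤₚ.∣i∣≡0⇒i≡0 (small ℤ.∣ + toℕ x ℤ.- + toℕ y ∣ (∣⇒∣ᵤ p∣x-y) close))))
    where
    small : ∀ m → p ℕ∣.∣ m → m < p → m ≡ 0
    small zero    _   _   = refl
    small (suc m) p∣m m<p = contradiction p∣m (ℕ∣.>⇒∤ m<p)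
    close : ℤ.∣ + toℕ x ℤ.- + toℕ y ∣ < p
    close = ≤-<-trans (≤-trans (≤-reflexive (cong ℤ.∣_∣ (ℤₚ.[+m]-[+n]≡m⊖n (toℕ x) (toℕ y)))) (ℤₚ.∣m⊝n∣≤m⊔n (toℕ x) (toℕ y)))
      (⊔-lub (toℕ<n x) (toℕ<n y))

  inverse : ∀ {c} → Unit c → Σ ℤ λ j → + p ∣ c ℤ.* j ℤ.- + 1
  inverse {c} (c≢0 , c<p) = signed c (inverse-abs (coprime-Bézout (prime⇒coprime p-prime {{ℤ.≢-nonZero c≢0}} c<p)))
    where
    inverse-abs : ∀ {m} → Bézout.Identity 1 p m → Σ ℤ λ j → + p ∣ + m ℤ.* j ℤ.- + 1
    inverse-abs {m} (Bézout.+- x y eq) = ℤ.- + y , divides (ℤ.- + x) (begin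
      + m ℤ.* (ℤ.- + y) ℤ.- + 1          ≡⟨ rearrange (+ m) (+ y) ⟩
      ℤ.- (+ 1 ℤ.+ + y ℤ.* + m)          ≡⟨ cong (λ z → ℤ.- (+ 1 ℤ.+ z)) (ℤₚ.pos-* y m) ⟨
      ℤ.- (+ (1 + y * m))                ≡⟨ cong (λ z → ℤ.- + z) eq ⟩
      ℤ.- (+ (x * p))                    ≡⟨ cong ℤ.-_ (ℤₚ.pos-* x p) ⟩
      ℤ.- (+ x ℤ.* + p)                  ≡⟨ ℤₚ.neg-distribˡ-* (+ x) (+ p) ⟩
      ℤ.- + x ℤ.* + p                    ∎)
      where
      open ≡-Reasoning
      rearrange : ∀ m y → m ℤ.* (ℤ.- y) ℤ.- + 1 ≡ ℤ.- (+ 1 ℤ.+ y ℤ.* m)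
      rearrange = ℤSolver.solve-∀
    inverse-abs {m} (Bézout.-+ x y eq) = + y , divides (+ x) (begin
      + m ℤ.* + y ℤ.- + 1                ≡⟨ cong (λ z → z ℤ.- + 1) (ℤₚ.pos-* m y) ⟨
      + (m * y) ℤ.- + 1                  ≡⟨ cong (λ z → + z ℤ.- + 1) (trans (*-comm m y) (sym eq)) ⟩
      + 1 ℤ.+ + (x * p) ℤ.- + 1          ≡⟨ drop (+ (x * p)) ⟩
      + (x * p)                          ≡⟨ ℤₚ.pos-* x p ⟩
      + x ℤ.* + p                        ∎)
      where
      open ≡-Reasoning
      drop : ∀ a → + 1 ℤ.+ a ℤ.- + 1 ≡ a
      drop = ℤSolver.solve-∀
    signed : ∀ c → (Σ ℤ λ j → + p ∣ + ℤ.∣ c ∣ ℤ.* j ℤ.- + 1) → Σ ℤ λ j → + p ∣ c ℤ.* j ℤ.- + 1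
    signed (+ m)    found   = found
    signed -[1+ m ] (j , d) = ℤ.- j , subst (λ x → + p ∣ x ℤ.- + 1) (flip (+ suc m) j) d
      where
      flip : ∀ m j → m ℤ.* j ≡ ℤ.- m ℤ.* ℤ.- j
      flip = ℤSolver.solve-∀

  solve-linear : ∀ {c} → Unit c → ∀ t → Σ (Fin p) λ x → + p ∣ t ℤ.+ c ℤ.* + toℕ x
  solve-linear {c} unit t = fromℕ< (ℤDivMod.n%ℕd<d a p) ,
    subst (+ p ∣_) (trans (expand t c j (a ℤDivMod./ℕ p) (+ p)) (cong (λ x → t ℤ.+ c ℤ.* x) (sym x≡)))
      (∣m∣n⇒∣m-n (∣m⇒∣-m (∣n⇒∣m*n t (proj₂ (inverse unit)))) (∣n⇒∣m*n c (∣n⇒∣m*n (a ℤDivMod./ℕ p) ∣-refl)))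
    where
    j a : ℤ
    j = proj₁ (inverse unit)
    a = ℤ.- (t ℤ.* j)
    expand : ∀ t c j q p → ℤ.- (t ℤ.* (c ℤ.* j ℤ.- + 1)) ℤ.- c ℤ.* (q ℤ.* p) ≡ t ℤ.+ c ℤ.* (ℤ.- (t ℤ.* j) ℤ.- q ℤ.* p)
    expand = ℤSolver.solve-∀
    x≡ : + toℕ (fromℕ< (ℤDivMod.n%ℕd<d a p)) ≡ a ℤ.- (a ℤDivMod./ℕ p) ℤ.* + p
    x≡ = trans (cong ℤ.+_ (toℕ-fromℕ< _)) (trans (add-sub (+ (a ℤDivMod.%ℕ p)) ((a ℤDivMod./ℕ p) ℤ.* + p))
      (cong (λ z → z ℤ.- (a ℤDivMod./ℕ p) ℤ.* + p) (sym (ℤDivMod.a≡a%ℕn+[a/ℕn]*n a p))))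
      where
      add-sub : ∀ r m → r ≡ r ℤ.+ m ℤ.- m
      add-sub = ℤSolver.solve-∀

Σ-masked : ∀ {k p} → (Fin k → Bool) → (Fin k → ℤ) → (Fin k → Fin p) → ℤ
Σ-masked {k} U c z = Σℤ k (λ i → if U i then c i ℤ.* + toℕ (z i) else + 0)

-- The value at s is exempt from w-inj: when a block starts a walk, that value is replaced by the one at the walk's end.
record Block (k p : ℕ) (c : Fin k → ℤ) (U : Fin k → Bool) (s : Fin k) (A : Subset p) : Set where
  field
    w     : Fin k → Fin p
    w∈A   : ∀ i → w i ∈ A
    w-inj : ∀ {i j} → U i ≡ false → U j ≡ false → i ≢ s → j ≢ s → w i ≡ w j → i ≡ j
    Σw≡0  : + p ∣ Σ-masked (not ∘ U) c w

module Walks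
  (k p : ℕ) (p-prime : Prime p) (c : Fin k → ℤ) (U : Fin k → Bool) (s : Fin k) (A : Subset p)
  (c-unit : ∀ i → ModPrime.Unit p p-prime (c i)) (r : ℕ) (α≤r : ∀ J → Independent p A J → ∣ J ∣ ≤ r)
  {n : ℕ} (block : Fin n → Block k p c U s A)
  (disjoint : ∀ {a b} i j → Block.w (block a) i ≡ Block.w (block b) j → a ≡ b)
  where

  open ModPrime p p-prime

  w : Fin n → Fin k → Fin p
  w v = Block.w (block v)

  val : Fin n → ℤ
  val v = + toℕ (w v s)

  -- The coefficient list is arbitrary so that induction can peel off its first entry. The values
  -- must avoid the blocks at the two ends only, as the inner blocks of a walk do not occur in the
  -- final solution.
  record Walk {k′} (d : Fin k′ → ℤ) (U′ : Fin k′ → Bool) (v : Fin n) : Set where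
    field
      end       : Fin n
      z         : Fin k′ → Fin p
      z∈A       : ∀ i → U′ i ≡ true → z i ∈ A
      z-inj     : ∀ {i j} → U′ i ≡ true → U′ j ≡ true → z i ≡ z j → i ≡ j
      z∉start   : ∀ i → U′ i ≡ true → ∀ j → z i ≢ w v j
      z∉end     : ∀ i → U′ i ≡ true → ∀ j → z i ≢ w end j
      total     : + p ∣ c s ℤ.* (val end ℤ.- val v) ℤ.+ Σ-masked U′ d z
      end≢start : ∀ i → U′ i ≡ true → end ≢ v

  -- A vertex has at most 5 k conflicts, five kinds with k labels each, so an independent subset
  -- costs the factor 2 (5 k) + 1; then r bounds that subset.
  bound : ℕ
  bound = suc (2 * (5 * k)) * r

  Step : ℤ → Fin n → Fin n → Fin p → Set
  Step d₀ u v x = + p ∣ c s ℤ.* (val v ℤ.- val u) ℤ.+ d₀ ℤ.* + toℕ x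

  val-injective : ∀ {u v} → + p ∣ c s ℤ.* (val u ℤ.- val v) → u ≡ v
  val-injective {u} {v} p∣ = disjoint s s (residue-unique (cancel-unit _ (c-unit s) p∣))

  source-unique : ∀ {d₀ u u′ v x} → Step d₀ u v x → Step d₀ u′ v x → u ≡ u′
  source-unique {d₀} {u} {u′} {v} {x} p∣ p∣′ = val-injective (subst (+ p ∣_)
    (difference (c s) (val u) (val u′) (val v) (d₀ ℤ.* + toℕ x)) (∣m∣n⇒∣m-n p∣′ p∣))
    where
    difference : ∀ c u u′ v x → c ℤ.* (v ℤ.- u′) ℤ.+ x ℤ.- (c ℤ.* (v ℤ.- u) ℤ.+ x) ≡ c ℤ.* (u ℤ.- u′)
    difference = ℤSolver.solve-∀

  target-unique : ∀ {d₀ u v v′ x} → Step d₀ u v x → Step d₀ u v′ x → v ≡ v′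
  target-unique {d₀} {u} {v} {v′} {x} p∣ p∣′ = val-injective (subst (+ p ∣_)
    (difference (c s) (val u) (val v) (val v′) (d₀ ℤ.* + toℕ x)) (∣m∣n⇒∣m-n p∣ p∣′))
    where
    difference : ∀ c u v v′ x → c ℤ.* (v ℤ.- u) ℤ.+ x ℤ.- (c ℤ.* (v′ ℤ.- u) ℤ.+ x) ≡ c ℤ.* (v ℤ.- v′)
    difference = ℤSolver.solve-∀

  module Extension {k′} (d : Fin (suc k′) → ℤ) (U′ : Fin (suc k′) → Bool) (k′≤k : k′ ≤ k)
    (d₀-unit : Unit (d fzero)) (U₀ : U′ fzero ≡ true)
    (walk? : ∀ v → Dec (Walk (d ∘ fsuc) (U′ ∘ fsuc) v))
    where

    TailWalk : Fin n → Set
    TailWalk = Walk (d ∘ fsuc) (U′ ∘ fsuc)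

    -- The ways in which prepending a step u → v to the chosen walk from v repeats an element: given one of the two
    -- vertices, each of them determines the other.
    Clash : ∀ {v} → Dec (TailWalk v) → Fin 5 → Fin k → Fin n → Set
    Clash     (no _)  _  _ _ = ⊥
    Clash {v} (yes W) 0F q u = Σ (Fin k′) λ i → toℕ i ≡ toℕ q × Step (d fzero) u v (Walk.z W i)
    Clash {v} (yes W) 1F q u = Step (d fzero) u v (w (Walk.end W) q)
    Clash {v} (yes W) 2F q u = Step (d fzero) v u (w v q)
    Clash     (yes W) 3F q u = Σ (Fin k′) λ i → toℕ i ≡ toℕ q × Σ (Fin k) λ j → Walk.z W i ≡ w u j
    Clash     (yes W) 4F q u = u ≡ Walk.end W

    clash-functional : ∀ {v} (W? : Dec (TailWalk v)) κ q {u u′} → Clash W? κ q u → Clash W? κ q u′ → u ≡ u′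
    clash-functional (yes W) 0F q (i , i≡q , st) (i′ , i′≡q , st′)
      with refl ← toℕ-injective (trans i≡q (sym i′≡q)) = source-unique {d fzero} {x = Walk.z W i} st st′
    clash-functional (yes W) 1F q st st′ = source-unique {d fzero} {x = w (Walk.end W) q} st st′
    clash-functional {v} (yes W) 2F q st st′ = target-unique {d fzero} {x = w v q} st st′
    clash-functional (yes W) 3F q (i , i≡q , j , e) (i′ , i′≡q , j′ , e′)
      with refl ← toℕ-injective (trans i≡q (sym i′≡q)) = disjoint j j′ (trans (sym e) e′)
    clash-functional (yes W) 4F q e e′ = trans e (sym e′)

    AnyClash : ∀ v → Fin (5 * k) → Fin n → Set
    AnyClash v q = Clash (walk? v) (proj₁ (remQuot {5} k q)) (proj₂ (remQuot {5} k q))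

    prepend : ∀ {u v} (Wu? : Dec (TailWalk u)) (Wv? : Dec (TailWalk v)) → does Wu? ≡ true → does Wv? ≡ true →
      (∀ κ q → ¬ Clash Wv? κ q u) → (∀ κ q → ¬ Clash Wu? κ q v) →
      ∀ a → a ∈ A → Step (d fzero) u v a → Walk d U′ u
    prepend {u} {v} (yes _) (yes W) _ _ ok ok′ a a∈A step = record
      { end       = end
      ; z         = z′
      ; z∈A       = λ { fzero _ → a∈A ; (fsuc i) U′i → z∈A i U′i }
      ; z-inj     = z-inj′
      -- A step element that repeats an entry of the start block is charged to u, since u and the
      -- label determine v. All other repetitions are charged to v.
      ; z∉start   = λ { fzero _ j a≡ → ok′ 2F j (subst (Step (d fzero) u v) a≡ step)
                      ; (fsuc i) _ j z≡ → ok 3F (inject≤ i k′≤k) (i , sym (toℕ-inject≤ i k′≤k) , j , z≡) }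
      ; z∉end     = λ { fzero _ j a≡ → ok 1F j (subst (Step (d fzero) u v) a≡ step) ; (fsuc i) U′i j → z∉end i U′i j }
      ; total     = subst (+ p ∣_) total≡ (∣m∣n⇒∣m+n step total)
      ; end≢start = λ _ _ end≡u → ok 4F s (sym end≡u)
      }
      where
      open Walk W
      z′ : Fin (suc k′) → Fin p
      z′ fzero    = a
      z′ (fsuc i) = z i
      a≢z : ∀ i → a ≢ z i
      a≢z i a≡ = ok 0F (inject≤ i k′≤k) (i , sym (toℕ-inject≤ i k′≤k) , subst (Step (d fzero) u v) a≡ step)
      z-inj′ : ∀ {i j} → U′ i ≡ true → U′ j ≡ true → z′ i ≡ z′ j → i ≡ j
      z-inj′ {fzero}  {fzero}  _ _ _ = refl
      z-inj′ {fzero}  {fsuc j} _ _ e = contradiction e (a≢z j)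
      z-inj′ {fsuc i} {fzero}  _ _ e = contradiction (sym e) (a≢z i)
      z-inj′ {fsuc i} {fsuc j} p q e = cong fsuc (z-inj p q e)
      total≡ : c s ℤ.* (val v ℤ.- val u) ℤ.+ d fzero ℤ.* + toℕ a ℤ.+
                 (c s ℤ.* (val end ℤ.- val v) ℤ.+ Σ-masked (U′ ∘ fsuc) (d ∘ fsuc) z) ≡
               c s ℤ.* (val end ℤ.- val u) ℤ.+ Σ-masked U′ d z′
      total≡ = trans (telescope (c s) (val u) (val v) (val end) (d fzero ℤ.* + toℕ a) (Σ-masked (U′ ∘ fsuc) (d ∘ fsuc) z))
        (cong (λ b → c s ℤ.* (val end ℤ.- val u) ℤ.+ ((if b then d fzero ℤ.* + toℕ a else + 0) ℤ.+ Σ-masked (U′ ∘ fsuc) (d ∘ fsuc) z))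
          (sym U₀))
        where
        telescope : ∀ c u v e x y → c ℤ.* (v ℤ.- u) ℤ.+ x ℤ.+ (c ℤ.* (e ℤ.- v) ℤ.+ y) ≡ c ℤ.* (e ℤ.- u) ℤ.+ (x ℤ.+ y)
        telescope = ℤSolver.solve-∀

    -- The dilate in concrete terms: the residue - c_s x_s / d₀. An arc of the Cayley graph between
    -- two such points is a step between their vertices.
    point : Fin n → Fin p
    point v = proj₁ (solve-linear d₀-unit (c s ℤ.* val v))

    point-eq : ∀ v → + p ∣ c s ℤ.* val v ℤ.+ d fzero ℤ.* + toℕ (point v)
    point-eq v = proj₂ (solve-linear d₀-unit (c s ℤ.* val v))

    point-injective : ∀ {u v} → point u ≡ point v → u ≡ v
    point-injective {u} {v} e = val-injective (subst (+ p ∣_) (difference (c s) (val u) (val v) (d fzero ℤ.* + toℕ (point v)))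
      (∣m∣n⇒∣m-n (subst (λ x → + p ∣ c s ℤ.* val u ℤ.+ d fzero ℤ.* + toℕ x) e (point-eq u)) (point-eq v)))
      where
      difference : ∀ c u v x → c ℤ.* u ℤ.+ x ℤ.- (c ℤ.* v ℤ.+ x) ≡ c ℤ.* (u ℤ.- v)
      difference = ℤSolver.solve-∀

    arc-step : ∀ {u v a} → + p ∣ + toℕ (point v) ℤ.- + toℕ (point u) ℤ.- + toℕ a → Step (d fzero) u v a
    arc-step {u} {v} {a} p∣ = subst (+ p ∣_)
      (combine-arcs (c s) (val u) (val v) (d fzero) (+ toℕ (point u)) (+ toℕ (point v)) (+ toℕ a))
      (∣m∣n⇒∣m-n (∣m∣n⇒∣m-n (point-eq v) (point-eq u)) (∣n⇒∣m*n (d fzero) p∣))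
      where
      combine-arcs : ∀ c u v d x y a →
        c ℤ.* v ℤ.+ d ℤ.* y ℤ.- (c ℤ.* u ℤ.+ d ℤ.* x) ℤ.- d ℤ.* (y ℤ.- x ℤ.- a) ≡ c ℤ.* (v ℤ.- u) ℤ.+ d ℤ.* a
      combine-arcs = ℤSolver.solve-∀

    no-clash : (clash? : ∀ v u → Dec (Σ (Fin (5 * k)) λ q → AnyClash v q u)) →
      ∀ v u → does (clash? v u) ≡ false → ∀ κ q → ¬ Clash (walk? v) κ q u
    no-clash clash? v u e κ q cl with clash? v u
    ... | no ¬c = ¬c (combine κ q , subst (λ κq → Clash (walk? v) (proj₁ κq) (proj₂ κq) u) (sym (remQuot-combine κ q)) cl)

    -- An arc between two points of I would be a step that can be prepended to the tail walk of its
    -- head, contrary to the absence of walks. So the points form an independent set of the Cayley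
    -- graph.
    clash-free-small : (clash? : ∀ v u → Dec (Σ (Fin (5 * k)) λ q → AnyClash v q u)) →
      ∀ I → (∀ v → I v ≡ true → does (walk? v) ≡ true) → (∀ v → I v ≡ true → ¬ Walk d U′ v) →
      (∀ {u v} → I u ≡ true → I v ≡ true → u ≢ v → does (clash? u v) ≡ false × does (clash? v u) ≡ false) → # I ≤ r
    clash-free-small clash? I tails none compatible = from-image (image I point (λ _ _ → point-injective))
      where
      step-absurd : ∀ {u v a} → I u ≡ true → I v ≡ true → u ≢ v → a ∈ A → Step (d fzero) u v a → ⊥
      step-absurd {u} {v} {a} Iu Iv u≢v a∈A step = none u Iu
        (prepend (walk? u) (walk? v) (tails u Iu) (tails v Iv)
          (no-clash clash? v u (proj₂ (compatible Iu Iv u≢v))) (no-clash clash? u v (proj₁ (compatible Iu Iv u≢v))) a a∈A step)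
      from-image : (Σ (Subset p) λ K → (∀ {y} → y ∈ K → Σ (Fin n) λ i → I i ≡ true × point i ≡ y) × # I ≤ ∣ K ∣) → # I ≤ r
      from-image (K , K⇒ , le) = ≤-trans le (α≤r K (λ x y x∈K y∈K x≢y arc → no-arc (K⇒ x∈K) (K⇒ y∈K) x≢y arc))
        where
        no-arc : ∀ {x y} → (Σ (Fin n) λ i → I i ≡ true × point i ≡ x) → (Σ (Fin n) λ i → I i ≡ true × point i ≡ y) →
          x ≢ y → ¬ Arc p A x y
        no-arc (u , Iu , refl) (v , Iv , refl) x≢y (a , a∈A , p∣) =
          step-absurd Iu Iv (λ u≡v → x≢y (cong point u≡v)) a∈A (arc-step {u} {v} {a} (∣ᵤ⇒∣ p∣))

    few-walks : (clash? : ∀ v u → Dec (Σ (Fin (5 * k)) λ q → AnyClash v q u)) →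
      ∀ V → (∀ v → V v ≡ true → does (walk? v) ≡ true) → (∀ v → V v ≡ true → ¬ Walk d U′ v) → # V ≤ bound
    few-walks clash? V tails none = from-independent (independent-subset (5 * k) (λ v u → does (clash? v u)) degree V)
      where
      chosen : ∀ v {u} → does (clash? v u) ≡ true → Σ (Fin (5 * k)) λ q → AnyClash v q u
      chosen v {u} e with clash? v u
      ... | yes c = c
      degree : ∀ v → # (λ u → does (clash? v u)) ≤ 5 * k
      degree v = #-bounded (AnyClash v) (chosen v)
        (λ {q} → clash-functional (walk? v) (proj₁ (remQuot {5} k q)) (proj₂ (remQuot {5} k q)))
      from-independent : IndependentIn (5 * k) (λ v u → does (clash? v u)) V → # V ≤ bound
      from-independent ind = ≤-trans large (scale (suc (2 * (5 * k)))
        (clash-free-small clash? I (λ v Iv → tails v (I⊆V Iv)) (λ v Iv → none v (I⊆V Iv)) compatible))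
        where open IndependentIn ind

  -- Induction on the coefficients: vertices without a walk for the tail are counted by the
  -- induction hypothesis, those whose tail walk exists but no full walk by `few-walks`.
  no-walks : ∀ {k′} (d : Fin k′ → ℤ) (U′ : Fin k′ → Bool) → k′ ≤ k → (∀ i → Unit (d i)) →
    ∀ P → (∀ v → P v ≡ true → ¬ Walk d U′ v) → # P ≤ k′ * bound
  no-walks {zero} d U′ _ units P none = ≤-trans (#-mono empty) (≤-reflexive (trans (∑Fin-const n 0) (*-zeroʳ n)))
    where
    empty : ∀ v → P v ≡ true → false ≡ true
    empty v Pv = ⊥-elim (none v Pv (record { end = v ; z = λ () ; z∈A = λ () ; z-inj = λ { {()} } ; z∉start = λ () ; z∉end = λ ()
      ; total = divides (+ 0) (vanish (c s) (val v)) ; end≢start = λ () }))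
      where
      vanish : ∀ c x → c ℤ.* (x ℤ.- x) ℤ.+ + 0 ≡ + 0
      vanish = ℤSolver.solve-∀
  no-walks {suc k′} d U′ k′<k units P none with U′ fzero in U₀
  ... | false = ≤-trans (no-walks (d ∘ fsuc) (U′ ∘ fsuc) (<⇒≤ k′<k) (units ∘ fsuc) P
                  (λ v Pv W → none v Pv (skip v W))) (m≤n+m _ bound)
    where
    skip : ∀ v → Walk (d ∘ fsuc) (U′ ∘ fsuc) v → Walk d U′ v
    skip v W = record
      { end = end ; z = z′
      ; z∈A = λ { fzero e → contradiction (trans (sym U₀) e) (λ ()) ; (fsuc i) → z∈A i }
      ; z-inj = λ { {fzero} e _ _ → contradiction (trans (sym U₀) e) (λ ())
                  ; {fsuc i} {fzero} _ e _ → contradiction (trans (sym U₀) e) (λ ())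
                  ; {fsuc i} {fsuc j} p q e → cong fsuc (z-inj p q e) }
      ; z∉start = λ { fzero e → contradiction (trans (sym U₀) e) (λ ()) ; (fsuc i) → z∉start i }
      ; z∉end = λ { fzero e → contradiction (trans (sym U₀) e) (λ ()) ; (fsuc i) → z∉end i }
      ; total = subst (λ x → + p ∣ c s ℤ.* (val end ℤ.- val v) ℤ.+ x) total≡ total
      ; end≢start = λ { fzero e → contradiction (trans (sym U₀) e) (λ ()) ; (fsuc i) → end≢start i } }
      where
      open Walk W
      z′ : Fin (suc k′) → Fin p
      -- A placeholder: the index is outside the mask, so its value is neither summed nor
      -- constrained.
      z′ fzero    = w v s
      z′ (fsuc i) = z i
      total≡ : Σ-masked (U′ ∘ fsuc) (d ∘ fsuc) z ≡ Σ-masked U′ d z′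
      total≡ = trans (sym (ℤₚ.+-identityˡ _)) (cong (λ b → (if b then d fzero ℤ.* + toℕ (w v s) else + 0) ℤ.+ Σ-masked (U′ ∘ fsuc) (d ∘ fsuc) z)
        (sym U₀))
  ... | true = decidable-stable (_ ≤? _) λ ¬le →
      ¬¬-∀ (λ v → ¬¬-excluded-middle {A = Walk (d ∘ fsuc) (U′ ∘ fsuc) v}) λ walk? →
      let open Extension d U′ (<⇒≤ k′<k) (units fzero) U₀ walk? in
      ¬¬-∀ (λ v → ¬¬-∀ (λ u → ¬¬-excluded-middle {A = Σ (Fin (5 * k)) λ q → AnyClash v q u})) λ clash? →
      ¬le (split (λ v → does (walk? v))
        (no-walks (d ∘ fsuc) (U′ ∘ fsuc) (<⇒≤ k′<k) (units ∘ fsuc) (λ v → P v ∧ not (does (walk? v))) (λ v e → absent v (walk? v) e))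
        (few-walks clash? (λ v → P v ∧ does (walk? v)) (λ v e → ∧ʳ (P v) e) (λ v e → none v (∧ˡ (P v) e))))
    where
    ∧ˡ : ∀ a {b} → a ∧ b ≡ true → a ≡ true
    ∧ˡ true _ = refl
    ∧ʳ : ∀ a {b} → a ∧ b ≡ true → b ≡ true
    ∧ʳ true e = e
    absent : ∀ v (W? : Dec (Walk (d ∘ fsuc) (U′ ∘ fsuc) v)) → P v ∧ not (does W?) ≡ true → ¬ Walk (d ∘ fsuc) (U′ ∘ fsuc) v
    absent v (no ¬W) e = ¬W
    absent v (yes W) e = contradiction (∧ʳ (P v) e) (λ ())
    split : ∀ (Q : Fin n → Bool) → # (λ v → P v ∧ not (Q v)) ≤ k′ * bound → # (λ v → P v ∧ Q v) ≤ bound → # P ≤ suc k′ * bound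
    split Q le le′ = ≤-trans (≤-trans (∑Fin-mono n pointwise) (≤-reflexive (∑Fin-+ n _ _))) (+-mono-≤ le′ le)
      where
      pointwise : ∀ v → ⟦ P v ⟧ ≤ ⟦ P v ∧ Q v ⟧ + ⟦ P v ∧ not (Q v) ⟧
      pointwise v with P v | Q v
      ... | false | _     = z≤n
      ... | true  | true  = ≤-refl
      ... | true  | false = ≤-refl

  -- The index t outside S guarantees at least one step, so the walk ends at another block. This
  -- separates the entry at s, taken from the end, from the entries kept from the start.
  module Assembly (solution-free : SolutionFree k c p A) (U-s : U s ≡ false) (t : Fin k) (U-t : U t ≡ true) where

    no-full-walk : ∀ v → ¬ Walk c U v
    no-full-walk v W = solution-free (a , a-inj , a∈A , ∣⇒∣ᵤ (subst (+ p ∣_) (sym sum≡) (∣m∣n⇒∣m+n (Block.Σw≡0 (block v)) total)))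
      where
      open Walk W
      e≢v : end ≢ v
      e≢v = end≢start t U-t
      a : Fin k → Fin p
      a i = if U i then z i else (if does (i ≟ s) then w end i else w v i)
      a∈A : ∀ i → a i ∈ A
      a∈A i with U i in Ui | i ≟ s
      ... | true  | _     = z∈A i Ui
      ... | false | yes _ = Block.w∈A (block end) i
      ... | false | no _  = Block.w∈A (block v) i
      a-inj : Injective _≡_ _≡_ a
      a-inj {i} {j} e with U i in Ui | U j in Uj | i ≟ s | j ≟ s
      ... | true  | true  | _     | _     = z-inj Ui Uj e
      ... | true  | false | _     | yes _ = contradiction e (z∉end i Ui j)
      ... | true  | false | _     | no _  = contradiction e (z∉start i Ui j)
      ... | false | true  | yes _ | _     = contradiction (sym e) (z∉end j Uj i)
      ... | false | true  | no _  | _     = contradiction (sym e) (z∉start j Uj i)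
      ... | false | false | yes x | yes y = trans x (sym y)
      ... | false | false | yes _ | no _  = contradiction (disjoint i j e) e≢v
      ... | false | false | no _  | yes _ = contradiction (sym (disjoint i j e)) e≢v
      ... | false | false | no x  | no y  = Block.w-inj (block v) Ui Uj x y e
      pointwise : ∀ i → c i ℤ.* + toℕ (a i) ≡ (if not (U i) then c i ℤ.* + toℕ (w v i) else + 0) ℤ.+
        (at s (c s ℤ.* (val end ℤ.- val v)) i ℤ.+ (if U i then c i ℤ.* + toℕ (z i) else + 0))
      pointwise i with U i in Ui | i ≟ s
      ... | true  | yes refl = contradiction (trans (sym Ui) U-s) (λ ())
      ... | true  | no _     = pad (c i ℤ.* + toℕ (z i))
        where
        pad : ∀ x → x ≡ + 0 ℤ.+ (+ 0 ℤ.+ x)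
        pad = ℤSolver.solve-∀
      ... | false | yes refl = pad (c s) (val end) (val v)
        where
        pad : ∀ c e v → c ℤ.* e ≡ c ℤ.* v ℤ.+ (c ℤ.* (e ℤ.- v) ℤ.+ + 0)
        pad = ℤSolver.solve-∀
      ... | false | no _     = pad (c i ℤ.* + toℕ (w v i))
        where
        pad : ∀ x → x ≡ x ℤ.+ (+ 0 ℤ.+ + 0)
        pad = ℤSolver.solve-∀
      sum≡ : Σℤ k (λ i → c i ℤ.* + toℕ (a i)) ≡
        Σ-masked (not ∘ U) c (w v) ℤ.+ (c s ℤ.* (val end ℤ.- val v) ℤ.+ Σ-masked U c z)
      sum≡ = trans (Σℤ-cong k pointwise) (trans (Σℤ-+ k _ _) (cong (λ x → Σ-masked (not ∘ U) c (w v) ℤ.+ x)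
        (trans (Σℤ-+ k _ _) (cong (λ x → x ℤ.+ Σ-masked U c z) (Σℤ-at k s _)))))

    few-blocks : n ≤ k * bound
    few-blocks = subst (_≤ k * bound) (#-all {n} {λ _ → true} (λ _ → refl))
      (no-walks c U ≤-refl c-unit (λ _ → true) (λ v _ → no-full-walk v))

-- Disjoint solutions of the invariant part

restrict : ∀ {k} → Subset k → (Fin k → ℤ) → Fin k → ℤ
restrict S c i = if lookup S i then c i else + 0

-- The where-local summand of Σℤ-over cannot be named, so its value at i is left to unification.
mutual
  Σℤ-over-restrict : ∀ k (S : Subset k) c → Σℤ-over k S c ≡ Σℤ k (restrict S c)
  Σℤ-over-restrict k S c = Σℤ-cong k (over-at k S c)

  over-at : ∀ k (S : Subset k) c i → _ ≡ restrict S c i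
  over-at k S c i with lookup S i
  ... | true  = refl
  ... | false = refl

Σℤ≤term : ∀ k (f : Fin k → ℤ) → (∀ i → f i ℤ.≤ + 0) → ∀ j → Σℤ k f ℤ.≤ f j
Σℤ≤term (suc k) f f≤0 fzero = ℤₚ.≤-trans (ℤₚ.+-monoʳ-≤ (f fzero) (Σℤ≤0 k (f ∘ fsuc) (f≤0 ∘ fsuc))) (ℤₚ.≤-reflexive (ℤₚ.+-identityʳ (f fzero)))
  where
  Σℤ≤0 : ∀ k (f : Fin k → ℤ) → (∀ i → f i ℤ.≤ + 0) → Σℤ k f ℤ.≤ + 0
  Σℤ≤0 zero    f f≤0 = ℤₚ.≤-refl
  Σℤ≤0 (suc k) f f≤0 = ℤₚ.+-mono-≤ (f≤0 fzero) (Σℤ≤0 k (f ∘ fsuc) (f≤0 ∘ fsuc))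
Σℤ≤term (suc k) f f≤0 (fsuc j) = ℤₚ.≤-trans (ℤₚ.+-mono-≤ (f≤0 fzero) (Σℤ≤term k (f ∘ fsuc) (f≤0 ∘ fsuc) j)) (ℤₚ.≤-reflexive (ℤₚ.+-identityˡ _))

-- If all terms were ≤ 0, the vanishing sum would be at most the j-th term and force it to be 0.
-- Applied to both signs of the coefficients, it supplies y and z.
positive-term : ∀ k (f : Fin k → ℤ) → Σℤ k f ≡ + 0 → ∀ j → f j ≢ + 0 → Σ (Fin k) λ i → + 0 ℤ.< f i
positive-term k f Σ≡0 j fj≢0 with any? (λ i → + 0 ℤ.<? f i)
... | yes found = found
... | no  none  = contradiction
  (ℤₚ.≤-antisym (f≤0 j) (ℤₚ.≤-trans (ℤₚ.≤-reflexive (sym Σ≡0)) (Σℤ≤term k f f≤0 j))) fj≢0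
  where
  f≤0 : ∀ i → f i ℤ.≤ + 0
  f≤0 i = ℤₚ.≮⇒≥ (λ 0<fi → none (i , 0<fi))

positive-form : ∀ {x} → + 0 ℤ.< x → Σ ℕ λ b → x ≡ + suc b
positive-form {+ suc b}  _           = b , refl
positive-form {+ zero}   (ℤ.+<+ ())

third : ∀ {k} → 3 ≤ k → (y z : Fin k) → Σ (Fin k) λ i → i ≢ y × i ≢ z
third (s≤s (s≤s (s≤s _))) fzero            fzero            = fsuc fzero , (λ ()) , λ ()
third (s≤s (s≤s (s≤s _))) fzero            (fsuc fzero)     = fsuc (fsuc fzero) , (λ ()) , λ ()
third (s≤s (s≤s (s≤s _))) fzero            (fsuc (fsuc z))  = fsuc fzero , (λ ()) , λ ()
third (s≤s (s≤s (s≤s _))) (fsuc fzero)     fzero            = fsuc (fsuc fzero) , (λ ()) , λ ()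
third (s≤s (s≤s (s≤s _))) (fsuc (fsuc y))  fzero            = fsuc fzero , (λ ()) , λ ()
third (s≤s (s≤s (s≤s _))) (fsuc y)         (fsuc z)         = fzero , (λ ()) , λ ()

indicator : ∀ {p} → Subset p → ℕ → Bool
indicator []      _       = false
indicator (b ∷ A) zero    = b
indicator (b ∷ A) (suc j) = indicator A j

∑-indicator : ∀ {p} (A : Subset p) → ∑ p (λ j → ⟦ indicator A j ⟧) ≡ ∣ A ∣
∑-indicator []          = refl
∑-indicator (true  ∷ A) = cong suc (∑-indicator A)
∑-indicator (false ∷ A) = ∑-indicator A

indicator-true : ∀ {p} (A : Subset p) {j} → indicator A j ≡ true → Σ (Fin p) λ a → j ≡ toℕ a × a ∈ A
indicator-true (true ∷ A) {zero}  _ = fzero , refl , here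
indicator-true (b ∷ A)    {suc j} e with a , j≡ , a∈A ← indicator-true A e = fsuc a , cong suc j≡ , there a∈A

module Blocks
  (k p : ℕ) (c : Fin k → ℤ) (S : Subset k) (s : Fin k) (A : Subset p)
  where

  U : Fin k → Bool
  U i = not (lookup S i)

  Block′ : Set
  Block′ = Block k p c U s A

  Σ-masked-restrict : ∀ (w : Fin k → Fin p) → Σ-masked (not ∘ U) c w ≡ Σℤ k (λ i → restrict S c i ℤ.* + toℕ (w i))
  Σ-masked-restrict w = Σℤ-cong k pointwise
    where
    pointwise : ∀ i → (if not (U i) then c i ℤ.* + toℕ (w i) else + 0) ≡ restrict S c i ℤ.* + toℕ (w i)
    pointwise i with lookup S i
    ... | true  = refl
    ... | false = refl

  -- Meant for S with two elements: the entry at s is exempt from distinctness and a single other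
  -- index of S remains. The walk later replaces the entry at s by a different element.
  constant-block : Σℤ k (restrict S c) ≡ + 0 → (∀ {i j} → U i ≡ false → U j ≡ false → i ≢ s → j ≢ s → i ≡ j) →
    ∀ a → a ∈ A → Block′
  constant-block Σ≡0 pair a a∈A = record
    { w = λ _ → a ; w∈A = λ _ → a∈A ; w-inj = λ Ui Uj i≢s j≢s _ → pair Ui Uj i≢s j≢s
    ; Σw≡0 = subst (+ p ∣_) (sym (trans (Σ-masked-restrict (λ _ → a)) (trans
        (Σℤ-cong k (λ i → ℤₚ.*-comm (restrict S c i) (+ toℕ a))) (Σℤ-* k (+ toℕ a) (restrict S c)))))
        (divides (+ 0) (trans (cong (+ toℕ a ℤ.*_) Σ≡0) (ℤₚ.*-zeroʳ (+ toℕ a)))) }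

  elements : Σ (Fin ∣ A ∣ → Fin p) λ φ → (∀ i → φ i ∈ A) × (∀ {i j} → φ i ≡ φ j → i ≡ j)
  elements with φ , φ-inj , _ , φ∈ ← select p ∣ A ∣ (indicator A) (≤-reflexive (sym (∑-indicator A))) =
    (λ i → proj₁ (indicator-true A (φ∈ i))) , (λ i → proj₂ (proj₂ (indicator-true A (φ∈ i)))) ,
    λ {i} {j} e → φ-inj (trans (proj₁ (proj₂ (indicator-true A (φ∈ i))))
      (trans (cong toℕ e) (sym (proj₁ (proj₂ (indicator-true A (φ∈ j)))))))

  extend : (ℕ → Bool) → ℤ → Bool
  extend E (+ j)    = E j
  extend E -[1+ _ ] = false

  lift : ∀ E → (∀ {j} → E j ≡ true → indicator A j ≡ true) → ∀ x → extend E x ≡ true →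
    Σ (Fin p) λ a → x ≡ + toℕ a × a ∈ A × E (toℕ a) ≡ true
  lift E E⊆A (+ j) e with a , refl , a∈A ← indicator-true A (E⊆A e) = a , refl , a∈A , e

  -- All k entries are distinct elements of A, also those outside S, whose coefficient in
  -- `restrict S c` is 0. A block thus uses up k elements, which is the last factor k of the size
  -- bound.
  record Tuple (E : ℕ → Bool) : Set where
    field
      a     : Fin k → Fin p
      a-inj : Injective _≡_ _≡_ a
      a∈A   : ∀ i → a i ∈ A
      a∈E   : ∀ i → E (toℕ (a i)) ≡ true
      Σa≡0  : Σℤ k (λ i → restrict S c i ℤ.* + toℕ (a i)) ≡ + 0

  tuple : ∀ E → (∀ {j} → E j ≡ true → indicator A j ≡ true) → Solution k (restrict S c) (extend E) → Tuple E
  tuple E E⊆A (x , x-inj , fx , Σ≡0) = record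
    { a     = a
    ; a-inj = λ {i} {j} e → x-inj (trans (x≡ i) (trans (cong (λ b → + toℕ b) e) (sym (x≡ j))))
    ; a∈A   = λ i → proj₁ (proj₂ (proj₂ (lift E E⊆A (x i) (fx i))))
    ; a∈E   = λ i → proj₂ (proj₂ (proj₂ (lift E E⊆A (x i) (fx i))))
    ; Σa≡0  = trans (Σℤ-cong k (λ i → cong (restrict S c i ℤ.*_) (sym (x≡ i)))) Σ≡0 }
    where
    a : Fin k → Fin p
    a i = proj₁ (lift E E⊆A (x i) (fx i))
    x≡ : ∀ i → x i ≡ + toℕ (a i)
    x≡ i = proj₁ (proj₂ (lift E E⊆A (x i) (fx i)))

  record Stage (m : ℕ) : Set where
    field
      block    : Fin m → Block′
      disjoint : ∀ {a b} i j → Block.w (block a) i ≡ Block.w (block b) j → a ≡ b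
      E        : ℕ → Bool
      E⊆A      : ∀ {j} → E j ≡ true → indicator A j ≡ true
      fresh    : ∀ a i → E (toℕ (Block.w (block a) i)) ≢ true
      count    : ∣ A ∣ ≤ ∑ p (λ j → ⟦ E j ⟧) + m * k

  start : Stage 0
  start = record { block = λ () ; disjoint = λ { {()} } ; E = indicator A ; E⊆A = λ e → e ; fresh = λ ()
    ; count = ≤-trans (≤-reflexive (sym (∑-indicator A))) (m≤m+n _ 0) }

  next : ∀ {m} (st : Stage m) → Tuple (Stage.E st) → Stage (suc m)
  next {m} st tup = record { block = block′ ; disjoint = disjoint′ ; E = E′ ; E⊆A = λ e → E⊆A (proj₁ (E′⇒ e)) ; fresh = fresh′
    ; count = ≤-trans count (≤-trans (+-monoˡ-≤ (m * k) (∑-removeAll p k (λ i → toℕ (a i)) E)) (≤-reflexive (+-assoc _ k (m * k)))) }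
    where
    open Stage st
    open Tuple tup
    E′ : ℕ → Bool
    E′ = removeAll k (λ i → toℕ (a i)) E
    E′⇒ : ∀ {j} → E′ j ≡ true → E j ≡ true × (∀ i → toℕ (a i) ≢ j)
    E′⇒ {j} = removeAll-true k (λ i → toℕ (a i)) E {j}
    block′ : Fin (suc m) → Block′
    block′ fzero    = record { w = a ; w∈A = a∈A ; w-inj = λ _ _ _ _ → a-inj
      ; Σw≡0 = subst (+ p ∣_) (sym (trans (Σ-masked-restrict a) Σa≡0)) (divides (+ 0) refl) }
    block′ (fsuc b) = block b
    fresh′ : ∀ b i → E′ (toℕ (Block.w (block′ b) i)) ≢ true
    fresh′ fzero    i e = proj₂ (E′⇒ e) i refl
    fresh′ (fsuc b) i e = fresh b i (proj₁ (E′⇒ e))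
    disjoint′ : ∀ {b b′} i j → Block.w (block′ b) i ≡ Block.w (block′ b′) j → b ≡ b′
    disjoint′ {fzero}  {fzero}   i j e = refl
    disjoint′ {fzero}  {fsuc b′} i j e = contradiction (trans (cong (λ x → E (toℕ x)) (sym e)) (a∈E i)) (fresh b′ j)
    disjoint′ {fsuc b} {fzero}   i j e = contradiction (trans (cong (λ x → E (toℕ x)) e) (a∈E j)) (fresh b i)
    disjoint′ {fsuc b} {fsuc b′} i j e = cong fsuc (disjoint i j e)

  module Greedy (q ℓ : ℕ) (roth : ∀ f → ¬ Solution k (restrict S c) f → ∀ n → suc q * ∑ n (λ j → ⟦ f (+ j) ⟧) ≤ n + suc q * ℓ)
    where

    -- If a stage with m ≤ N could not be continued, its remainder E would be solution-free, hence
    -- small by Roth's theorem; then A, which is E and m k further elements at most, would be too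
    -- small for `big`.
    stages : ∀ N → p + suc q * (ℓ + N * k) < suc q * ∣ A ∣ → ∀ m → m ≤ suc N → ¬ ¬ Stage m
    stages N big zero    _           ¬st = ¬st start
    stages N big (suc m) (s≤s m≤N) ¬st = stages N big m (≤-trans m≤N (n≤1+n N)) λ st →
      <⇒≱ big (bound st (roth (extend (Stage.E st)) (λ sol → ¬st (next st (tuple (Stage.E st) (Stage.E⊆A st) sol))) p))
      where
      bound : (st : Stage m) → suc q * ∑ p (λ j → ⟦ Stage.E st j ⟧) ≤ p + suc q * ℓ → suc q * ∣ A ∣ ≤ p + suc q * (ℓ + N * k)
      bound st le = begin
        suc q * ∣ A ∣                                                   ≤⟨ scale (suc q) (Stage.count st) ⟩
        suc q * (∑ p (λ j → ⟦ Stage.E st j ⟧) + m * k)                  ≡⟨ *-distribˡ-+ (suc q) _ (m * k) ⟩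
        suc q * ∑ p (λ j → ⟦ Stage.E st j ⟧) + suc q * (m * k)          ≤⟨ +-mono-≤ le (scale (suc q) (*-monoˡ-≤ k m≤N)) ⟩
        p + suc q * ℓ + suc q * (N * k)                                 ≡⟨ regroup p (suc q) ℓ (N * k) ⟩
        p + suc q * (ℓ + N * k)                                         ∎
        where
        open ≤-Reasoning
        regroup : ∀ p q l n → p + q * l + q * n ≡ p + q * (l + n)
        regroup = solve-∀

    few : ∀ N → (∀ {m} → Stage m → m ≤ N) → suc q * ∣ A ∣ ≤ p + suc q * (ℓ + N * k)
    few N le = ≮⇒≥ (λ big → stages N big (suc N) ≤-refl (λ st → <⇒≱ (n<1+n N) (le st)))

-- The size bound by cases on the support of the invariant part

walkBound : ℕ → ℕ → ℕ
walkBound k r = suc (2 * (5 * k)) * r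

SizeBound : ℕ → (k : ℕ) → (Fin k → ℤ) → Set
SizeBound q k c = Σ ℕ λ P → Σ ℕ λ ℓ → ∀ p → Prime p → P ≤ p → (A : Subset p) → SolutionFree k c p A →
  ∀ r → (∀ J → Independent p A J → ∣ J ∣ ≤ r) → suc q * ∣ A ∣ ≤ p + suc q * (ℓ + k * walkBound k r * k)

module _ (k : ℕ) (k≥3 : 3 ≤ k) (c : Fin k → ℤ) (c≢0 : ∀ i → c i ≢ + 0) (S : Subset k) (Σ≡0 : Σℤ k (restrict S c) ≡ + 0) (q : ℕ) where

  private
    C : ℕ
    C = suc (∑Fin k (λ i → ℤ.∣ c i ∣))

    unit : ∀ {p} → C ≤ p → ∀ i → c i ≢ + 0 × ℤ.∣ c i ∣ < p
    unit C≤p i = c≢0 i , <-≤-trans (s≤s (∑Fin-term k (λ i → ℤ.∣ c i ∣) i)) C≤p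

    restrict≢0 : ∀ {i} → not (lookup S i) ≡ false → restrict S c i ≢ + 0
    restrict≢0 {i} e with lookup S i
    ... | true = c≢0 i

    outside-S : ∀ {i} → restrict S c i ≡ + 0 → not (lookup S i) ≡ true
    outside-S {i} e with lookup S i
    ... | true  = contradiction e (c≢0 i)
    ... | false = refl

    inside-S : ∀ {i} → restrict S c i ≢ + 0 → not (lookup S i) ≡ false
    inside-S {i} e with lookup S i
    ... | true  = refl
    ... | false = contradiction refl e

  -- A block is a single element here, so `few-blocks` bounds A itself without any error term.
  pair-bound : ∀ s t → restrict S c s ≢ + 0 → restrict S c t ≡ + 0 → (z : Fin k) → (∀ i → i ≢ s → restrict S c i ≢ + 0 → i ≡ z) →
    SizeBound q k c
  pair-bound s t s≢0 t≡0 z only = C , 0 , λ p p-prime C≤p A free r α≤r →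
    let open Blocks k p c S s A
        φ , φ∈A , φ-inj = elements
        open Walks k p p-prime c U s A (unit C≤p) r α≤r
               (λ v → constant-block Σ≡0 (λ Ui Uj i≢s j≢s → trans (only _ i≢s (restrict≢0 Ui)) (sym (only _ j≢s (restrict≢0 Uj)))) (φ v) (φ∈A v))
               (λ _ _ e → φ-inj e)
        open Assembly free (inside-S s≢0) t (outside-S t≡0)
    in ≤-trans (scale (suc q) (≤-trans few-blocks (m≤m*n _ k {{>-nonZero (≤-trans (s≤s z≤n) k≥3)}}))) (m≤n+m _ p)

  module _ (i₁ y z : Fin k) (i₁≢y : i₁ ≢ y) (i₁≢z : i₁ ≢ z) (y≢z : y ≢ z)
    (b g : ℕ) (cy : restrict S c y ≡ + suc b) (cz : restrict S c z ≡ -[1+ g ]) (c₁≢0 : restrict S c i₁ ≢ + 0) where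

    private
      ℓ : ℕ
      ℓ = proj₁ (Roth.roth k (restrict S c) Σ≡0 i₁ y z i₁≢y i₁≢z y≢z b g cy cz c₁≢0 q)

      roth : ∀ f → ¬ Solution k (restrict S c) f → ∀ n → suc q * ∑ n (λ j → ⟦ f (+ j) ⟧) ≤ n + suc q * ℓ
      roth = proj₂ (Roth.roth k (restrict S c) Σ≡0 i₁ y z i₁≢y i₁≢z y≢z b g cy cz c₁≢0 q)

    partial-bound : ∀ t → restrict S c t ≡ + 0 → SizeBound q k c
    partial-bound t t≡0 = C , ℓ , λ p p-prime C≤p A free r α≤r →
      Blocks.Greedy.few k p c S i₁ A q ℓ roth (k * walkBound k r) (at-most p p-prime C≤p A free r α≤r)
      where
      at-most : ∀ p (p-prime : Prime p) → C ≤ p → ∀ A → SolutionFree k c p A → ∀ r → (∀ J → Independent p A J → ∣ J ∣ ≤ r) →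
        ∀ {m} → Blocks.Stage k p c S i₁ A m → m ≤ k * walkBound k r
      at-most p p-prime C≤p A free r α≤r st = few-blocks
        where
        open Blocks k p c S i₁ A
        open Stage st
        open Walks k p p-prime c U i₁ A (unit C≤p) r α≤r block disjoint
        open Assembly free (inside-S c₁≢0) t (outside-S t≡0)

    -- When S is everything there is no step to take: a solution of the invariant equation in A
    -- already contradicts freeness, and Roth's theorem bounds A directly.
    full-bound : (∀ t → restrict S c t ≢ + 0) → SizeBound q k c
    full-bound full = C , ℓ , λ p p-prime C≤p A free r α≤r →
      ≤-trans (subst (λ x → suc q * x ≤ p + suc q * ℓ) (∑-indicator A) (roth (Blocks.extend k p c S i₁ A (indicator A)) (no-solution p A free) p))
        (+-monoʳ-≤ p (scale (suc q) (m≤m+n ℓ _)))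
      where
      restrict≡ : ∀ i → restrict S c i ≡ c i
      restrict≡ i with lookup S i | full i
      ... | true  | _   = refl
      ... | false | ≢0 = contradiction refl ≢0
      no-solution : ∀ p A → SolutionFree k c p A → ¬ Solution k (restrict S c) (Blocks.extend k p c S i₁ A (indicator A))
      no-solution p A free sol = free (a , a-inj , a∈A , ∣⇒∣ᵤ {+ p} (divides (+ 0)
        (trans (Σℤ-cong k (λ i → cong (ℤ._* + toℕ (a i)) (sym (restrict≡ i)))) Σa≡0)))
        where open Blocks.Tuple (Blocks.tuple k p c S i₁ A (indicator A) (λ e → e) sol)

  size-bound : Nonempty S → SizeBound q k c
  size-bound (j , j∈S) = from-signs (positive-term k (restrict S c) Σ≡0 j j≢0)
    (positive-term k (λ i → ℤ.- + 1 ℤ.* restrict S c i) (trans (Σℤ-* k (ℤ.- + 1) (restrict S c)) (cong (ℤ.- + 1 ℤ.*_) Σ≡0)) j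
      (λ e → j≢0 (trans (negated (restrict S c j)) (cong ℤ.-_ e))))
    where
    negated : ∀ x → x ≡ ℤ.- (ℤ.- + 1 ℤ.* x)
    negated = ℤSolver.solve-∀
    j≢0 : restrict S c j ≢ + 0
    j≢0 e rewrite []=⇒lookup j∈S = c≢0 j e
    from-signs : (Σ (Fin k) λ i → + 0 ℤ.< restrict S c i) → (Σ (Fin k) λ i → + 0 ℤ.< ℤ.- + 1 ℤ.* restrict S c i) → SizeBound q k c
    from-signs (y , 0<y) (z , 0<z) = decide (any? (λ i → ¬? (i ≟ y) ×-dec ¬? (i ≟ z) ×-dec ¬? (restrict S c i ℤ.≟ + 0)))
      where
      b g : ℕ
      b = proj₁ (positive-form 0<y)
      g = proj₁ (positive-form 0<z)
      cy : restrict S c y ≡ + suc b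
      cy = proj₂ (positive-form 0<y)
      cz : restrict S c z ≡ -[1+ g ]
      cz = trans (negated (restrict S c z)) (cong ℤ.-_ (proj₂ (positive-form 0<z)))
      y≢z : y ≢ z
      y≢z refl = contradiction (trans (sym cy) cz) (λ ())
      y≢0 : restrict S c y ≢ + 0
      y≢0 e = contradiction (trans (sym cy) e) (λ ())
      decide : Dec (Σ (Fin k) λ i → i ≢ y × i ≢ z × restrict S c i ≢ + 0) → SizeBound q k c
      decide (yes (i₁ , i₁≢y , i₁≢z , c₁≢0)) = cases (any? (λ t → restrict S c t ℤ.≟ + 0))
        where
        cases : Dec (Σ (Fin k) λ t → restrict S c t ≡ + 0) → SizeBound q k c
        cases (yes (t , t≡0)) = partial-bound i₁ y z i₁≢y i₁≢z y≢z b g cy cz c₁≢0 t t≡0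
        cases (no none)       = full-bound i₁ y z i₁≢y i₁≢z y≢z b g cy cz c₁≢0 (λ t t≡0 → none (t , t≡0))
      decide (no none) = pair-bound y t y≢0 t≡0 z only
        where
        t : Fin k
        t = proj₁ (third k≥3 y z)
        t≡0 : restrict S c t ≡ + 0
        t≡0 = decidable-stable (_ ℤ.≟ _) (λ t≢0 → none (t , proj₁ (proj₂ (third k≥3 y z)) , proj₂ (proj₂ (third k≥3 y z)) , t≢0))
        only : ∀ i → i ≢ y → restrict S c i ≢ + 0 → i ≡ z
        only i i≢y i≢0 = decidable-stable (i ≟ z) (λ i≢z → none (i , i≢y , i≢z , i≢0))

-- Rational bounds

toℚᵘ-toℚ : ∀ n → ℚ.toℚᵘ (toℚ n) ℚᵘ.≃ mkℚᵘ (+ n) 0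
toℚᵘ-toℚ n = ℚₚ.toℚᵘ-fromℚᵘ (mkℚᵘ (+ n) 0)

toℚ-+ : ∀ m n → toℚ (m + n) ≡ toℚ m ℚ.+ toℚ n
toℚ-+ m n = ℚₚ.toℚᵘ-injective (begin
  ℚ.toℚᵘ (toℚ (m + n))                       ≈⟨ toℚᵘ-toℚ (m + n) ⟩
  mkℚᵘ (+ (m + n)) 0                         ≈⟨ *≡* (cong (ℤ._* + 1) (trans (ℤₚ.pos-+ m n) (sym (cong₂ ℤ._+_ (ℤₚ.*-identityʳ (+ m)) (ℤₚ.*-identityʳ (+ n)))))) ⟩
  mkℚᵘ (+ m) 0 ℚᵘ.+ mkℚᵘ (+ n) 0             ≈⟨ ℚᵘₚ.+-cong (toℚᵘ-toℚ m) (toℚᵘ-toℚ n) ⟨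
  ℚ.toℚᵘ (toℚ m) ℚᵘ.+ ℚ.toℚᵘ (toℚ n)         ≈⟨ ℚₚ.toℚᵘ-homo-+ (toℚ m) (toℚ n) ⟨
  ℚ.toℚᵘ (toℚ m ℚ.+ toℚ n)                   ∎)
  where open ℚᵘₚ.≃-Reasoning

toℚ-* : ∀ m n → toℚ (m * n) ≡ toℚ m ℚ.* toℚ n
toℚ-* m n = ℚₚ.toℚᵘ-injective (begin
  ℚ.toℚᵘ (toℚ (m * n))                       ≈⟨ toℚᵘ-toℚ (m * n) ⟩
  mkℚᵘ (+ (m * n)) 0                         ≈⟨ *≡* (cong (ℤ._* + 1) (ℤₚ.pos-* m n)) ⟩
  mkℚᵘ (+ m) 0 ℚᵘ.* mkℚᵘ (+ n) 0             ≈⟨ ℚᵘₚ.*-cong (toℚᵘ-toℚ m) (toℚᵘ-toℚ n) ⟨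
  ℚ.toℚᵘ (toℚ m) ℚᵘ.* ℚ.toℚᵘ (toℚ n)         ≈⟨ ℚₚ.toℚᵘ-homo-* (toℚ m) (toℚ n) ⟨
  ℚ.toℚᵘ (toℚ m ℚ.* toℚ n)                   ∎)
  where open ℚᵘₚ.≃-Reasoning

toℚ-mono : ∀ {m n} → m ≤ n → toℚ m ℚ.≤ toℚ n
toℚ-mono {m} {n} m≤n = ℚₚ.toℚᵘ-cancel-≤ (begin
  ℚ.toℚᵘ (toℚ m)     ≃⟨ toℚᵘ-toℚ m ⟩
  mkℚᵘ (+ m) 0       ≤⟨ *≤* (ℤₚ.*-monoʳ-≤-nonNeg (+ 1) (ℤ.+≤+ m≤n)) ⟩
  mkℚᵘ (+ n) 0       ≃⟨ toℚᵘ-toℚ n ⟨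
  ℚ.toℚᵘ (toℚ n)     ∎)
  where open ℚᵘₚ.≤-Reasoning

toℚ-nonNegative : ∀ n → ℚ.NonNegative (toℚ n)
toℚ-nonNegative n = ℚ.nonNegative (toℚ-mono {0} {n} z≤n)

toℚ-positive : ∀ n → ℚ.Positive (toℚ (suc n))
toℚ-positive n = ℚₚ.normalize-pos (suc n) 1

-- The denominator of δ serves, as the numerator is at least 1.
reciprocal-bound : ∀ δ → 0ℚ ℚ.< δ → Σ ℕ λ d → toℚ 1 ℚ.≤ toℚ (suc d) ℚ.* δ
reciprocal-bound (mkℚ (+ zero)   d _) (ℚ.*<* (ℤ.+<+ ()))
reciprocal-bound δ@(mkℚ (+ suc a) d _) _ = d , ℚₚ.toℚᵘ-cancel-≤ (begin
  ℚ.toℚᵘ (toℚ 1)                                  ≃⟨ toℚᵘ-toℚ 1 ⟩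
  mkℚᵘ (+ 1) 0                                    ≤⟨ *≤* (ℤ.+≤+ (cross a d)) ⟩
  mkℚᵘ (+ suc d) 0 ℚᵘ.* mkℚᵘ (+ suc a) d          ≃⟨ ℚᵘₚ.*-congʳ (toℚᵘ-toℚ (suc d)) ⟨
  ℚ.toℚᵘ (toℚ (suc d)) ℚᵘ.* ℚ.toℚᵘ δ              ≃⟨ ℚₚ.toℚᵘ-homo-* (toℚ (suc d)) δ ⟨
  ℚ.toℚᵘ (toℚ (suc d) ℚ.* δ)                      ∎)
  where
  open ℚᵘₚ.≤-Reasoning
  cross : ∀ a d → 1 * (1 * suc d) ≤ suc d * suc a * 1
  cross a d = ≤-trans (≤-reflexive (trans (*-identityˡ _) (*-identityˡ _))) (≤-trans (m≤m*n (suc d) (suc a)) (≤-reflexive (sym (*-identityʳ _))))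
reciprocal-bound (mkℚ -[1+ _ ] d _) (ℚ.*<* ())

-- Rounds ε p down to a natural number. The search may stop at p, since no set of residues is
-- larger.
largest-below : ∀ x → 0ℚ ℚ.≤ x → ∀ N → Σ ℕ λ r → toℚ r ℚ.≤ x × (∀ n → n ≤ N → toℚ n ℚ.≤ x → n ≤ r)
largest-below x 0≤x zero = 0 , 0≤x , λ n n≤0 _ → n≤0
largest-below x 0≤x (suc N) with toℚ (suc N) ℚ.≤? x
... | yes le = suc N , le , λ n n≤ _ → n≤
... | no ¬le with r , r≤x , max ← largest-below x 0≤x N = r , r≤x , λ n n≤ n≤x →
  max n (≤-pred (≤∧≢⇒< n≤ (λ { refl → ¬le n≤x }))) n≤x

-- The argument yields the constant (10 k + 1) k², and 10 k + 1 ≤ 11 k ≤ 100 k leaves ample room.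
constant-suffices : ∀ k r → k * walkBound k r * k ≤ 100 ^ (k + 1) * k ^ 3 * r
constant-suffices zero r = z≤n
constant-suffices k@(suc _) r = begin
  k * walkBound k r * k                ≡⟨ regroup k r ⟩
  (10 * k + 1) * (k * k) * r           ≤⟨ *-monoˡ-≤ r (*-monoˡ-≤ (k * k) (≤-trans (+-monoʳ-≤ (10 * k) (s≤s z≤n)) (≤-trans (≤-reflexive (eleven k)) (*-monoˡ-≤ k {11} {100} (≤ᵇ⇒≤ 11 100 _))))) ⟩
  100 * k * (k * k) * r                ≤⟨ *-monoˡ-≤ r (≤-trans (≤-reflexive (cube k)) (*-monoˡ-≤ (k ^ 3) hundred)) ⟩
  100 ^ (k + 1) * k ^ 3 * r            ∎
  where
  open ≤-Reasoning
  regroup : ∀ k r → k * (suc (2 * (5 * k)) * r) * k ≡ (10 * k + 1) * (k * k) * r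
  regroup = solve-∀
  eleven : ∀ k → 10 * k + k ≡ 11 * k
  eleven = solve-∀
  cube : ∀ k → 100 * k * (k * k) ≡ 100 * (k * (k * (k * 1)))
  cube = solve-∀
  hundred : 100 ≤ 100 ^ (k + 1)
  hundred = ≤-trans (≤-reflexive (sym (*-identityʳ 100))) (^-monoʳ-≤ 100 (m≤n+m 1 k))

module _ (ε δ : ℚ) (d : ℕ) (d≥ : toℚ 1 ℚ.≤ toℚ (suc d) ℚ.* δ) where

  rational-bound : ∀ K r p a → toℚ r ℚ.≤ ε ℚ.* toℚ p → suc d * a ≤ p + suc d * (K * r) →
    toℚ a ℚ.≤ (toℚ K ℚ.* ε ℚ.+ δ) ℚ.* toℚ p
  rational-bound K r p a r≤ a≤ = ℚₚ.*-cancelˡ-≤-pos (toℚ (suc d)) {{toℚ-positive d}} (begin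
    D ℚ.* toℚ a                                             ≡⟨ toℚ-* (suc d) a ⟨
    toℚ (suc d * a)                                         ≤⟨ toℚ-mono a≤ ⟩
    toℚ (p + suc d * (K * r))                               ≡⟨ trans (toℚ-+ p _) (cong₂ ℚ._+_ (sym (ℚₚ.*-identityˡ (toℚ p)))
                                                                (trans (toℚ-* (suc d) (K * r)) (cong (D ℚ.*_) (toℚ-* K r)))) ⟩
    toℚ 1 ℚ.* toℚ p ℚ.+ D ℚ.* (toℚ K ℚ.* toℚ r)             ≤⟨ ℚₚ.+-mono-≤ (ℚₚ.*-monoʳ-≤-nonNeg (toℚ p) {{toℚ-nonNegative p}} d≥)
                                                                (ℚₚ.*-monoˡ-≤-nonNeg D {{toℚ-nonNegative (suc d)}}
                                                                  (ℚₚ.*-monoˡ-≤-nonNeg (toℚ K) {{toℚ-nonNegative K}} r≤)) ⟩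
    D ℚ.* δ ℚ.* toℚ p ℚ.+ D ℚ.* (toℚ K ℚ.* (ε ℚ.* toℚ p))   ≡⟨ cong₂ ℚ._+_ (ℚₚ.*-assoc D δ (toℚ p)) (cong (D ℚ.*_) (sym (ℚₚ.*-assoc (toℚ K) ε (toℚ p)))) ⟩
    D ℚ.* (δ ℚ.* toℚ p) ℚ.+ D ℚ.* (toℚ K ℚ.* ε ℚ.* toℚ p)   ≡⟨ ℚₚ.*-distribˡ-+ D _ _ ⟨
    D ℚ.* (δ ℚ.* toℚ p ℚ.+ toℚ K ℚ.* ε ℚ.* toℚ p)           ≡⟨ cong (D ℚ.*_) (trans (ℚₚ.+-comm (δ ℚ.* toℚ p) (toℚ K ℚ.* ε ℚ.* toℚ p)) (sym (ℚₚ.*-distribʳ-+ (toℚ p) (toℚ K ℚ.* ε) δ))) ⟩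
    D ℚ.* ((toℚ K ℚ.* ε ℚ.+ δ) ℚ.* toℚ p)                   ∎)
    where
    open ℚₚ.≤-Reasoning
    D : ℚ
    D = toℚ (suc d)

theorem3p1 : (k : ℕ) → 3 ≤ k → (c : Fin k → ℤ) → (∀ i → c i ≢ + 0) →
    Degenerate k c →
    (ε : ℚ) → 0ℚ ℚ.< ε →
    (δ : ℚ) → 0ℚ ℚ.< δ →
    Σ ℕ λ P → (p : ℕ) → Prime p → P ≤ p →
    (A : Subset p) → SolutionFree k c p A → αCay≤ p A ε →
    toℚ ∣ A ∣ ℚ.≤ (toℚ (100 ^ (k + 1) * (k ^ 3)) ℚ.* ε ℚ.+ δ) ℚ.* toℚ p
theorem3p1 k k≥3 c c≢0 (S , nonempty , ΣS≡0) ε ε>0 δ δ>0 = P₀ + 2 * suc d * ℓ , λ p p-prime P≤p A free α →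
  let r , r≤ , largest = largest-below (ε ℚ.* toℚ p) (0≤ p) p
      sized = bound p p-prime (≤-trans (m≤m+n P₀ _) P≤p) A free r (λ J indep → largest ∣ J ∣ (∣p∣≤n J) (α J indep))
  in rational-bound ε δ d d≥ K r p ∣ A ∣ r≤ (halve p ∣ A ∣ (k * walkBound k r * k) (K * r) (constant-suffices k r)
       (≤-trans (m≤n+m _ P₀) P≤p) sized)
  where
  K d P₀ ℓ : ℕ
  K = 100 ^ (k + 1) * (k ^ 3)
  d = proj₁ (reciprocal-bound δ δ>0)
  d≥ : toℚ 1 ℚ.≤ toℚ (suc d) ℚ.* δ
  d≥ = proj₂ (reciprocal-bound δ δ>0)
  -- `d + suc (d + 0)` is the predecessor of 2 (d + 1): Roth's theorem is applied with half of the
  -- slack, and p ≥ 2 (d + 1) ℓ lets the other half absorb ℓ.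
  sizes : SizeBound (d + suc (d + 0)) k c
  sizes = size-bound k k≥3 c c≢0 S (trans (sym (Σℤ-over-restrict k S c)) ΣS≡0) (d + suc (d + 0)) nonempty
  P₀ = proj₁ sizes
  ℓ = proj₁ (proj₂ sizes)
  bound = proj₂ (proj₂ sizes)
  0≤ : ∀ p → 0ℚ ℚ.≤ ε ℚ.* toℚ p
  0≤ p = subst (ℚ._≤ ε ℚ.* toℚ p) (ℚₚ.*-zeroˡ (toℚ p)) (ℚₚ.*-monoʳ-≤-nonNeg (toℚ p) {{toℚ-nonNegative p}} (ℚₚ.<⇒≤ ε>0))
  halve : ∀ p a N N′ → N ≤ N′ → 2 * suc d * ℓ ≤ p → 2 * suc d * a ≤ p + 2 * suc d * (ℓ + N) → suc d * a ≤ p + suc d * N′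
  halve p a N N′ N≤N′ ℓ≤p a≤ = *-cancelˡ-≤ 2 (begin
    2 * (suc d * a)                            ≡⟨ *-assoc 2 (suc d) a ⟨
    2 * suc d * a                              ≤⟨ a≤ ⟩
    p + 2 * suc d * (ℓ + N)                    ≡⟨ cong (λ x → p + x) (*-distribˡ-+ (2 * suc d) ℓ N) ⟩
    p + (2 * suc d * ℓ + 2 * suc d * N)        ≤⟨ +-monoʳ-≤ p (+-mono-≤ ℓ≤p (scale (2 * suc d) N≤N′)) ⟩
    p + (p + 2 * suc d * N′)                   ≡⟨ regroup p (suc d) N′ ⟩
    2 * (p + suc d * N′)                       ∎)
    where
    open ≤-Reasoning
    regroup : ∀ p d n → p + (p + 2 * d * n) ≡ 2 * (p + d * n)
    regroup = solve-∀
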